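{- For every integer $r\geq 3$, there exists $n_1\in\mathbb{N}$ such that for all integers $n\geq n_1$ and every proper subset $A\subsetneq [n]$, we have $g_r(A)<g_r([n])$.
   Context: $[n]=\{1,2,\ldots,n\}$. A 3-term arithmetic progression (3-AP) of $A\subseteq[n]$ is a sequence $a, a+d, a+2d$ of elements of $A$ with $d\in[n]$ (so $d\ge 1$). An $r$-coloring of $A$ is any map $c\colon A\to[r]$ (not necessarily surjective). A 3-AP of $A$ is rainbow under $c$ if its three terms have pairwise distinct colors; $c$ is rainbow 3-AP-free if no 3-AP of $A$ is rainbow. $g_r(A)$ denotes the number of rainbow 3-AP-free $r$-colorings of $A$. -}

module Defs where

open import Data.Nat using (ℕ; suc; _+_; _*_)
import Data.Nat as ℕ
open import Data.Fin using (Fin; zero; suc; toℕ; _≟_)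
open import Data.Fin.Properties using (all?; any?)
open import Data.Fin.Subset using (Subset; inside; outside; _∈_)
open import Data.Fin.Subset.Properties using (_∈?_)
open import Data.List using (List; [_]; map; filter; length; allFin; cartesianProductWith)
import Data.List.Membership.Propositional as List
open import Data.List.Membership.Propositional.Properties
  using (∈-map⁺; ∈-cartesianProductWith⁺; ∈-allFin)
import Data.List.Relation.Unary.All as All
import Data.List.Relation.Unary.AllPairs as AllPairs
import Data.List.Relation.Unary.Any as Any
open import Data.List.Relation.Unary.Unique.Propositional using (Unique)
open import Data.List.Relation.Unary.Unique.Propositional.Properties
  using (map⁺; cartesianProductWith⁺; allFin⁺)
open import Data.Product using (∃; _×_; _,_)
open import Data.Vec using ([]; _∷_; here; there)
open import Relation.Binary.PropositionalEquality
  using (_≡_; _≢_; refl; cong; cong₂; subst)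
open import Relation.Nullary using (Dec; yes; no; ¬_; ¬?; contradiction; _×-dec_; _→-dec_)
open import Relation.Nullary.Decidable using (map′)

private
  variable
    n r : ℕ

-- The set [n] = {1, …, n} is Fin n, with i standing for the integer 1 + toℕ i;
-- [r] is Fin r.  The common difference ranges over [n] in the same way.

Is3AP : Fin n → Fin n → Fin n → Set
Is3AP {n} x y z = ∃ λ (i : Fin n) →
  let d = suc (toℕ i) in
    suc (toℕ y) ≡ suc (toℕ x) + d
  × suc (toℕ z) ≡ suc (toℕ x) + 2 * d

is3AP? : (x y z : Fin n) → Dec (Is3AP x y z)
is3AP? x y z = any? λ i → (_ ℕ.≟ _) ×-dec (_ ℕ.≟ _)

-- A map A → [r], stored as the table of its values: one colour for each
-- element of A and no data at the positions outside A.  Using tables makes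
-- propositional equality coincide with pointwise equality of maps (see
-- `colour-injective` and `colour-tabulate`).

data Coloring (r : ℕ) : {n : ℕ} → Subset n → Set where
  []   : Coloring r []
  _∷_  : {A : Subset n} → Fin r → Coloring r A → Coloring r (inside ∷ A)
  skip : {A : Subset n} → Coloring r A → Coloring r (outside ∷ A)

colour : {A : Subset n} → Coloring r A → {x : Fin n} → x ∈ A → Fin r
colour (k ∷ c)  here      = k
colour (k ∷ c)  (there p) = colour c p
colour (skip c) (there p) = colour c p

tabulate : (A : Subset n) → (∀ {x} → x ∈ A → Fin r) → Coloring r A
tabulate []            f = []
tabulate (inside ∷ A)  f = f here ∷ tabulate A (λ p → f (there p))
tabulate (outside ∷ A) f = skip (tabulate A (λ p → f (there p)))

colour-tabulate : (A : Subset n) (f : ∀ {x} → x ∈ A → Fin r) →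
                  ∀ {x} (p : x ∈ A) → colour (tabulate A f) p ≡ f p
colour-tabulate (inside ∷ A)  f here      = refl
colour-tabulate (inside ∷ A)  f (there p) = colour-tabulate A (λ q → f (there q)) p
colour-tabulate (outside ∷ A) f (there p) = colour-tabulate A (λ q → f (there q)) p

colour-injective : {A : Subset n} (c c′ : Coloring r A) →
                   (∀ {x} (p : x ∈ A) → colour c p ≡ colour c′ p) → c ≡ c′
colour-injective []       []         eq = refl
colour-injective (k ∷ c)  (k′ ∷ c′)  eq =
  cong₂ _∷_ (eq here) (colour-injective c c′ λ p → eq (there p))
colour-injective (skip c) (skip c′)  eq =
  cong skip (colour-injective c c′ λ p → eq (there p))

Rainbow : Fin r → Fin r → Fin r → Set
Rainbow i j k = i ≢ j × i ≢ k × j ≢ k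

RainbowFree : {A : Subset n} → Coloring r A → Set
RainbowFree {A = A} c =
  ∀ x y z (p : x ∈ A) (q : y ∈ A) (s : z ∈ A) →
  Is3AP x y z → ¬ Rainbow (colour c p) (colour c q) (colour c s)

∈-irrelevant : {A : Subset n} {x : Fin n} (p q : x ∈ A) → p ≡ q
∈-irrelevant here      here      = refl
∈-irrelevant (there p) (there q) = cong there (∈-irrelevant p q)

∀∈? : {A : Subset n} (x : Fin n) {P : x ∈ A → Set} →
      (∀ p → Dec (P p)) → Dec (∀ p → P p)
∀∈? {A = A} x {P} P? with x ∈? A
... | no x∉A = yes λ p → contradiction p x∉A
... | yes p  = map′ (λ h q → subst P (∈-irrelevant p q) h) (λ h → h p) (P? p)

rainbowFree? : {A : Subset n} (c : Coloring r A) → Dec (RainbowFree c)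
rainbowFree? c =
  all? λ x → all? λ y → all? λ z →
  ∀∈? x λ p → ∀∈? y λ q → ∀∈? z λ s →
  is3AP? x y z →-dec ¬? (rainbow? (colour c p) (colour c q) (colour c s))
  where
  rainbow? : ∀ i j k → Dec (Rainbow i j k)
  rainbow? i j k = ¬? (i ≟ j) ×-dec ¬? (i ≟ k) ×-dec ¬? (j ≟ k)

-- Every r-colouring of A, listed exactly once (`∈-colorings`, `colorings-unique`).

colorings : (r : ℕ) (A : Subset n) → List (Coloring r A)
colorings r []            = [ [] ]
colorings r (inside ∷ A)  = cartesianProductWith _∷_ (allFin r) (colorings r A)
colorings r (outside ∷ A) = map skip (colorings r A)

∈-colorings : {A : Subset n} (c : Coloring r A) → c List.∈ colorings r A
∈-colorings []       = Any.here refl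
∈-colorings (k ∷ c)  = ∈-cartesianProductWith⁺ _∷_ (∈-allFin k) (∈-colorings c)
∈-colorings (skip c) = ∈-map⁺ skip (∈-colorings c)

colorings-unique : (r : ℕ) (A : Subset n) → Unique (colorings r A)
colorings-unique r []            = All.[] AllPairs.∷ AllPairs.[]
colorings-unique r (inside ∷ A)  =
  cartesianProductWith⁺ _∷_ (λ { refl → refl , refl }) (allFin⁺ r) (colorings-unique r A)
colorings-unique r (outside ∷ A) = map⁺ (λ { refl → refl }) (colorings-unique r A)

g : (r : ℕ) → Subset n → ℕ
g r A = length (filter rainbowFree? (colorings r A))

{-# OPTIONS --safe #-}

-- Colourings with at most two colours are rainbow-free; passing from A to [n] at least doubles their
-- number, and [n] has at least 2ⁿ of them.  So it suffices that fewer than 2ⁿ⁻¹ rainbow-free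
-- colourings of A use three colours.  Fix points z₁, z₂, z₃ of distinct colours and let F be the set of
-- rainbow-free colourings of A with these three values.
--
-- If F realised, on a set X of points, all choices from three-element palettes, then X would contain no
-- 3-AP, so |X| ≤ n/K by Roth's theorem.  By a Sauer–Shelah argument, up to a factor exponential in n/K,
-- F is then no larger than if every point had a palette of two colours.
--
-- This gives about 2ⁿ, and the zᵢ save an exponential factor.  Take a chain x, y, w, u with y midway
-- between x and z₁, w midway between y and z₂, u midway between w and z₃.  If all 16 patterns of some
-- two-colour palettes occurred on it, then each zᵢ would force the palettes of its two neighbours to
-- agree and to contain its colour, giving three colours in one palette.  So at most 15 patterns occur,
-- and there are about n/256 pairwise disjoint chains.
--
-- Roth's theorem is obtained by a density increment.  A dense X contains a Hilbert cube of bounded size;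
-- the sets Dᵢ of reflections 2s − v (s in X, v in the i-th subcube) increase and avoid X, so some
-- Dᵢ₊₁ = Dᵢ ∪ (Dᵢ − d) is hardly larger than Dᵢ.  Then the complement of Dᵢ, which contains X beyond the
-- cube, is nearly a union of long progressions of difference d, and X is denser on one of them.
module Submission where

open import Defs
open import Data.Nat using (ℕ; _≤_; _<_; _≥_)
open import Data.Fin.Subset using (Subset; _⊂_; ⊤)
open import Data.Product using (∃-syntax)

open import Data.Bool as Bool using (Bool; true; false; if_then_else_; _∧_; _∨_; not)
open import Data.Empty using (⊥; ⊥-elim)
open import Data.Fin using (Fin; zero; suc; toℕ; fromℕ<; _≟_)
import Data.Fin.Properties as Fin
open import Data.Fin.Subset using () renaming (_∈_ to _∈ˢ_; _∉_ to _∉ˢ_)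
open import Data.Fin.Subset.Properties using (∈⊤) renaming (_∈?_ to _∈ˢ?_)
open import Data.List
  using (List; []; _∷_; _++_; length; map; filter; concat; cartesianProductWith; allFin; downFrom)
import Data.List as List
open import Data.List.Membership.Propositional using (_∈_; _∉_)
open import Data.List.Membership.Propositional.Properties
  using (∈-cartesianProductWith⁺; ∈-cartesianProductWith⁻; ∈-allFin; ∈-++⁺ˡ; ∈-++⁺ʳ; ∈-++⁻; ∈-filter⁺; ∈-filter⁻;
         ∈-map⁻; ∈-tabulate⁺; ∈-tabulate⁻; ∈-downFrom⁺)
import Data.List.Properties as List
open import Data.List.Relation.Unary.All using (All; []; _∷_)
import Data.List.Relation.Unary.All as All
import Data.List.Relation.Unary.All.Properties as All
open import Data.List.Relation.Unary.AllPairs using (AllPairs; []; _∷_)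
import Data.List.Relation.Unary.AllPairs as AllPairs
import Data.List.Relation.Unary.AllPairs.Properties as AllPairs
open import Data.List.Relation.Unary.Any using (here; there)
import Data.List.Relation.Unary.Any as Any
open import Data.List.Relation.Unary.Unique.Propositional using (Unique)
import Data.List.Relation.Unary.Unique.Propositional.Properties as Unique
open import Data.Nat as ℕ hiding (_≟_)
open import Data.Nat.DivMod using (_/_; _%_; m≡m%n+[m/n]*n; m%n<n; m/n*n≤m; m*n/n≡m; /-monoˡ-≤; m/n≤m)
open import Data.Nat.Properties hiding (_≟_)
open import Data.Nat.Tactic.RingSolver using (solve-∀)
open import Data.Product using (∃; _×_; _,_; proj₁; proj₂)
open import Data.Sum using (_⊎_; inj₁; inj₂)
open import Data.Unit using (tt) renaming (⊤ to Unit)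
open import Data.Vec using (Vec; []; _∷_; lookup)
import Data.Vec as Vec
import Data.Vec.Properties as Vec
open import Function using (_∘_; id)
open import Relation.Binary using (DecidableEquality; tri<; tri≈; tri>)
open import Relation.Binary.PropositionalEquality
  using (_≡_; _≢_; refl; sym; trans; cong; cong₂; subst; module ≡-Reasoning)
open import Relation.Nullary using (Dec; yes; no; does; ¬_; ¬?; contradiction; _×-dec_; _→-dec_)
open import Relation.Nullary.Decidable using (map′; decidable-stable)
open import Relation.Unary using (Decidable)

-- With palettes alone the count is 2ⁿ times a factor exponential in n/K, and no choice of K brings
-- that below 2ⁿ⁻¹. The chains save a fixed factor 31/32 for each of about n/256 chains, while the
-- losses are `Λ ^ D` with D about n/K and the number `(n * r) ^ 3` of choices of the zᵢ and their
-- colours. Hence the order of choices: Λ depends on `r` only, then K is taken large for Λ, and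
-- Roth's theorem is needed for every K but without any rate. A chain has three links because the
-- contradiction takes three colours in one palette, and each zᵢ contributes just one. Nothing is
-- known about `A`, which may be small or contain no whole chain. Every colouring of `A` is
-- therefore extended to [n] by a fixed colour, and all n points are counted; a point outside `A`
-- shows a single colour, so it is never worse than a palette of two. The increment argument for
-- Roth's theorem runs over bounds p/q with q fixed: p drops by one at each round, so no limiting
-- density has to be formed.

private
  variable
    A B : Set
    P : A → Set

-- Finite sums

-- Linear arithmetic by certificate: l ≤ u collects the hypotheses, s is the slack, and the
-- equation is a semiring identity.
≤-linear : ∀ {a b l u} s → l ≤ u → b + l ≡ a + u + s → a ≤ b
≤-linear {a} {b} {l} {u} s l≤u eq = +-cancelʳ-≤ u a b (begin
  a + u      ≤⟨ m≤m+n (a + u) s ⟩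
  a + u + s  ≡⟨ eq ⟨
  b + l      ≤⟨ +-monoʳ-≤ b l≤u ⟩
  b + u      ∎)
  where open ≤-Reasoning

sumTo : (ℕ → ℕ) → ℕ → ℕ
sumTo f zero    = 0
sumTo f (suc n) = sumTo f n + f n

sumTo-+ : ∀ f m n → sumTo f (m + n) ≡ sumTo f m + sumTo (λ i → f (m + i)) n
sumTo-+ f m zero    rewrite +-identityʳ m = sym (+-identityʳ _)
sumTo-+ f m (suc n) rewrite +-suc m n | sumTo-+ f m n = +-assoc (sumTo f m) _ _

sumTo-mono : ∀ {f h} n → (∀ i → i < n → f i ≤ h i) → sumTo f n ≤ sumTo h n
sumTo-mono zero    f≤h = z≤n
sumTo-mono (suc n) f≤h =
  +-mono-≤ (sumTo-mono n λ i i<n → f≤h i (m<n⇒m<1+n i<n)) (f≤h n (n<1+n n))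

sumTo-cong : ∀ {f h} n → (∀ i → i < n → f i ≡ h i) → sumTo f n ≡ sumTo h n
sumTo-cong zero    f≡h = refl
sumTo-cong (suc n) f≡h =
  cong₂ _+_ (sumTo-cong n λ i i<n → f≡h i (m<n⇒m<1+n i<n)) (f≡h n (n<1+n n))

sumTo-add : ∀ f h n → sumTo (λ i → f i + h i) n ≡ sumTo f n + sumTo h n
sumTo-add f h zero    = refl
sumTo-add f h (suc n) rewrite sumTo-add f h n = 
  let a = sumTo f n; b = sumTo h n; c = f n; d = h n in lemma a b c d
  where
  lemma : ∀ a b c d → a + b + (c + d) ≡ a + c + (b + d)
  lemma = solve-∀

sumTo-*ˡ : ∀ k f n → sumTo (λ i → k * f i) n ≡ k * sumTo f n
sumTo-*ˡ k f zero    = sym (*-zeroʳ k)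
sumTo-*ˡ k f (suc n) rewrite sumTo-*ˡ k f n = sym (*-distribˡ-+ k _ _)

sumTo-const : ∀ k n → sumTo (λ _ → k) n ≡ n * k
sumTo-const k zero    = refl
sumTo-const k (suc n) rewrite sumTo-const k n = +-comm (n * k) k

sumTo-swap : ∀ (F : ℕ → ℕ → ℕ) m n →
             sumTo (λ i → sumTo (F i) n) m ≡ sumTo (λ j → sumTo (λ i → F i j) m) n
sumTo-swap F m zero    = trans (sumTo-const 0 m) (*-zeroʳ m)
sumTo-swap F m (suc n) =
  trans (sumTo-add (λ i → sumTo (F i) n) (λ i → F i n) m)
        (cong (_+ sumTo (λ i → F i n) m) (sumTo-swap F m n))

sumTo-average : ∀ f m n → 1 ≤ n → n * m ≤ sumTo f n → ∃[ i ] i < n × m ≤ f i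
sumTo-average f m (suc n) _ nm≤ with m ≤? f n
... | yes m≤fn = n , n<1+n n , m≤fn
sumTo-average f m (suc zero)      _ nm≤ | no m≰ = contradiction (subst (_≤ f 0) (*-identityˡ m) nm≤) m≰
sumTo-average f m (suc n@(suc _)) _ nm≤ | no m≰ =
  let i , i<n , m≤fi = sumTo-average f m n (s≤s z≤n)
                         (+-cancelˡ-≤ m _ _ (≤-trans nm≤ (≤-trans (+-monoʳ-≤ (sumTo f n) (≰⇒≥ m≰)) (≤-reflexive (+-comm _ m)))))
  in i , m<n⇒m<1+n i<n , m≤fi

window : (ℕ → ℕ) → ℕ → ℕ → ℕ
window f a n = sumTo (λ i → f (a + i)) n

window-+ : ∀ f a m n → window f a (m + n) ≡ window f a m + window f (a + m) n
window-+ f a m n =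
  trans (sumTo-+ _ m n)
        (cong (sumTo _ m +_) (sumTo-cong n λ i _ → cong f (sym (+-assoc a m i))))

window-⊆ : ∀ f a b m n → a ≤ b → b + m ≤ a + n → window f b m ≤ window f a n
window-⊆ f a b m n a≤b b+m≤a+n with m≤n⇒∃[o]m+o≡n a≤b
... | d , refl with m≤n⇒∃[o]m+o≡n (+-cancelˡ-≤ a (d + m) n (subst (_≤ a + n) (+-assoc a d m) b+m≤a+n))
... | e , refl = begin
  window f (a + d) m                                           ≤⟨ m≤n+m _ _ ⟩
  window f a d + window f (a + d) m                            ≡⟨ window-+ f a d m ⟨
  window f a (d + m)                                           ≤⟨ m≤m+n _ _ ⟩
  window f a (d + m) + window f (a + (d + m)) e                ≡⟨ window-+ f a (d + m) e ⟨
  window f a (d + m + e)                                       ∎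
  where open ≤-Reasoning

𝟙 : Bool → ℕ
𝟙 true  = 1
𝟙 false = 0

𝟙≤1 : ∀ b → 𝟙 b ≤ 1
𝟙≤1 true  = s≤s z≤n
𝟙≤1 false = z≤n

count : (ℕ → Bool) → ℕ → ℕ
count X n = sumTo (𝟙 ∘ X) n

count≤ : ∀ X n → count X n ≤ n
count≤ X n = ≤-trans (sumTo-mono n λ i _ → 𝟙≤1 (X i)) (≤-reflexive (trans (sumTo-const 1 n) (*-identityʳ n)))

-- Hilbert cubes

Cube : (ℕ → Bool) → ℕ → List ℕ → Set
Cube X x []       = X x ≡ true
Cube X x (d ∷ ds) = Cube X x ds × Cube X (x + d) ds

Cube-map : ∀ {X Y} (f : ℕ → ℕ) → (∀ x → X x ≡ true → Y (f x) ≡ true) →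
           (∀ x d → f (x + d) ≡ f x + d) →
           ∀ x ds → Cube X x ds → Cube Y (f x) ds
Cube-map         f X⇒Y f-shift x []       c        = X⇒Y x c
Cube-map {X} {Y} f X⇒Y f-shift x (d ∷ ds) (c , c′) =
  Cube-map {X} {Y} f X⇒Y f-shift x ds c ,
  subst (λ y → Cube Y y ds) (f-shift x d) (Cube-map {X} {Y} f X⇒Y f-shift (x + d) ds c′)

∧-true : ∀ {a b} → a ∧ b ≡ true → a ≡ true × b ≡ true
∧-true {true} {true} refl = refl , refl

∨-true : ∀ {a b} → a ∨ b ≡ true → a ≡ true ⊎ b ≡ true
∨-true {true}          refl = inj₁ refl
∨-true {false} {true}  refl = inj₂ refl

count-witness : ∀ X n → 1 ≤ count X n → ∃[ x ] X x ≡ true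
count-witness X (suc n) 1≤ with X n in eq
... | true  = n , eq
... | false = count-witness X n (subst (1 ≤_) (+-identityʳ _) 1≤)

successors : (ℕ → Bool) → ℕ → ℕ → ℕ
successors X g y = sumTo (λ d → 𝟙 (X y ∧ X (y + suc d))) g

-- The first element of `X` in the window has all later ones among its successors, as they lie
-- within distance `g`; only that first element itself goes unpaid.
window≤successors : ∀ X g a → window (𝟙 ∘ X) a g ≤ 1 + window (successors X g) a g
window≤successors X g a = go g ≤-refl a
  where
  open ≤-Reasoning
  head : ∀ f a n → window f a (suc n) ≡ f a + window f (suc a) n
  head f a n = trans (window-+ f a 1 n)
                 (cong₂ _+_ (cong f (+-identityʳ a)) (cong (λ b → window f b n) (+-comm a 1)))
  go : ∀ l → l ≤ g → ∀ a → window (𝟙 ∘ X) a l ≤ 1 + window (successors X g) a l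
  go zero    _   a = z≤n
  go (suc l) l<g a rewrite head (𝟙 ∘ X) a l | head (successors X g) a l with X a in eq
  ... | false = ≤-trans (go l (<⇒≤ l<g) (suc a)) (s≤s (m≤n+m _ _))
  ... | true  = s≤s (begin
    window (𝟙 ∘ X) (suc a) l                        ≡⟨ sumTo-cong l (λ i _ → cong (𝟙 ∘ X) (sym (+-suc a i))) ⟩
    sumTo (λ d → 𝟙 (X (a + suc d))) l               ≤⟨ window-⊆ (λ d → 𝟙 (X (a + suc d))) 0 0 l g z≤n (<⇒≤ l<g) ⟩
    sumTo (λ d → 𝟙 (X (a + suc d))) g               ≤⟨ m≤m+n _ _ ⟩
    _ + window (successors X g) (suc a) l           ∎)

count≤successors : ∀ X g J → count X (J * g) ≤ J + sumTo (successors X g) (J * g)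
count≤successors X g zero    = z≤n
count≤successors X g (suc J)
  rewrite +-comm g (J * g) | sumTo-+ (𝟙 ∘ X) (J * g) g | sumTo-+ (successors X g) (J * g) g =
  ≤-linear 0 (+-mono-≤ (count≤successors X g J) (window≤successors X g (J * g)))
    (lemma (count X (J * g)) (window (𝟙 ∘ X) (J * g) g) J
           (sumTo (successors X g) (J * g)) (window (successors X g) (J * g) g))
  where
  lemma : ∀ a b j c d → suc j + (c + d) + (a + b) ≡ a + b + (j + c + (1 + d)) + 0
  lemma = solve-∀

SupportedBelow : ℕ → (ℕ → Bool) → Set
SupportedBelow m X = ∀ x → X x ≡ true → x < m

common : (ℕ → Bool) → ℕ → (ℕ → Bool)
common X d y = X y ∧ X (y + suc d)

-- A block of length 2q holds two elements of `X` on average, so close pairs are plentiful: at least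
-- m/(4q) of them have distance at most 2q. One of these 2q distances then occurs m/(8q²) times. The
-- incomplete last block is paid for by `4 * q ≤ m`.
dense-common : ∀ q m X → 1 ≤ q → 4 * q ≤ m → SupportedBelow m X → m ≤ q * count X m →
               ∃[ d ] d < 2 * q × m ≤ 8 * (q * q) * count (common X d) m
dense-common q m X 1≤q 4q≤m X<m m≤qX =
  let d , d<G , le = sumTo-average (λ d → 8 * (q * q) * count (common X d) m) m G 1≤G total
  in d , d<G , le
  where
  G = 2 * q
  1≤G : 1 ≤ G
  1≤G = ≤-trans 1≤q (m≤m+n q _)
  instance
    G≢0 : NonZero G
    G≢0 = >-nonZero 1≤G
  J = suc (m / G)
  Z = sumTo (successors X G) m

  m≤JG : m ≤ J * G
  m≤JG = begin
    m                    ≡⟨ m≡m%n+[m/n]*n m G ⟩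
    m % G + m / G * G    ≤⟨ +-monoˡ-≤ _ (<⇒≤ (m%n<n m G)) ⟩
    G + m / G * G        ∎
    where open ≤-Reasoning

  JG≤ : J * G ≤ G + m
  JG≤ = +-monoʳ-≤ G (≤-trans (m≤n+m _ (m % G)) (≤-reflexive (sym (m≡m%n+[m/n]*n m G))))

  -- Rounding `m` up to full blocks creates no pairs, because `X` ends before `m`.
  tail-zero : ∀ k → window (successors X G) m k ≡ 0
  tail-zero k = trans (sumTo-cong k λ i _ → trans (sumTo-cong G λ d _ → cong 𝟙 (outside i d)) (trans (sumTo-const 0 G) (*-zeroʳ G)))
                      (trans (sumTo-const 0 k) (*-zeroʳ k))
    where
    outside : ∀ i d → X (m + i) ∧ X (m + i + suc d) ≡ false
    outside i d with X (m + i) in eq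
    ... | false = refl
    ... | true  = contradiction (X<m _ eq) (m+n≮m m i)

  cX≤ : count X m ≤ J + Z
  cX≤ with m≤n⇒∃[o]m+o≡n m≤JG
  ... | k , m+k≡JG = begin
    count X m                              ≤⟨ window-⊆ (𝟙 ∘ X) 0 0 m (J * G) z≤n m≤JG ⟩
    count X (J * G)                        ≤⟨ count≤successors X G J ⟩
    J + sumTo (successors X G) (J * G)     ≡⟨ cong (λ l → J + sumTo (successors X G) l) m+k≡JG ⟨
    J + sumTo (successors X G) (m + k)     ≡⟨ cong (J +_) (sumTo-+ (successors X G) m k) ⟩
    J + (Z + window (successors X G) m k)  ≡⟨ cong (λ z → J + (Z + z)) (tail-zero k) ⟩
    J + (Z + 0)                            ≡⟨ cong (J +_) (+-identityʳ Z) ⟩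
    J + Z                                  ∎
    where open ≤-Reasoning

  m≤4qZ : m ≤ 4 * q * Z
  m≤4qZ = ≤-linear 0 hyp (lemma m q Z J (count X m))
    where
    hyp : 4 * (m) + (4 * q * count X m + (2 * (J * G) + 4 * q))
        ≤ 4 * (q * count X m) + (4 * q * (J + Z) + (2 * (G + m) + m))
    hyp = +-mono-≤ (*-monoʳ-≤ 4 m≤qX) (+-mono-≤ (*-monoʳ-≤ (4 * q) cX≤) (+-mono-≤ (*-monoʳ-≤ 2 JG≤) 4q≤m))
    lemma : ∀ m q z j c → 4 * q * z + (4 * m + (4 * q * c + (2 * (j * (2 * q)) + 4 * q)))
          ≡ m + (4 * (q * c) + (4 * q * (j + z) + (2 * (2 * q + m) + m))) + 0
    lemma = solve-∀

  total : G * m ≤ sumTo (λ d → 8 * (q * q) * count (common X d) m) G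
  total = begin
    G * m                                                         ≤⟨ *-monoʳ-≤ G m≤4qZ ⟩
    G * (4 * q * Z)                                               ≡⟨ lemma q Z ⟩
    8 * (q * q) * Z                                               ≡⟨ cong (8 * (q * q) *_) (sumTo-swap (λ y d → 𝟙 (common X d y)) m G) ⟩
    8 * (q * q) * sumTo (λ d → count (common X d) m) G            ≡⟨ sumTo-*ˡ (8 * (q * q)) _ G ⟨
    sumTo (λ d → 8 * (q * q) * count (common X d) m) G            ∎
    where
    open ≤-Reasoning
    lemma : ∀ q z → 2 * q * (4 * q * z) ≡ 8 * (q * q) * z
    lemma = solve-∀

Step : ℕ → ℕ → Set
Step H d = 1 ≤ d × d ≤ H

-- Each side costs density: 1/q becomes 1/(8q²). What matters later is that `H` and `M` depend on
-- `k` and `q` alone, so the side lengths stay bounded while the interval grows.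
dense⇒cube : ∀ k q → 1 ≤ q → ∃[ H ] ∃[ M ] (∀ m X → M ≤ m → SupportedBelow m X → m ≤ q * count X m →
             ∃[ x ] ∃[ ds ] length ds ≡ k × All (Step H) ds × Cube X x ds)
dense⇒cube zero q _ = 0 , 1 , λ m X 1≤m _ m≤qX →
  let x , Xx = count-witness X m (n≢0⇒n>0 λ eq → <⇒≱ 1≤m (≤-trans m≤qX (≤-reflexive (trans (cong (q *_) eq) (*-zeroʳ q)))))
  in x , [] , refl , [] , Xx
dense⇒cube (suc k) q 1≤q with dense⇒cube k (8 * (q * q)) (*-mono-≤ {1} {8} (s≤s z≤n) (*-mono-≤ 1≤q 1≤q))
... | H , M , cube = H + 2 * q , M + 4 * q , λ m X M≤m X<m m≤qX →
  let d , d<g , le = dense-common q m X 1≤q (≤-trans (m≤n+m _ M) M≤m) X<m m≤qX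
      x , ds , len , steps , c = cube m (common X d) (≤-trans (m≤m+n M _) M≤m) (λ y Yy → let Xy , _ = ∧-true Yy in X<m y Xy) le
  in x , suc d ∷ ds , cong suc len
   , (s≤s z≤n , ≤-trans d<g (m≤n+m _ H)) ∷ All.map (λ (1≤e , e≤H) → 1≤e , ≤-trans e≤H (m≤m+n H _)) steps
   , Cube-map (λ y → y) (λ y Yy → let Xy , _ = ∧-true Yy in Xy) (λ _ _ → refl) x ds c
   , Cube-map (_+ suc d) (λ y Yy → let _ , Xy = ∧-true Yy in Xy) (λ y e → lemma y e d) x ds c
  where
  lemma : ∀ y e d → y + e + suc d ≡ y + suc d + e
  lemma = solve-∀

-- Reflections of a cube

APFree : (ℕ → Bool) → Set
APFree X = ∀ a d → X a ≡ true → X (a + suc d) ≡ true → X (a + suc d + suc d) ≡ true → ⊥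

APFree-shift : ∀ {X} a → APFree X → APFree (λ i → X (a + i))
APFree-shift {X} a free b d p q s =
  free (a + b) d p (subst (λ y → X y ≡ true) (sym (+-assoc a b (suc d))) q)
    (subst (λ y → X y ≡ true) (lemma a b (suc d)) s)
  where
  lemma : ∀ a b c → a + (b + c + c) ≡ a + b + c + c
  lemma = solve-∀

APFree-scale : ∀ {X} d → 1 ≤ d → APFree X → APFree (λ i → X (i * d))
APFree-scale {X} (suc d) _ free b e p q s =
  free (b * suc d) (d + e * suc d) p (subst (λ y → X y ≡ true) (lemma b e d) q)
    (subst (λ y → X y ≡ true) (lemma′ b e d) s)
  where
  lemma : ∀ b e d → (b + (1 + e)) * (1 + d) ≡ b * (1 + d) + (1 + (d + e * (1 + d)))
  lemma = solve-∀
  lemma′ : ∀ b e d → (b + (1 + e) + (1 + e)) * (1 + d) ≡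
                     b * (1 + d) + (1 + (d + e * (1 + d))) + (1 + (d + e * (1 + d)))
  lemma′ = solve-∀

-- The indicator of the set of all 2s with s in `X`; recursion in steps of two takes the place of a
-- parity test.
double : (ℕ → Bool) → ℕ → Bool
double X zero          = X zero
double X (suc zero)    = false
double X (suc (suc t)) = double (X ∘ suc) t

double-witness : ∀ X t → double X t ≡ true → ∃[ s ] s + s ≡ t × X s ≡ true
double-witness X zero          p = 0 , refl , p
double-witness X (suc (suc t)) p =
  let s , eq , q = double-witness (X ∘ suc) t p
  in suc s , cong suc (trans (+-suc s s) (cong suc eq)) , q

double-even : ∀ X a t → double X (a + a + t) ≡ double (λ i → X (a + i)) t
double-even X zero    t = refl
double-even X (suc a) t rewrite +-suc a a = double-even (X ∘ suc) a t

double-odd : ∀ X n → double X (suc (n + n)) ≡ false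
double-odd X zero    = refl
double-odd X (suc n) rewrite +-suc n n = double-odd (X ∘ suc) n

count-double : ∀ X n → count (double X) (n + n) ≡ count X n
count-double X zero    = refl
count-double X (suc n)
  rewrite +-suc n n | double-odd X n | +-identityʳ (count (double X) (n + n) + 𝟙 (double X (n + n)))
        | count-double X n =
  cong (λ b → count X n + 𝟙 b)
    (trans (cong (double X) (sym (+-identityʳ (n + n)))) (trans (double-even X n 0) (cong X (+-identityʳ n))))

-- reflections X x ds is the set of points 2 s − v with s in X and v in the
-- cube with base point x and side lengths ds.
reflections : (ℕ → Bool) → ℕ → List ℕ → ℕ → Bool
reflections X x []       y = double X (x + y)
reflections X x (d ∷ ds) y = reflections X x ds y ∨ reflections X x ds (y + d)

-- Only the sum of base point and argument enters, so moving either has the same effect. Thus the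
-- second half of a cube with side `d` is the cube based at `x + d`.
reflections-shift : ∀ X x d ds y → reflections X x ds (y + d) ≡ reflections X (x + d) ds y
reflections-shift X x d []       y = cong (double X) (lemma x d y)
  where
  lemma : ∀ x d y → x + (y + d) ≡ x + d + y
  lemma = solve-∀
reflections-shift X x d (e ∷ ds) y =
  cong₂ _∨_ (reflections-shift X x d ds y)
    (trans (cong (reflections X x ds) (lemma y d e)) (reflections-shift X x d ds (y + e)))
  where
  lemma : ∀ y d e → y + d + e ≡ y + e + d
  lemma = solve-∀

reflections-witness : ∀ X Y x ds y → Cube Y x ds → reflections X x ds y ≡ true →
                      ∃[ v ] Y v ≡ true × double X (v + y) ≡ true
reflections-witness X Y x []       y c        p = x , c , p
reflections-witness X Y x (d ∷ ds) y (c , c′) p with ∨-true p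
... | inj₁ q = reflections-witness X Y x ds y c q
... | inj₂ q = reflections-witness X Y (x + d) ds y c′ (trans (sym (reflections-shift X x d ds y)) q)

-- The base point itself gives all points 2s - x, whatever sides are added. This keeps the set large
-- enough for `size-lower`.
reflections-base : ∀ X x ds y → 𝟙 (double X (x + y)) ≤ 𝟙 (reflections X x ds y)
reflections-base X x []       y = ≤-refl
reflections-base X x (d ∷ ds) y with reflections X x ds y | reflections-base X x ds y
... | true  | le = le
... | false | le = ≤-trans le z≤n

-- A reflection y = 2s - v with v < m ≤ y has s strictly between v and y, so v, s, y is a
-- progression; v and s lie in `X`, hence y does not.
reflections-free : ∀ X Y m x ds → APFree X → SupportedBelow m Y → (∀ v → Y v ≡ true → X v ≡ true) →
                   Cube Y x ds → ∀ y → m ≤ y → reflections X x ds y ≡ true → X y ≡ false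
reflections-free X Y m x ds free Y<m Y⊆X c y m≤y p with X y in Xy
... | false = refl
... | true  = ⊥-elim (go Xy)
  where
  go : X y ≡ true → ⊥
  go Xy with reflections-witness X Y x ds y c p
  ... | v , Yv , q with double-witness X (v + y) q
  ... | s , s+s≡v+y , Xs with m≤n⇒∃[o]m+o≡n (<-≤-trans (Y<m v Yv) m≤y)
  ... | k , refl with m≤n⇒∃[o]m+o≡n v<s
    where
    v<s : v < s
    v<s = ≰⇒> λ s≤v → <⇒≢ (≤-<-trans (+-mono-≤ s≤v s≤v) (+-monoʳ-< v (s≤s (m≤m+n v k)))) s+s≡v+y
  ... | e , refl = free v e (Y⊆X v Yv)
        (subst (λ z → X z ≡ true) (sym (+-suc v e)) Xs)
        (subst (λ z → X z ≡ true) (+-cancelˡ-≡ v _ _ (trans (sym s+s≡v+y) (lemma v e))) Xy)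
    where
    lemma : ∀ v e → (1 + v + e) + (1 + v + e) ≡ v + (v + (1 + e) + (1 + e))
    lemma = solve-∀

-- Density transfer along runs

-- For the reflections of a cube these are exactly the points gained by adding the side `d`: a small
-- gain means that runs of difference `d` seldom enter the set.
entry : (ℕ → Bool) → ℕ → ℕ → Bool
entry E d y = not (E y) ∧ E (y + d)

module _ (X E : ℕ → Bool) (m : ℕ) (disjoint : ∀ y → m ≤ y → E y ≡ true → X y ≡ false) where

  -- A run that ends in E without entering it lies in E, hence misses X.
  run-into : ∀ d y L → m ≤ y → E (y + L * d) ≡ true →
             sumTo (λ j → 𝟙 (X (y + j * d))) L ≤ L * sumTo (λ j → 𝟙 (entry E d (y + j * d))) L
  run-into d y zero    _   _ = z≤n
  run-into d y (suc L) m≤y e with E (y + L * d) in eq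
  ... | true  = begin
    xs + 𝟙 (X (y + L * d))      ≡⟨ cong (λ b → xs + 𝟙 b) (disjoint _ (≤-trans m≤y (m≤m+n y _)) eq) ⟩
    xs + 0                      ≡⟨ +-identityʳ xs ⟩
    xs                          ≤⟨ run-into d y L m≤y eq ⟩
    L * es                      ≤⟨ m≤n+m _ es ⟩
    suc L * es                  ≤⟨ *-monoʳ-≤ (suc L) (m≤m+n es _) ⟩
    suc L * (es + 0)            ∎
    where
    open ≤-Reasoning
    xs = sumTo (λ j → 𝟙 (X (y + j * d))) L
    es = sumTo (λ j → 𝟙 (entry E d (y + j * d))) L
  ... | false = begin
    sumTo (λ j → 𝟙 (X (y + j * d))) (suc L)    ≤⟨ count≤ (λ j → X (y + j * d)) (suc L) ⟩
    suc L                                      ≡⟨ *-identityʳ (suc L) ⟨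
    suc L * 1                                  ≤⟨ *-monoʳ-≤ (suc L) (≤-trans (≤-reflexive (sym entering)) (m≤n+m _ es)) ⟩
    suc L * (es + 𝟙 (E (y + L * d + d)))       ∎
    where
    open ≤-Reasoning
    es = sumTo (λ j → 𝟙 (entry E d (y + j * d))) L
    entering : 𝟙 (E (y + L * d + d)) ≡ 1
    entering = cong 𝟙 (trans (cong E (trans (+-assoc y (L * d) d) (cong (y +_) (+-comm (L * d) d)))) e)

  module _ (q p L d : ℕ) (L≥1 : 1 ≤ L)
           (upper : ∀ y → q * sumTo (λ j → 𝟙 (X (y + j * d))) L ≤ p * L) where

    run : ℕ → ℕ
    run y = sumTo (λ j → 𝟙 (X (y + j * d))) L

    -- The point just after the run decides: if it lies outside `E`, the density bound for runs
    -- applies, otherwise `run-into` does. Testing at this single point makes the sum over all runs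
    -- count each point of the complement at most once.
    run-bound : ∀ y → m ≤ y → q * run y ≤ p * L * 𝟙 (not (E (y + L * d)))
                                       + q * L * sumTo (λ j → 𝟙 (entry E d (y + j * d))) L
    run-bound y m≤y with E (y + L * d) in eq
    ... | false = ≤-trans (upper y) (≤-trans (≤-reflexive (sym (*-identityʳ (p * L)))) (m≤m+n _ _))
    ... | true  = ≤-trans (*-monoʳ-≤ q (run-into d y L m≤y eq))
                    (≤-trans (≤-reflexive (sym (*-assoc q L _))) (m≤n+m _ _))

    module _ (n k : ℕ) (n≡ : k + L * d ≡ n) where

      complement entryCount : ℕ
      complement = window (𝟙 ∘ not ∘ E) m n
      entryCount = window (𝟙 ∘ entry E d) m n

      shifted : ∀ f j → j ≤ L → window f (m + j * d) k ≤ window f m n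
      shifted f j j≤L = window-⊆ f m (m + j * d) k n (m≤m+n m _) (begin
        m + j * d + k    ≡⟨ +-assoc m _ k ⟩
        m + (j * d + k)  ≤⟨ +-monoʳ-≤ m (+-monoˡ-≤ k (*-monoˡ-≤ d j≤L)) ⟩
        m + (L * d + k)  ≡⟨ cong (m +_) (trans (+-comm (L * d) k) n≡) ⟩
        m + n            ∎)
        where open ≤-Reasoning

      swapped : ∀ (Y : ℕ → Bool) → sumTo (λ i → sumTo (λ j → 𝟙 (Y (m + i + j * d))) L) k
                ≡ sumTo (λ j → window (𝟙 ∘ Y) (m + j * d) k) L
      swapped Y = trans (sumTo-swap _ k L)
        (sumTo-cong L λ j _ → sumTo-cong k λ i _ → cong (𝟙 ∘ Y) (lemma m i (j * d)))
        where
        lemma : ∀ m i e → m + i + e ≡ m + e + i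
        lemma = solve-∀

      runs-upper : q * sumTo (λ i → run (m + i)) k ≤ p * L * complement + q * L * (L * entryCount)
      runs-upper = begin
        q * sumTo (λ i → run (m + i)) k
          ≡⟨ sumTo-*ˡ q _ k ⟨
        sumTo (λ i → q * run (m + i)) k
          ≤⟨ sumTo-mono k (λ i _ → run-bound (m + i) (m≤m+n m i)) ⟩
        sumTo (λ i → p * L * 𝟙 (not (E (m + i + L * d))) + q * L * sumTo (λ j → 𝟙 (entry E d (m + i + j * d))) L) k
          ≡⟨ sumTo-add _ _ k ⟩
        sumTo (λ i → p * L * 𝟙 (not (E (m + i + L * d)))) k + sumTo (λ i → q * L * sumTo (λ j → 𝟙 (entry E d (m + i + j * d))) L) k
          ≡⟨ cong₂ _+_ (sumTo-*ˡ (p * L) _ k) (sumTo-*ˡ (q * L) _ k) ⟩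
        p * L * sumTo (λ i → 𝟙 (not (E (m + i + L * d)))) k + q * L * sumTo (λ i → sumTo (λ j → 𝟙 (entry E d (m + i + j * d))) L) k
          ≤⟨ +-mono-≤ (*-monoʳ-≤ (p * L) first) (*-monoʳ-≤ (q * L) second) ⟩
        p * L * complement + q * L * (L * entryCount) ∎
        where
        open ≤-Reasoning
        lemma : ∀ m i e → m + i + e ≡ m + e + i
        lemma = solve-∀
        first : sumTo (λ i → 𝟙 (not (E (m + i + L * d)))) k ≤ complement
        first = begin
          sumTo (λ i → 𝟙 (not (E (m + i + L * d)))) k  ≡⟨ sumTo-cong k (λ i _ → cong (𝟙 ∘ not ∘ E) (lemma m i (L * d))) ⟩
          window (𝟙 ∘ not ∘ E) (m + L * d) k           ≤⟨ shifted (𝟙 ∘ not ∘ E) L ≤-refl ⟩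
          complement                                      ∎
        second : sumTo (λ i → sumTo (λ j → 𝟙 (entry E d (m + i + j * d))) L) k ≤ L * entryCount
        second = begin
          _                                                          ≡⟨ swapped (entry E d) ⟩
          sumTo (λ j → window (𝟙 ∘ entry E d) (m + j * d) k) L       ≤⟨ sumTo-mono L (λ j j<L → shifted (𝟙 ∘ entry E d) j (<⇒≤ j<L)) ⟩
          sumTo (λ _ → entryCount) L                                    ≡⟨ sumTo-const entryCount L ⟩
          L * entryCount                                                ∎

      -- For every `j`, the j-th terms of the runs sweep out the whole window except at most `L * d`
      -- points near its two ends.
      runs-lower : L * window (𝟙 ∘ X) m n ≤ sumTo (λ i → run (m + i)) k + L * (L * d)
      runs-lower = begin
        L * window (𝟙 ∘ X) m n                                            ≡⟨ sumTo-const _ L ⟨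
        sumTo (λ _ → window (𝟙 ∘ X) m n) L                                ≤⟨ sumTo-mono L each ⟩
        sumTo (λ j → window (𝟙 ∘ X) (m + j * d) k + L * d) L              ≡⟨ sumTo-add _ _ L ⟩
        sumTo (λ j → window (𝟙 ∘ X) (m + j * d) k) L + sumTo (λ _ → L * d) L
                                                                          ≡⟨ cong₂ _+_ (sym (swapped X)) (sumTo-const (L * d) L) ⟩
        sumTo (λ i → run (m + i)) k + L * (L * d)                         ∎
        where
        open ≤-Reasoning
        each : ∀ j → j < L → window (𝟙 ∘ X) m n ≤ window (𝟙 ∘ X) (m + j * d) k + L * d
        each j j<L with m≤n⇒∃[o]m+o≡n (*-monoˡ-≤ d (<⇒≤ j<L))
        ... | e , jd+e≡Ld = begin
          window χ m n                                               ≡⟨ cong (window χ m) n≡′ ⟩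
          window χ m (j * d + (k + e))                               ≡⟨ window-+ χ m (j * d) (k + e) ⟩
          window χ m (j * d) + window χ (m + j * d) (k + e)          ≡⟨ cong (window χ m (j * d) +_) (window-+ χ (m + j * d) k e) ⟩
          window χ m (j * d) + (w + window χ (m + j * d + k) e)      ≤⟨ +-mono-≤ (count≤ _ (j * d)) (+-monoʳ-≤ w (count≤ _ e)) ⟩
          j * d + (w + e)                                            ≡⟨ lemma (j * d) w e ⟩
          w + (j * d + e)                                            ≡⟨ cong (w +_) jd+e≡Ld ⟩
          w + L * d                                                  ∎
          where
          χ = 𝟙 ∘ X
          w = window χ (m + j * d) k
          lemma : ∀ a w e → a + (w + e) ≡ w + (a + e)
          lemma = solve-∀
          n≡′ : n ≡ j * d + (k + e)
          n≡′ = trans (sym n≡) (trans (cong (k +_) (sym jd+e≡Ld)) (sym (lemma (j * d) k e)))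

      -- Double counting of the terms of all runs, divided by `L`: up to entries and end effects,
      -- `X` behaves as if confined to the complement of `E` with density at most p/q there.
      density-transfer : q * window (𝟙 ∘ X) m n ≤ p * complement + q * (L * entryCount) + q * (L * d)
      density-transfer = *-cancelˡ-≤ L {{>-nonZero L≥1}} (begin
        L * (q * x)                                                         ≡⟨ lemma L q x ⟩
        q * (L * x)                                                         ≤⟨ *-monoʳ-≤ q runs-lower ⟩
        q * (s + L * (L * d))                                               ≡⟨ *-distribˡ-+ q s _ ⟩
        q * s + q * (L * (L * d))                                           ≤⟨ +-monoˡ-≤ _ runs-upper ⟩
        p * L * complement + q * L * (L * entryCount) + q * (L * (L * d))         ≡⟨ lemma′ p L complement q entryCount d ⟩
        L * (p * complement + q * (L * entryCount) + q * (L * d))                 ∎)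
        where
        open ≤-Reasoning
        x = window (𝟙 ∘ X) m n
        s = sumTo (λ i → run (m + i)) k
        lemma : ∀ a b c → a * (b * c) ≡ b * (a * c)
        lemma = solve-∀
        lemma′ : ∀ p L o q e d → p * L * o + q * L * (L * e) + q * (L * (L * d)) ≡ L * (p * o + q * (L * e) + q * (L * d))
        lemma′ = solve-∀

-- Roth's theorem

-- An upper bound p/q on the density of progression-free sets. The denominator stays fixed, so an
-- improvement lowers `p` by one and finitely many improvements suffice.
Bounded : ℕ → ℕ → ℕ → Set
Bounded p q N = ∀ X n → N ≤ n → APFree X → q * count X n ≤ p * n

reflections-entry : ∀ X x d ds y →
  𝟙 (reflections X x (d ∷ ds) y) ≡ 𝟙 (reflections X x ds y) + 𝟙 (entry (reflections X x ds) d y)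
reflections-entry X x d ds y with reflections X x ds y
... | true  = refl
... | false = refl

𝟙-not : ∀ b → 𝟙 (not b) + 𝟙 b ≡ 1
𝟙-not true  = refl
𝟙-not false = refl

Cube-base : ∀ {X} x ds → Cube X x ds → X x ≡ true
Cube-base x []       c       = c
Cube-base x (d ∷ ds) (c , _) = Cube-base x ds c

-- Pigeonhole along the nested subcubes with common base point `x`: sides that each gain more than
-- `B` force the total up by `suc B` every time.
small-growth : ∀ (W : List ℕ → ℕ) B Y x H ds → All (Step H) ds → Cube Y x ds →
  (∃[ d ] ∃[ es ] Step H d × Cube Y x (d ∷ es) × W (d ∷ es) ≤ W es + B) ⊎ length ds * suc B ≤ W ds
small-growth W B Y x H []       _        _ = inj₂ z≤n
small-growth W B Y x H (d ∷ ds) (st All.∷ sts) c with W (d ∷ ds) ≤? W ds + B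
... | yes le = inj₁ (d , ds , st , c , le)
... | no  gt with small-growth W B Y x H ds sts (proj₁ c)
...   | inj₁ found = inj₁ found
...   | inj₂ le    = inj₂ (begin
  suc B + length ds * suc B  ≤⟨ +-monoʳ-≤ (suc B) le ⟩
  suc B + W ds               ≡⟨ cong suc (+-comm B (W ds)) ⟩
  suc (W ds + B)             ≤⟨ ≰⇒> gt ⟩
  W (d ∷ ds)                 ∎)
  where open ≤-Reasoning

-- The density increment

module Increment (q P L₀ : ℕ) (q≥1 : 1 ≤ q) (P≥2 : 2 ≤ P) (4q<P² : 4 * q + 4 ≤ P * P + 4 * P)
                 (bounded : Bounded (P + 4) q L₀) where

  L K : ℕ
  L = suc L₀
  -- With e ≤ m/K entries and a side d ≤ m/K, this `K` makes both error terms `q * q * L * e` and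
  -- `q * q * L * d` at most m.
  K = q * q * L

  K≥1 : 1 ≤ K
  K≥1 = *-mono-≤ {1} {q * q} {1} {L} (*-mono-≤ q≥1 q≥1) (s≤s z≤n)

  -- With `3 * K` sides, gains above m/K at every side would add up to more than 3m, the length of
  -- the window in which the sizes are measured.
  cubes = dense⇒cube (3 * K) q q≥1
  H = proj₁ cubes
  M = proj₁ (proj₂ cubes)

  threshold : ℕ
  threshold = 1 + L + M + K * H + (4 * q * q + 4 * q * (P + 4)) + 4 * q

  module Contradiction (X : ℕ → Bool) (free : APFree X) (m : ℕ) (m≥ : threshold ≤ m)
                       (large : (P + 3) * (4 * m) ≤ q * count X (4 * m) + 4 * q) where

    χ = 𝟙 ∘ X
    a₀ = window χ 0 m
    a₁ = window χ m m
    a₂ = window χ (m + m) (m + m)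
    a₃ = window χ m (3 * m)

    open ≤-Reasoning

    s₁ = 1 + L + M + K * H + (4 * q * q + 4 * q * (P + 4))
    s₂ = 1 + L + M + K * H
    s₃ = 1 + L + M
    m≥s₁ : s₁ ≤ m
    m≥s₁ = ≤-trans (m≤m+n s₁ (4 * q)) m≥
    m≥4q : 4 * q ≤ m
    m≥4q = ≤-trans (m≤n+m (4 * q) s₁) m≥
    m≥e : 4 * q * q + 4 * q * (P + 4) ≤ m
    m≥e = ≤-trans (m≤n+m _ s₂) m≥s₁
    m≥s₂ : s₂ ≤ m
    m≥s₂ = ≤-trans (m≤m+n s₂ _) m≥s₁
    m≥KH : K * H ≤ m
    m≥KH = ≤-trans (m≤n+m (K * H) s₃) m≥s₂
    m≥s₃ : s₃ ≤ m
    m≥s₃ = ≤-trans (m≤m+n s₃ _) m≥s₂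
    m≥M : M ≤ m
    m≥M = ≤-trans (m≤n+m M (1 + L)) m≥s₃
    m≥1+L : 1 + L ≤ m
    m≥1+L = ≤-trans (m≤m+n (1 + L) M) m≥s₃
    m≥L₀ : L₀ ≤ m
    m≥L₀ = ≤-trans (≤-trans (n≤1+n L₀) (n≤1+n L)) m≥1+L
    m≥1 : 1 ≤ m
    m≥1 = ≤-trans (s≤s z≤n) m≥1+L

    upper : ∀ a n → L₀ ≤ n → q * window χ a n ≤ (P + 4) * n
    upper a n L₀≤n = bounded (λ i → X (a + i)) n L₀≤n (APFree-shift a free)

    m≤3m : m ≤ 3 * m
    m≤3m = m≤m+n m _

    split₃ : count X (4 * m) ≡ a₀ + a₃
    split₃ = sumTo-+ χ m (3 * m)

    split₁₂ : a₃ ≡ a₁ + a₂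
    split₁₂ = trans (cong (window χ m) (cong (λ z → m + (m + z)) (+-identityʳ m))) (window-+ χ m m (m + m))

    large′ : (P + 3) * (4 * m) ≤ q * (a₀ + a₃) + 4 * q
    large′ = subst (λ c → (P + 3) * (4 * m) ≤ q * c + 4 * q) split₃ large

    -- The bound (P + 4)/q on the other three quarters leaves P m - 4q for `q * a₀`, and this is at
    -- least m since P ≥ 2 and m ≥ 4q. The bounds on `a₁` and `a₃` arise in the same way.
    dense₀ : m ≤ q * a₀
    dense₀ = ≤-linear 0 (+-mono-≤ large′ (+-mono-≤ (upper m (3 * m) (≤-trans m≥L₀ m≤3m)) (+-mono-≤ m≥4q (*-monoˡ-≤ m P≥2))))
               (lemma P m q a₀ a₃)
      where
      lemma : ∀ P m q a b → q * a + ((P + 3) * (4 * m) + (q * b + (4 * q + 2 * m)))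
                ≡ m + (q * (a + b) + 4 * q + ((P + 4) * (3 * m) + (m + P * m))) + 0
      lemma = solve-∀

    dense₁ : P * m ≤ q * a₁ + 4 * q
    dense₁ = ≤-linear 0 (+-mono-≤ (subst (λ c → (P + 3) * (4 * m) ≤ q * (a₀ + c) + 4 * q) split₁₂ large′)
                          (+-mono-≤ (upper 0 m m≥L₀) (upper (m + m) (m + m) (≤-trans m≥L₀ (m≤m+n m m)))))
               (lemma P m q a₀ a₁ a₂)
      where
      lemma : ∀ P m q a b c → q * b + 4 * q + ((P + 3) * (4 * m) + (q * a + q * c))
                ≡ P * m + (q * (a + (b + c)) + 4 * q + ((P + 4) * m + (P + 4) * (m + m))) + 0
      lemma = solve-∀

    dense₃ : (3 * P + 8) * m ≤ q * a₃ + 4 * q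
    dense₃ = ≤-linear 0 (+-mono-≤ large′ (upper 0 m m≥L₀)) (lemma P m q a₀ a₃)
      where
      lemma : ∀ P m q a b → q * b + 4 * q + ((P + 3) * (4 * m) + q * a)
                ≡ (3 * P + 8) * m + (q * (a + b) + 4 * q + (P + 4) * m) + 0
      lemma = solve-∀

    Y : ℕ → Bool
    Y x = X x ∧ (x <ᵇ m)

    Y⊆X : ∀ v → Y v ≡ true → X v ≡ true
    Y⊆X v p = proj₁ (∧-true p)

    Y<m : SupportedBelow m Y
    Y<m v p = <ᵇ⇒< v m (subst Bool.T (sym (proj₂ (∧-true {X v} p))) _)

    count-Y : count Y m ≡ a₀
    count-Y = sumTo-cong m λ i i<m → cong 𝟙 (lemma i (<⇒<ᵇ i<m))
      where
      lemma : ∀ i → Bool.T (i <ᵇ m) → X i ∧ (i <ᵇ m) ≡ X i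
      lemma i t with i <ᵇ m | X i
      ... | true | true  = refl
      ... | true | false = refl

    module _ (x : ℕ) (x<m : x < m) where

      size : List ℕ → ℕ
      size ds = window (𝟙 ∘ reflections X x ds) m (3 * m)

      -- For s in [m, 2m) and x < m, the reflections 2s - x are distinct and fall in [m, 4m); so
      -- every element of `X` in the second quarter yields one.
      size-lower : ∀ ds → a₁ ≤ size ds
      size-lower ds = begin
        a₁                                                   ≡⟨ count-double (λ i → X (m + i)) m ⟨
        count (double (λ i → X (m + i))) (m + m)             ≡⟨ sumTo-cong (m + m) (λ i _ → cong 𝟙 (sym (double-even X m i))) ⟩
        window (𝟙 ∘ double X) (m + m) (m + m)                ≤⟨ window-⊆ (𝟙 ∘ double X) (x + m) (m + m) (m + m) (3 * m)
                                                                  (+-monoˡ-≤ m (<⇒≤ x<m)) (≤-trans (≤-reflexive (lemma m)) (+-monoˡ-≤ (3 * m) (m≤n+m m x))) ⟩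
        window (𝟙 ∘ double X) (x + m) (3 * m)                ≡⟨ sumTo-cong (3 * m) (λ i _ → cong (𝟙 ∘ double X) (+-assoc x m i)) ⟩
        window (λ y → 𝟙 (double X (x + y))) m (3 * m)        ≤⟨ sumTo-mono (3 * m) (λ i _ → reflections-base X x ds (m + i)) ⟩
        size ds                                              ∎
        where
        lemma : ∀ m → m + m + (m + m) ≡ m + 3 * m
        lemma = solve-∀

      module _ (d : ℕ) (ds : List ℕ) (step : Step H d) (cube : Cube Y x (d ∷ ds))
               (growth : size (d ∷ ds) ≤ size ds + m / suc (pred K)) where

        E = reflections X x ds

        disjoint : ∀ y → m ≤ y → E y ≡ true → X y ≡ false
        disjoint = reflections-free X Y m x ds free Y<m Y⊆X (proj₁ cube)

        K≡ : suc (pred K) ≡ K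
        K≡ = suc-pred K {{>-nonZero K≥1}}

        β = m / suc (pred K)

        Kβ≤m : K * β ≤ m
        Kβ≤m = ≤-trans (≤-reflexive (trans (cong (_* β) (sym K≡)) (*-comm (suc (pred K)) β))) (m/n*n≤m m (suc (pred K)))

        o e : ℕ
        o = window (𝟙 ∘ not ∘ E) m (3 * m)
        e = window (𝟙 ∘ entry E d) m (3 * m)

        e≤β : e ≤ β
        e≤β = +-cancelˡ-≤ (size ds) e β (begin
          size ds + e                                        ≡⟨ sumTo-add _ _ (3 * m) ⟨
          sumTo (λ i → 𝟙 (E (m + i)) + 𝟙 (entry E d (m + i))) (3 * m)
                                                             ≡⟨ sumTo-cong (3 * m) (λ i _ → reflections-entry X x d ds (m + i)) ⟨
          size (d ∷ ds)                                      ≤⟨ growth ⟩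
          size ds + β                                        ∎)

        o+a₁≤3m : o + a₁ ≤ 3 * m
        o+a₁≤3m = begin
          o + a₁                                                        ≤⟨ +-monoʳ-≤ o (size-lower ds) ⟩
          o + size ds                                                   ≡⟨ sumTo-add _ _ (3 * m) ⟨
          sumTo (λ i → 𝟙 (not (E (m + i))) + 𝟙 (E (m + i))) (3 * m)     ≡⟨ sumTo-cong (3 * m) (λ i _ → 𝟙-not (E (m + i))) ⟩
          sumTo (λ _ → 1) (3 * m)                                       ≡⟨ sumTo-const 1 (3 * m) ⟩
          3 * m * 1                                                     ≡⟨ *-identityʳ (3 * m) ⟩
          3 * m                                                         ∎

        Kd≤m : K * d ≤ m
        Kd≤m = ≤-trans (*-monoʳ-≤ K (proj₂ step)) m≥KH

        Ld≤3m : L * d ≤ 3 * m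
        Ld≤3m = begin
          L * d      ≤⟨ *-monoˡ-≤ d (≤-trans (≤-reflexive (sym (*-identityˡ L))) (*-monoˡ-≤ L (*-mono-≤ q≥1 q≥1))) ⟩
          K * d      ≤⟨ Kd≤m ⟩
          m          ≤⟨ m≤3m ⟩
          3 * m      ∎

        k = 3 * m ∸ L * d

        transfer : q * a₃ ≤ (P + 4) * o + q * (L * e) + q * (L * d)
        transfer = density-transfer X E m disjoint q (P + 4) L d (s≤s z≤n)
          (λ y → bounded (λ j → X (y + j * d)) L (n≤1+n L₀)
                   (APFree-scale {λ i → X (y + i)} d (proj₁ step) (APFree-shift y free)))
          (3 * m) k (m∸n+n≡m Ld≤3m)

        -- Beyond the cube, `X` must fit into the complement of `E`, of size at most 3m - a₁, at
        -- density about (P + 4)/q. With q a₁ ≥ P m - 4q this gives 3P + 8 ≤ 3P + 12 - P (P + 4)/q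
        -- up to errors, against `4q<P²`. Multiplied through by q m, that hypothesis leaves 4m to
        -- spare, of which entries, run ends and constant terms take at most m each.
        m≤0 : m ≤ 0
        m≤0 = ≤-linear 0
          (+-mono-≤ (*-monoʳ-≤ q transfer) (+-mono-≤ (*-monoʳ-≤ q dense₃) (+-mono-≤ (*-monoʳ-≤ (P + 4) dense₁)
          (+-mono-≤ (*-monoʳ-≤ ((P + 4) * q) o+a₁≤3m) (+-mono-≤ m≥e (+-mono-≤ (≤-trans (*-monoʳ-≤ K e≤β) Kβ≤m)
          (+-mono-≤ Kd≤m (*-monoˡ-≤ m 4q<P²))))))))
          (lemma P m q a₁ a₃ o L e d)
          where
          lemma : ∀ P m q a₁ a₃ o L e d →
            0 + (q * (q * a₃) + (q * ((3 * P + 8) * m) + ((P + 4) * (P * m) + ((P + 4) * q * (o + a₁) +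
              (4 * q * q + 4 * q * (P + 4) + (q * q * L * e + (q * q * L * d + (4 * q + 4) * m)))))))
            ≡ m + (q * ((P + 4) * o + q * (L * e) + q * (L * d)) + (q * (q * a₃ + 4 * q) + ((P + 4) * (q * a₁ + 4 * q) +
              ((P + 4) * q * (3 * m) + (m + (m + (m + (P * P + 4 * P) * m))))))) + 0
          lemma = solve-∀

    impossible : ⊥
    impossible with proj₂ (proj₂ cubes) m Y m≥M Y<m (≤-trans dense₀ (≤-reflexive (cong (q *_) (sym count-Y))))
    ... | x , ds , len , steps , c = finish
      where
      x<m : x < m
      x<m = Y<m x (Cube-base x ds c)
      β₀ = m / suc (pred K)
      m<K : m < K * suc β₀
      m<K = begin-strict
        m                                          ≡⟨ m≡m%n+[m/n]*n m (suc (pred K)) ⟩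
        m % suc (pred K) + β₀ * suc (pred K)        <⟨ +-monoˡ-< _ (m%n<n m (suc (pred K))) ⟩
        suc β₀ * suc (pred K)                       ≡⟨ *-comm (suc β₀) _ ⟩
        suc (pred K) * suc β₀                       ≡⟨ cong (_* suc β₀) (suc-pred K {{>-nonZero K≥1}}) ⟩
        K * suc β₀                                  ∎
      finish : ⊥
      finish with small-growth (size x x<m) β₀ Y x H ds steps c
      ... | inj₁ (d , es , st , c′ , growth) = <⇒≱ m≥1 (m≤0 x x<m d es st c′ growth)
      ... | inj₂ le = <-irrefl refl (begin-strict
        3 * m                      <⟨ *-monoʳ-< 3 m<K ⟩
        3 * (K * suc β₀)            ≡⟨ *-assoc 3 K (suc β₀) ⟨
        3 * K * suc β₀              ≡⟨ cong (_* suc β₀) len ⟨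
        length ds * suc β₀          ≤⟨ le ⟩
        size x x<m ds              ≤⟨ count≤ _ (3 * m) ⟩
        3 * m                      ∎)

  improved : Bounded (P + 3) q (4 * threshold)
  improved X n n≥ free with q * count X n ≤? (P + 3) * n
  ... | yes le = le
  ... | no  gt = ⊥-elim (Contradiction.impossible X free m m≥ (begin
    (P + 3) * (4 * m)                     ≤⟨ *-monoʳ-≤ (P + 3) 4m≤n ⟩
    (P + 3) * n                           ≤⟨ <⇒≤ (≰⇒> gt) ⟩
    q * count X n                         ≤⟨ *-monoʳ-≤ q count-n ⟩
    q * (count X (4 * m) + 4)             ≡⟨ *-distribˡ-+ q _ 4 ⟩
    q * count X (4 * m) + q * 4           ≡⟨ cong (q * count X (4 * m) +_) (*-comm q 4) ⟩
    q * count X (4 * m) + 4 * q           ∎))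
    where
    open ≤-Reasoning
    -- Cutting `n` down to a multiple of four drops fewer than four points, hence the `4 * q` in the
    -- hypothesis `large`.
    m = n / 4
    n≡ : n ≡ 4 * m + n % 4
    n≡ = trans (m≡m%n+[m/n]*n n 4) (trans (+-comm (n % 4) _) (cong (_+ n % 4) (*-comm m 4)))
    4m≤n : 4 * m ≤ n
    4m≤n = ≤-trans (m≤m+n (4 * m) (n % 4)) (≤-reflexive (sym n≡))
    count-n : count X n ≤ count X (4 * m) + 4
    count-n = begin
      count X n                                                      ≡⟨ cong (count X) n≡ ⟩
      count X (4 * m + n % 4)                                        ≡⟨ sumTo-+ _ (4 * m) (n % 4) ⟩
      count X (4 * m) + count (λ i → X (4 * m + i)) (n % 4)          ≤⟨ +-monoʳ-≤ (count X (4 * m)) (≤-trans (count≤ _ (n % 4)) (<⇒≤ (m%n<n n 4))) ⟩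
      count X (4 * m) + 4                                            ∎
    m≥ : threshold ≤ m
    m≥ = ≮⇒≥ λ m<t → <⇒≱ (begin-strict
      n                        ≡⟨ n≡ ⟩
      4 * m + n % 4            <⟨ +-monoʳ-< (4 * m) (m%n<n n 4) ⟩
      4 * m + 4                ≡⟨ +-comm (4 * m) 4 ⟩
      4 + 4 * m                ≡⟨ *-suc 4 m ⟨
      4 * suc m                ≤⟨ *-monoʳ-≤ 4 m<t ⟩
      4 * threshold            ∎) n≥

-- The increment works as long as P (P + 4) ≥ 4q + 4. This holds for P₀ and a fortiori above it, so
-- the descent can go on until the numerator is P₀ + 3.
bounded-descent : ∀ q P₀ → 1 ≤ q → 2 ≤ P₀ → 4 * q + 4 ≤ P₀ * P₀ + 4 * P₀ →
                  ∀ i → (∃[ N ] Bounded (P₀ + 3 + i) q N) → ∃[ N ] Bounded (P₀ + 3) q N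
bounded-descent q P₀ q≥1 P≥2 4q< zero    (N , b) = N , subst (λ p → Bounded p q N) (+-identityʳ (P₀ + 3)) b
bounded-descent q P₀ q≥1 P≥2 4q< (suc i) (N , b) =
  bounded-descent q P₀ q≥1 P≥2 4q< i
    (_ , subst (λ p → Bounded p q (4 * Increment.threshold q Pᵢ N q≥1 P≥ 4q<P b′)) (lemma P₀ i) (Increment.improved q Pᵢ N q≥1 P≥ 4q<P b′))
  where
  Pᵢ = P₀ + i
  P≥ : 2 ≤ Pᵢ
  P≥ = ≤-trans P≥2 (m≤m+n P₀ i)
  4q<P : 4 * q + 4 ≤ Pᵢ * Pᵢ + 4 * Pᵢ
  4q<P = ≤-trans 4q< (+-mono-≤ (*-mono-≤ (m≤m+n P₀ i) (m≤m+n P₀ i)) (*-monoʳ-≤ 4 (m≤m+n P₀ i)))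
  lemma : ∀ P i → P + i + 3 ≡ P + 3 + i
  lemma = solve-∀
  lemma′ : ∀ P i → P + 3 + (1 + i) ≡ P + i + 4
  lemma′ = solve-∀
  b′ : Bounded (Pᵢ + 4) q N
  b′ = subst (λ p → Bounded p q N) (lemma′ P₀ i) b

roth : ∀ K → 1 ≤ K → ∃[ N ] (∀ X n → N ≤ n → APFree X → K * count X n ≤ n)
roth K K≥1 = N , λ X n N≤n free → *-cancelˡ-≤ (25 * K) {{>-nonZero 25K≥1}} (begin
  25 * K * (K * count X n)          ≡⟨ lemma K (count X n) ⟩
  q * count X n                     ≤⟨ b X n N≤n free ⟩
  (2 * (5 * K) + 3) * n             ≤⟨ *-monoˡ-≤ n 10K+3≤25K ⟩
  25 * K * n                        ∎)
  where
  open ≤-Reasoning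
  -- The descent stalls near P² = 4q, at density about 2/√q. Taking q = (5K)² and P₀ = 10K gives P₀²
  -- = 4q exactly, and (10K + 3)/(25K²) ≤ 1/K.
  q = 5 * K * (5 * K)
  P₀ = 2 * (5 * K)
  25K≥1 : 1 ≤ 25 * K
  25K≥1 = *-mono-≤ {1} {25} (s≤s z≤n) K≥1
  5K≥1 : 1 ≤ 5 * K
  5K≥1 = *-mono-≤ {1} {5} (s≤s z≤n) K≥1
  lemma : ∀ K c → 25 * K * (K * c) ≡ 5 * K * (5 * K) * c
  lemma = solve-∀
  10K+3≤25K : 2 * (5 * K) + 3 ≤ 25 * K
  10K+3≤25K = ≤-linear (12 * K) (*-monoʳ-≤ 3 K≥1) (eq K)
    where
    eq : ∀ K → 25 * K + 3 * 1 ≡ 2 * (5 * K) + 3 + 3 * K + 12 * K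
    eq = solve-∀
  4q<P² : 4 * q + 4 ≤ P₀ * P₀ + 4 * P₀
  4q<P² = ≤-linear (36 * K) (*-monoʳ-≤ 4 K≥1) (eq K)
    where
    eq : ∀ K → 2 * (5 * K) * (2 * (5 * K)) + 4 * (2 * (5 * K)) + 4 * 1 ≡ 4 * (5 * K * (5 * K)) + 4 + 4 * K + 36 * K
    eq = solve-∀
  -- The starting point is the density bound 1, whose numerator q is enlarged to fit the descent.
  trivial : Bounded (P₀ + 3 + q) q 0
  trivial X n _ _ = *-mono-≤ (m≤n+m q (P₀ + 3)) (count≤ X n)
  descent = bounded-descent q P₀ (*-mono-≤ 5K≥1 5K≥1) (*-mono-≤ {2} {2} ≤-refl 5K≥1) 4q<P² q (0 , trivial)
  N = proj₁ descent
  b = proj₂ descent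

-- Counting over lists

indicator : Dec B → ℕ
indicator d = 𝟙 (does d)

indicator≤1 : (d : Dec B) → indicator d ≤ 1
indicator≤1 d = 𝟙≤1 (does d)

indicator-yes : (d : Dec B) → B → 1 ≤ indicator d
indicator-yes (yes _) _ = ≤-refl
indicator-yes (no ¬b) b = contradiction b ¬b

indicator-no : (d : Dec B) → ¬ B → indicator d ≡ 0
indicator-no (yes b) ¬b = contradiction b ¬b
indicator-no (no _)  _  = refl

sumOver : List A → (A → ℕ) → ℕ
sumOver []       f = 0
sumOver (x ∷ xs) f = f x + sumOver xs f

sumOver-mono : ∀ {f h : A → ℕ} xs → (∀ x → x ∈ xs → f x ≤ h x) → sumOver xs f ≤ sumOver xs h
sumOver-mono []       f≤h = z≤n
sumOver-mono (x ∷ xs) f≤h = +-mono-≤ (f≤h x (here refl)) (sumOver-mono xs λ y → f≤h y ∘ there)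

sumOver-add : ∀ (f h : A → ℕ) xs → sumOver xs (λ x → f x + h x) ≡ sumOver xs f + sumOver xs h
sumOver-add f h []       = refl
sumOver-add f h (x ∷ xs) = trans (cong (f x + h x +_) (sumOver-add f h xs)) (lemma (f x) (h x) (sumOver xs f) (sumOver xs h))
  where
  lemma : ∀ a b c d → a + b + (c + d) ≡ a + c + (b + d)
  lemma = solve-∀

sumOver-*ˡ : ∀ k (f : A → ℕ) xs → sumOver xs (λ x → k * f x) ≡ k * sumOver xs f
sumOver-*ˡ k f []       = sym (*-zeroʳ k)
sumOver-*ˡ k f (x ∷ xs) = trans (cong (k * f x +_) (sumOver-*ˡ k f xs)) (sym (*-distribˡ-+ k (f x) _))

sumOver-const : ∀ k (xs : List A) → sumOver xs (λ _ → k) ≡ length xs * k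
sumOver-const k []       = refl
sumOver-const k (x ∷ xs) = cong (k +_) (sumOver-const k xs)

sumOver-bound : ∀ {f : A → ℕ} k xs → (∀ x → x ∈ xs → f x ≤ k) → sumOver xs f ≤ length xs * k
sumOver-bound k xs f≤k = ≤-trans (sumOver-mono xs f≤k) (≤-reflexive (sumOver-const k xs))

sumOver-swap : ∀ (F : A → B → ℕ) xs ys →
               sumOver xs (λ x → sumOver ys (F x)) ≡ sumOver ys (λ y → sumOver xs (λ x → F x y))
sumOver-swap F []       ys = sym (trans (sumOver-const 0 ys) (*-zeroʳ (length ys)))
sumOver-swap F (x ∷ xs) ys =
  trans (cong (sumOver ys (F x) +_) (sumOver-swap F xs ys)) (sym (sumOver-add (F x) _ ys))

sumOver-++ : ∀ (f : A → ℕ) xs ys → sumOver (xs ++ ys) f ≡ sumOver xs f + sumOver ys f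
sumOver-++ f []       ys = refl
sumOver-++ f (x ∷ xs) ys = trans (cong (f x +_) (sumOver-++ f xs ys)) (sym (+-assoc (f x) _ _))

sumOver-map : ∀ (f : B → ℕ) (h : A → B) xs → sumOver (map h xs) f ≡ sumOver xs (f ∘ h)
sumOver-map f h []       = refl
sumOver-map f h (x ∷ xs) = cong (f (h x) +_) (sumOver-map f h xs)

sumOver-product : ∀ {C : Set} (op : A → B → C) (f : C → ℕ) xs ys →
                  sumOver (cartesianProductWith op xs ys) f ≡ sumOver xs (λ x → sumOver ys (λ y → f (op x y)))
sumOver-product op f []       ys = refl
sumOver-product op f (x ∷ xs) ys =
  trans (sumOver-++ f (map (op x) ys) _) (cong₂ _+_ (sumOver-map f (op x) ys) (sumOver-product op f xs ys))

member≤sumOver : ∀ (f : A → ℕ) {x xs} → x ∈ xs → f x ≤ sumOver xs f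
member≤sumOver f (here refl) = m≤m+n _ _
member≤sumOver f (there x∈)  = ≤-trans (member≤sumOver f x∈) (m≤n+m _ _)

length-filter≡sumOver : (P? : Decidable {A = A} P) → ∀ xs → length (filter P? xs) ≡ sumOver xs (λ x → indicator (P? x))
length-filter≡sumOver P? []       = refl
length-filter≡sumOver P? (x ∷ xs) with P? x
... | yes _ = cong suc (length-filter≡sumOver P? xs)
... | no  _ = length-filter≡sumOver P? xs

sumOver-unique≤1 : (P? : Decidable {A = A} P) → ∀ {xs} → Unique xs →
                   (∀ {x y} → P x → P y → x ≡ y) → sumOver xs (λ x → indicator (P? x)) ≤ 1
sumOver-unique≤1 P? []                       unique = z≤n
sumOver-unique≤1 P? {x ∷ xs} (x∉xs ∷ xs!) unique with P? x
... | no  _  = sumOver-unique≤1 P? xs! unique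
... | yes Px = s≤s (≤-trans (sumOver-bound 0 xs λ y y∈xs →
                   ≤-reflexive (indicator-no (P? y) λ Py → All.lookup x∉xs y∈xs (unique Px Py)))
                 (≤-reflexive (*-zeroʳ (length xs))))

sumOver-missing : (P? : Decidable {A = A} P) → ∀ {x xs} → x ∈ xs → ¬ P x →
                  suc (sumOver xs (λ x → indicator (P? x))) ≤ length xs
sumOver-missing P? {xs = x ∷ xs} (here refl) ¬Px rewrite indicator-no (P? x) ¬Px =
  s≤s (≤-trans (sumOver-bound 1 xs λ y _ → indicator≤1 (P? y)) (≤-reflexive (*-identityʳ _)))
sumOver-missing P? {xs = y ∷ xs} (there x∈)  ¬Px =
  ≤-trans (≤-reflexive (sym (+-suc _ _))) (+-mono-≤ (indicator≤1 (P? y)) (sumOver-missing P? x∈ ¬Px))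

unique⊆⇒length≤ : DecidableEquality A → ∀ {xs ys : List A} → Unique xs → (∀ {x} → x ∈ xs → x ∈ ys) →
                  length xs ≤ length ys
unique⊆⇒length≤ _≟A_ {xs} {ys} xs! xs⊆ys = begin
  length xs                                                  ≡⟨ *-identityʳ _ ⟨
  length xs * 1                                              ≡⟨ sumOver-const 1 xs ⟨
  sumOver xs (λ _ → 1)                                       ≤⟨ sumOver-mono xs (λ x x∈ → ≤-trans (indicator-yes (x ≟A x) refl)
                                                                  (member≤sumOver (λ y → indicator (y ≟A x)) (xs⊆ys x∈))) ⟩
  sumOver xs (λ x → sumOver ys (λ y → indicator (y ≟A x)))   ≡⟨ sumOver-swap _ xs ys ⟩
  sumOver ys (λ y → sumOver xs (λ x → indicator (y ≟A x)))   ≤⟨ sumOver-bound 1 ys (λ y _ → sumOver-unique≤1 (y ≟A_) xs! (λ p q → trans (sym p) q)) ⟩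
  length ys * 1                                              ≡⟨ *-identityʳ _ ⟩
  length ys                                                  ∎
  where open ≤-Reasoning

injection⇒length≤ : DecidableEquality B → (f : A → B) → ∀ {xs ys} → Unique xs →
                    (∀ {x} → x ∈ xs → f x ∈ ys) → (∀ {x y} → x ∈ xs → y ∈ xs → f x ≡ f y → x ≡ y) →
                    length xs ≤ length ys
injection⇒length≤ {A = A} _≟B_ f {xs} {ys} xs! f∈ f-inj =
  ≤-trans (≤-reflexive (sym (List.length-map f xs)))
    (unique⊆⇒length≤ _≟B_ (unique-map xs! f-inj) λ y∈ → image xs f∈ y∈)
  where
  image : ∀ zs → (∀ {x} → x ∈ zs → f x ∈ ys) → ∀ {y} → y ∈ map f zs → y ∈ ys
  image (z ∷ zs) h (here refl) = h (here refl)
  image (z ∷ zs) h (there y∈)  = image zs (h ∘ there) y∈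
  unique-map : ∀ {zs} → Unique zs → (∀ {x y} → x ∈ zs → y ∈ zs → f x ≡ f y → x ≡ y) → Unique (map f zs)
  unique-map []               inj = []
  unique-map (z∉zs ∷ zs!) inj =
    All.map⁺ (All.tabulate λ y∈ eq → All.lookup z∉zs y∈ (inj (here refl) (there y∈) eq)) ∷
    unique-map zs! λ x∈ y∈ → inj (there x∈) (there y∈)

-- Palettes of two colours

vectors : List A → ∀ l → List (Vec A l)
vectors xs zero    = [] ∷ []
vectors xs (suc l) = cartesianProductWith _∷_ xs (vectors xs l)

∈-vectors : ∀ {xs : List A} → (∀ x → x ∈ xs) → ∀ {l} (v : Vec A l) → v ∈ vectors xs l
∈-vectors all []      = here refl
∈-vectors all (x ∷ v) = ∈-cartesianProductWith⁺ _∷_ (all x) (∈-vectors all v)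

length-vectors : ∀ (xs : List A) l → length (vectors xs l) ≡ length xs ^ l
length-vectors xs zero    = refl
length-vectors xs (suc l) = begin-equality
  length (vectors xs (suc l))                                 ≡⟨ *-identityʳ _ ⟨
  length (vectors xs (suc l)) * 1                             ≡⟨ sumOver-const 1 (vectors xs (suc l)) ⟨
  sumOver (vectors xs (suc l)) (λ _ → 1)                      ≡⟨ sumOver-product _∷_ _ xs (vectors xs l) ⟩
  sumOver xs (λ _ → sumOver (vectors xs l) (λ _ → 1))         ≡⟨ sumOver-const _ xs ⟩
  length xs * sumOver (vectors xs l) (λ _ → 1)                ≡⟨ cong (length xs *_) (sumOver-const 1 (vectors xs l)) ⟩
  length xs * (length (vectors xs l) * 1)                     ≡⟨ cong (length xs *_) (trans (*-identityʳ _) (length-vectors xs l)) ⟩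
  length xs * length xs ^ l                                   ∎
  where open ≤-Reasoning

∃vec? : ∀ {xs : List A} → (∀ x → x ∈ xs) → ∀ {l} {P : Vec A l → Set} → Decidable P → Dec (∃ P)
∃vec? {xs = xs} all {l} P? = map′ (λ a → Any.satisfied a) (λ (v , p) → Any.map (λ { refl → p }) (∈-vectors all v)) (Any.any? P? (vectors xs l))

choice : ∀ {l} {A B : Fin l → Set} → (∀ i → A i ⊎ B i) → (∃ A) ⊎ (∀ i → B i)
choice {zero}  c = inj₂ λ ()
choice {suc l} c with c zero
... | inj₁ a = inj₁ (zero , a)
... | inj₂ b with choice (c ∘ suc)
...   | inj₁ (i , a) = inj₁ (suc i , a)
...   | inj₂ bs      = inj₂ λ { zero → b ; (suc i) → bs i }

pick : ∀ {l} → (Fin l → A × A) → Vec Bool l → Vec A l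
pick pal []           = []
pick pal (true  ∷ bs) = proj₁ (pal zero) ∷ pick (pal ∘ suc) bs
pick pal (false ∷ bs) = proj₂ (pal zero) ∷ pick (pal ∘ suc) bs

bits : ∀ l → List (Vec Bool l)
bits = vectors (true ∷ false ∷ [])

module Palettes {r : ℕ} (r≥2 : 2 ≤ r) where

  C : Set
  C = Fin r

  Distinct : Vec C 3 → Set
  Distinct T = ∀ i j → lookup T i ≡ lookup T j → i ≡ j

  another : ∀ (p : C) → ∃[ q ] p ≢ q
  another p = go r≥2 p
    where
    go : ∀ {s} → 2 ≤ s → (p : Fin s) → ∃[ q ] p ≢ q
    go (s≤s (s≤s _)) zero    = suc zero , λ ()
    go (s≤s (s≤s _)) (suc p) = zero , λ ()

  distinct₃ : ∀ {a b c : C} → a ≢ b → a ≢ c → b ≢ c → Distinct (a ∷ b ∷ c ∷ [])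
  distinct₃ ab ac bc zero             zero             _  = refl
  distinct₃ ab ac bc zero             (suc zero)       eq = contradiction eq ab
  distinct₃ ab ac bc zero             (suc (suc zero)) eq = contradiction eq ac
  distinct₃ ab ac bc (suc zero)       zero             eq = contradiction (sym eq) ab
  distinct₃ ab ac bc (suc zero)       (suc zero)       _  = refl
  distinct₃ ab ac bc (suc zero)       (suc (suc zero)) eq = contradiction eq bc
  distinct₃ ab ac bc (suc (suc zero)) zero             eq = contradiction (sym eq) ac
  distinct₃ ab ac bc (suc (suc zero)) (suc zero)       eq = contradiction (sym eq) bc
  distinct₃ ab ac bc (suc (suc zero)) (suc (suc zero)) _  = refl

  _∈₂_ : C → C × C → Set
  k ∈₂ (p , q) = k ≡ p ⊎ k ≡ q

  -- Palettes are padded: where fewer than two colours satisfy `Q`, arbitrary others are added, so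
  -- that a palette always consists of two distinct colours.
  three-or-two : {Q : C → Set} → Decidable Q →
                 (∃[ T ] Distinct T × ∀ j → Q (lookup T j)) ⊎ (∃[ pal ] proj₁ pal ≢ proj₂ pal × ∀ k → Q k → k ∈₂ pal)
  three-or-two Q? with Fin.any? Q?
  ... | no ¬Q = inj₂ ((p₀ , proj₁ (another p₀)) , proj₂ (another p₀) , λ k Qk → contradiction (k , Qk) ¬Q)
    where p₀ = fromℕ< {0} (≤-trans (s≤s z≤n) r≥2)
  ... | yes (p , Qp) with Fin.any? (λ k → ¬? (p ≟ k) ×-dec Q? k)
  ...   | no ¬Q = inj₂ ((p , proj₁ (another p)) , proj₂ (another p) , only)
    where
    only : ∀ k → _ → k ∈₂ (p , proj₁ (another p))
    only k Qk with p ≟ k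
    ... | yes p≡k = inj₁ (sym p≡k)
    ... | no  p≢k = contradiction (k , p≢k , Qk) ¬Q
  ...   | yes (q , p≢q , Qq) with Fin.any? (λ k → ¬? (p ≟ k) ×-dec ¬? (q ≟ k) ×-dec Q? k)
  ...     | yes (t , p≢t , q≢t , Qt) = inj₁ (p ∷ q ∷ t ∷ [] , distinct₃ p≢q p≢t q≢t ,
                λ { zero → Qp ; (suc zero) → Qq ; (suc (suc zero)) → Qt })
  ...     | no ¬Q = inj₂ ((p , q) , p≢q , only)
    where
    only : ∀ k → _ → k ∈₂ (p , q)
    only k Qk with p ≟ k | q ≟ k
    ... | yes p≡k | _       = inj₁ (sym p≡k)
    ... | no _    | yes q≡k = inj₂ (sym q≡k)
    ... | no p≢k  | no q≢k  = contradiction (k , p≢k , q≢k , Qk) ¬Q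

  sum-supported-on-two : ∀ (f : C → ℕ) p q → (∀ k → ¬ (k ∈₂ (p , q)) → f k ≡ 0) → sumOver (allFin r) f ≤ f p + f q
  sum-supported-on-two f p q zero-off = begin
    sumOver (allFin r) f
      ≤⟨ sumOver-mono (allFin r) (λ k _ → pointwise k) ⟩
    sumOver (allFin r) (λ k → f p * indicator (p ≟ k) + f q * indicator (q ≟ k))
      ≡⟨ sumOver-add _ _ (allFin r) ⟩
    sumOver (allFin r) (λ k → f p * indicator (p ≟ k)) + sumOver (allFin r) (λ k → f q * indicator (q ≟ k))
      ≡⟨ cong₂ _+_ (sumOver-*ˡ (f p) _ (allFin r)) (sumOver-*ˡ (f q) _ (allFin r)) ⟩
    f p * sumOver (allFin r) (λ k → indicator (p ≟ k)) + f q * sumOver (allFin r) (λ k → indicator (q ≟ k))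
      ≤⟨ +-mono-≤ (*-monoʳ-≤ (f p) (once p)) (*-monoʳ-≤ (f q) (once q)) ⟩
    f p * 1 + f q * 1
      ≡⟨ cong₂ _+_ (*-identityʳ (f p)) (*-identityʳ (f q)) ⟩
    f p + f q ∎
    where
    open ≤-Reasoning
    once : ∀ p → sumOver (allFin r) (λ k → indicator (p ≟ k)) ≤ 1
    once p = sumOver-unique≤1 (p ≟_) (Unique.allFin⁺ r) λ e e′ → trans (sym e) e′
    pointwise : ∀ k → f k ≤ f p * indicator (p ≟ k) + f q * indicator (q ≟ k)
    pointwise k with p ≟ k | q ≟ k
    ... | yes refl | _        = ≤-trans (≤-reflexive (sym (*-identityʳ (f p)))) (m≤m+n _ _)
    ... | no  _    | yes refl = ≤-trans (≤-reflexive (sym (*-identityʳ (f q)))) (m≤n+m _ _)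
    ... | no p≢k   | no q≢k   = ≤-trans (≤-reflexive (zero-off k λ { (inj₁ e) → p≢k (sym e) ; (inj₂ e) → q≢k (sym e) })) z≤n

  sum-in-palettes : ∀ {l} {S : Vec C l → Set} (S? : Decidable S) (pal : Fin l → C × C) →
                    (∀ v → S v → ∀ i → lookup v i ∈₂ pal i) →
                    sumOver (vectors (allFin r) l) (λ v → indicator (S? v)) ≤ sumOver (bits l) (λ b → indicator (S? (pick pal b)))
  sum-in-palettes {zero}  S? pal S⊆ = ≤-refl
  sum-in-palettes {suc l} S? pal S⊆ = begin
    sumOver (vectors (allFin r) (suc l)) (λ v → indicator (S? v))
      ≡⟨ sumOver-product _∷_ _ (allFin r) (vectors (allFin r) l) ⟩
    sumOver (allFin r) F
      ≤⟨ sum-supported-on-two F p q off ⟩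
    F p + F q
      ≤⟨ +-mono-≤ (sum-in-palettes (S? ∘ (p ∷_)) (pal ∘ suc) (λ v Sv i → S⊆ (p ∷ v) Sv (suc i)))
                  (sum-in-palettes (S? ∘ (q ∷_)) (pal ∘ suc) (λ v Sv i → S⊆ (q ∷ v) Sv (suc i))) ⟩
    sumOver (bits l) (λ b → indicator (S? (pick pal (true ∷ b)))) + sumOver (bits l) (λ b → indicator (S? (pick pal (false ∷ b))))
      ≡⟨ cong (sumOver (bits l) (λ b → indicator (S? (pick pal (true ∷ b)))) +_) (+-identityʳ _) ⟨
    sumOver (true ∷ false ∷ []) (λ t → sumOver (bits l) (λ b → indicator (S? (pick pal (t ∷ b)))))
      ≡⟨ sumOver-product _∷_ _ (true ∷ false ∷ []) (bits l) ⟨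
    sumOver (bits (suc l)) (λ b → indicator (S? (pick pal b))) ∎
    where
    open ≤-Reasoning
    p = proj₁ (pal zero)
    q = proj₂ (pal zero)
    F : C → ℕ
    F k = sumOver (vectors (allFin r) l) (λ v → indicator (S? (k ∷ v)))
    off : ∀ k → ¬ (k ∈₂ (p , q)) → F k ≡ 0
    off k k∉ = n≤0⇒n≡0 (≤-trans (sumOver-bound 0 (vectors (allFin r) l) λ v _ →
                 ≤-reflexive (indicator-no (S? (k ∷ v)) λ Sv → k∉ (S⊆ (k ∷ v) Sv zero)))
                 (≤-reflexive (*-zeroʳ (length (vectors (allFin r) l)))))

  ThreeColoured : ∀ {l} → (Vec C l → Set) → Set
  ThreeColoured {l} S = ∃[ i ] ∃[ T ] Distinct T × ∀ j → ∃[ v ] S v × lookup {n = l} v i ≡ lookup T j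

  three-coloured-or-palettes : ∀ {l} {S : Vec C l → Set} → Decidable S →
    ThreeColoured S ⊎ (∃[ pal ] (∀ i → proj₁ (pal i) ≢ proj₂ (pal i)) × (∀ v → S v → ∀ i → lookup v i ∈₂ pal i))
  three-coloured-or-palettes S?
    with choice (λ i → three-or-two (λ k → ∃vec? ∈-allFin (λ v → S? v ×-dec (lookup v i ≟ k))))
  ... | inj₁ found = inj₁ found
  ... | inj₂ pals  = inj₂ ((proj₁ ∘ pals) , (λ i → proj₁ (proj₂ (pals i))) , λ v Sv i → proj₂ (proj₂ (pals i)) _ (v , Sv , refl))

  three-coloured-or-≤2^ : ∀ {l} {S : Vec C l → Set} (S? : Decidable S) →
    ThreeColoured S ⊎ sumOver (vectors (allFin r) l) (λ v → indicator (S? v)) ≤ 2 ^ l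
  three-coloured-or-≤2^ {l} S? with three-coloured-or-palettes S?
  ... | inj₁ found          = inj₁ found
  ... | inj₂ (pal , _ , S⊆) = inj₂ (begin
    _                                                ≤⟨ sum-in-palettes S? pal S⊆ ⟩
    sumOver (bits l) (λ b → indicator (S? (pick pal b))) ≤⟨ sumOver-bound 1 (bits l) (λ b _ → indicator≤1 (S? (pick pal b))) ⟩
    length (bits l) * 1                              ≡⟨ *-identityʳ _ ⟩
    length (bits l)                                  ≡⟨ length-vectors (true ∷ false ∷ []) l ⟩
    2 ^ l                                            ∎)
    where open ≤-Reasoning

  -- Reaching 2 ^ l would take every pattern of the two-colour palettes; `thin` forbids that, and a
  -- single missing pattern lowers the bound by one.
  three-coloured-or-<2^ : ∀ {l} {S : Vec C l → Set} (S? : Decidable S) →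
    (∀ pal → (∀ i → proj₁ (pal i) ≢ proj₂ (pal i)) → ¬ (∀ b → S (pick pal b))) →
    ThreeColoured S ⊎ sumOver (vectors (allFin r) l) (λ v → indicator (S? v)) ≤ pred (2 ^ l)
  three-coloured-or-<2^ {l} S? thin with three-coloured-or-palettes S?
  ... | inj₁ found            = inj₁ found
  ... | inj₂ (pal , pal≢ , S⊆) with ∃vec? bit (λ b → ¬? (S? (pick pal b)))
    where
    bit : ∀ b → b ∈ true ∷ false ∷ []
    bit true  = here refl
    bit false = there (here refl)
  ...   | no  full     = ⊥-elim (thin pal pal≢ λ b → decidable-stable (S? (pick pal b)) λ ¬S → full (b , ¬S))
  ...   | yes (b , ¬S) = inj₂ (≤-trans (sum-in-palettes S? pal S⊆) (≤-pred (begin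
    suc (sumOver (bits l) (λ b → indicator (S? (pick pal b))))  ≤⟨ sumOver-missing (S? ∘ pick pal) (∈-vectors bit b) ¬S ⟩
    length (bits l)                                             ≡⟨ length-vectors (true ∷ false ∷ []) l ⟩
    2 ^ l                                                       ≡⟨ suc-pred (2 ^ l) {{m^n≢0 2 l}} ⟨
    suc (pred (2 ^ l))                                          ∎)))
    where
    open ≤-Reasoning
    bit : ∀ b → b ∈ true ∷ false ∷ []
    bit true  = here refl
    bit false = there (here refl)

-- Shattering

module Shattering {r : ℕ} (r≥2 : 2 ≤ r) (n : ℕ) where

  open Palettes r≥2

  -- A group of points whose colours are counted jointly. The field `bounded` is the dichotomy that
  -- drives the induction: a set of allowed words either is small or has a place with three colours,
  -- which can join a shattered set.
  record Block : Set₁ where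
    field
      size    : ℕ
      place   : Fin size → Fin n
      Allowed : Vec C size → Set
      bound   : ℕ
      bounded : ∀ {S : Vec C size → Set} (S? : Decidable S) → (∀ v → S v → Allowed v) →
                ThreeColoured S ⊎ sumOver (vectors (allFin r) size) (λ v → indicator (S? v)) ≤ bound

  open Block

  Code : List Block → Set
  Code []       = Unit
  Code (b ∷ bs) = Vec C (size b) × Code bs

  code-≟ : ∀ bs → DecidableEquality (Code bs)
  code-≟ []       tt      tt        = yes refl
  code-≟ (b ∷ bs) (v , c) (v′ , c′) with Vec.≡-dec _≟_ v v′ | code-≟ bs c c′
  ... | yes refl | yes refl = yes refl
  ... | no v≢    | _        = no λ { refl → v≢ refl }
  ... | yes _    | no c≢    = no λ { refl → c≢ refl }

  AllAllowed : ∀ bs → Code bs → Set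
  AllAllowed []       _       = Unit
  AllAllowed (b ∷ bs) (v , c) = Allowed b v × AllAllowed bs c

  Places : List Block → Fin n → Set
  Places []       x = ⊥
  Places (b ∷ bs) x = (∃[ i ] place b i ≡ x) ⊎ Places bs x

  DisjointPlaces : List Block → Set
  DisjointPlaces []       = Unit
  DisjointPlaces (b ∷ bs) = (∀ i → ¬ Places bs (place b i)) × DisjointPlaces bs

  Assigned : ∀ bs → Code bs → Fin n → C → Set
  Assigned []       _       x k = ⊥
  Assigned (b ∷ bs) (v , c) x k = (∃[ i ] place b i ≡ x × lookup v i ≡ k) ⊎ Assigned bs c x k

  Triples : Set
  Triples = List (Fin n × Vec C 3)

  -- Only the values of `s` on the points of `X` matter; with `s` defined on all of [n], the same
  -- `s` serves before and after a point is added.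
  Shatters : ∀ bs → (Code bs → Set) → Triples → Set
  Shatters bs P X = ∀ (s : Fin n → Fin 3) → ∃[ c ] P c × All (λ (x , T) → Assigned bs c x (lookup T (s x))) X

  -- The first block is summed innermost, so that the fibre over a code of the remaining blocks
  -- appears as an inner sum.
  total : ∀ bs → (Code bs → ℕ) → ℕ
  total []       f = f tt
  total (b ∷ bs) f = total bs (λ c → sumOver (vectors (allFin r) (size b)) (λ v → f (v , c)))

  total-mono : ∀ bs {f h} → (∀ c → f c ≤ h c) → total bs f ≤ total bs h
  total-mono []       f≤h = f≤h tt
  total-mono (b ∷ bs) f≤h = total-mono bs λ c → sumOver-mono (vectors (allFin r) (size b)) λ v _ → f≤h (v , c)

  total-cong : ∀ bs {f h} → (∀ c → f c ≡ h c) → total bs f ≡ total bs h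
  total-cong bs f≡h = ≤-antisym (total-mono bs (≤-reflexive ∘ f≡h)) (total-mono bs (≤-reflexive ∘ sym ∘ f≡h))

  total-add : ∀ bs f h → total bs (λ c → f c + h c) ≡ total bs f + total bs h
  total-add []       f h = refl
  total-add (b ∷ bs) f h =
    trans (total-cong bs λ c → sumOver-add (λ v → f (v , c)) (λ v → h (v , c)) (vectors (allFin r) (size b))) (total-add bs _ _)

  total-*ˡ : ∀ bs k f → total bs (λ c → k * f c) ≡ k * total bs f
  total-*ˡ []       k f = refl
  total-*ˡ (b ∷ bs) k f = trans (total-cong bs λ c → sumOver-*ˡ k (λ v → f (v , c)) (vectors (allFin r) (size b))) (total-*ˡ bs k _)

  total-zero : ∀ bs → total bs (λ _ → 0) ≡ 0
  total-zero bs = total-*ˡ bs 0 (λ _ → 0)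

  total-sumOver : ∀ bs {A : Set} (F : A → Code bs → ℕ) xs →
                  total bs (λ c → sumOver xs (λ x → F x c)) ≡ sumOver xs (λ x → total bs (F x))
  total-sumOver bs F []       = total-zero bs
  total-sumOver bs F (x ∷ xs) =
    trans (total-add bs (F x) (λ c → sumOver xs (λ x → F x c))) (cong (total bs (F x) +_) (total-sumOver bs F xs))

  term≤total : ∀ bs f c → f c ≤ total bs f
  term≤total []       f tt      = ≤-refl
  term≤total (b ∷ bs) f (v , c) = ≤-trans (member≤sumOver (λ v → f (v , c)) (∈-vectors ∈-allFin v)) (term≤total bs _ c)

  unique⇒length≤total : ∀ bs {P : Code bs → Set} (P? : Decidable P) {L} → Unique L → (∀ {c} → c ∈ L → P c) →
                        length L ≤ total bs (λ c → indicator (P? c))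
  unique⇒length≤total bs P? {L} L! L⊆P = begin
    length L                                                       ≡⟨ *-identityʳ _ ⟨
    length L * 1                                                   ≡⟨ sumOver-const 1 L ⟨
    sumOver L (λ _ → 1)                                            ≤⟨ sumOver-mono L (λ l _ → ≤-trans (indicator-yes (code-≟ bs l l) refl) (term≤total bs _ l)) ⟩
    sumOver L (λ l → total bs (λ c → indicator (code-≟ bs l c)))   ≡⟨ total-sumOver bs (λ l c → indicator (code-≟ bs l c)) L ⟨
    total bs (λ c → sumOver L (λ l → indicator (code-≟ bs l c)))   ≤⟨ total-mono bs hits ⟩
    total bs (λ c → indicator (P? c))                              ∎
    where
    open ≤-Reasoning
    hits : ∀ c → sumOver L (λ l → indicator (code-≟ bs l c)) ≤ indicator (P? c)
    hits c with P? c
    ... | yes _ = sumOver-unique≤1 (λ l → code-≟ bs l c) L! λ e e′ → trans e (sym e′)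
    ... | no ¬P = ≤-trans (sumOver-bound 0 L λ l l∈ → ≤-reflexive (indicator-no (code-≟ bs l c) λ { refl → ¬P (L⊆P l∈) }))
                    (≤-reflexive (*-zeroʳ (length L)))

  -- The cost of the three-coloured case: the fibre has at most as many elements as there are words,
  -- and the place and its triple of colours are summed over all possibilities.
  weight : Block → ℕ
  weight b = length (vectors (allFin r) (size b)) * (length (allFin (size b)) * length (vectors (allFin r) 3))

  -- After division by Λ the factor of a block is `bound b` plus `weight b` / Λ, so a large Λ brings
  -- it close to `bound b`.
  capacity : ℕ → List Block → ℕ
  capacity Λ []       = 1
  capacity Λ (b ∷ bs) = (bound b * Λ + weight b) * capacity Λ bs

  WellPlaced : List Block → Triples → Set
  WellPlaced bs X = Unique (map proj₁ X) × All (λ (x , T) → Places bs x × Distinct T) X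

  distinct? : Decidable Distinct
  distinct? T = Fin.all? λ i → Fin.all? λ j → (lookup T i ≟ lookup T j) →-dec (i ≟ j)

  module _ (b : Block) (bs : List Block) {P : Code (b ∷ bs) → Set} (P? : Decidable P) where

    private
      V = vectors (allFin r) (size b)

    Extends : Code bs → Set
    Extends c = ∃[ v ] P (v , c)

    extends? : Decidable Extends
    extends? c = ∃vec? ∈-allFin λ v → P? (v , c)

    -- All three colours occur at place `i` over the same code `c`. So the colour there can still be
    -- picked once `c` realises the choices on the other points, which is how `shatters-rich` adds a
    -- point.
    Rich : Fin (size b) → Vec C 3 → Code bs → Set
    Rich i T c = Distinct T × (∀ j → ∃[ v ] P (v , c) × lookup v i ≡ lookup T j)

    rich? : ∀ i T → Decidable (Rich i T)
    rich? i T c = distinct? T ×-dec Fin.all? λ j → ∃vec? ∈-allFin λ v → P? (v , c) ×-dec (lookup v i ≟ lookup T j)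

    richness : Code bs → ℕ
    richness c = sumOver (allFin (size b)) (λ i → sumOver (vectors (allFin r) 3) (λ T → indicator (rich? i T c)))

    -- If some place takes three colours, `richness` is at least one and the number of all words is
    -- a sufficient bound; otherwise `bound b` applies.
    fibre-bound : (∀ c → P c → Allowed b (proj₁ c)) → ∀ c →
                  sumOver V (λ v → indicator (P? (v , c))) ≤ bound b * indicator (extends? c) + length V * richness c
    fibre-bound P⇒ c = go (extends? c)
      where
      open ≤-Reasoning
      go : (E? : Dec (Extends c)) →
           sumOver V (λ v → indicator (P? (v , c))) ≤ bound b * indicator E? + length V * richness c
      go (no ¬E) = ≤-trans (sumOver-bound 0 V λ v _ → ≤-reflexive (indicator-no (P? (v , c)) λ Pv → ¬E (v , Pv)))
                     (≤-trans (≤-reflexive (*-zeroʳ (length V))) z≤n)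
      go (yes _) with bounded b (λ v → P? (v , c)) (λ v Pv → P⇒ (v , c) Pv)
      ... | inj₂ le = ≤-trans le (≤-trans (≤-reflexive (sym (*-identityʳ (bound b)))) (m≤m+n _ _))
      ... | inj₁ (i , T , T! , hit) = ≤-trans
              (sumOver-bound 1 V λ v _ → indicator≤1 (P? (v , c)))
              (≤-trans (*-monoʳ-≤ (length V) (begin
                1                                                                        ≤⟨ indicator-yes (rich? i T c) (T! , hit) ⟩
                indicator (rich? i T c)                                                  ≤⟨ member≤sumOver (λ T → indicator (rich? i T c)) (∈-vectors ∈-allFin T) ⟩
                sumOver (vectors (allFin r) 3) (λ T → indicator (rich? i T c))           ≤⟨ member≤sumOver (λ i → sumOver (vectors (allFin r) 3) (λ T → indicator (rich? i T c))) (∈-allFin i) ⟩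
                richness c                                                               ∎))
              (m≤n+m _ _))

    shatters-extends : ∀ {X} → Shatters bs Extends X → Shatters (b ∷ bs) P X
    shatters-extends sh s = let c , (v , Pv) , as = sh s in (v , c) , Pv , All.map inj₂ as

    shatters-rich : ∀ {X} i T → Shatters bs (Rich i T) X → Shatters (b ∷ bs) P ((place b i , T) ∷ X)
    shatters-rich i T sh s =
      let c , (_ , hit) , as = sh s
          v , Pv , eq = hit (s (place b i))
      in (v , c) , Pv , inj₁ (i , refl , eq) ∷ All.map inj₂ as

  -- Sauer–Shelah by induction on the blocks.  A fibre over the remaining blocks either has at most
  -- bound b elements or makes some place of b take three colours, which enlarges the shattered set;
  -- a shattered place is paid for by a factor Λ.
  sauer-shelah : ∀ Λ bs {P : Code bs → Set} (P? : Decidable P) w M →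
                 (∀ c → P c → AllAllowed bs c) → DisjointPlaces bs →
                 (∀ X → WellPlaced bs X → Shatters bs P X → w * Λ ^ length X ≤ M) →
                 w * total bs (λ c → indicator (P? c)) * Λ ^ length bs ≤ M * capacity Λ bs
  sauer-shelah Λ [] {P} P? w M _ _ shattered with P? tt
  ... | yes p = begin
    w * 1 * 1     ≡⟨ *-identityʳ _ ⟩
    w * 1         ≤⟨ shattered [] ([] , []) (λ _ → tt , p , []) ⟩
    M             ≡⟨ *-identityʳ M ⟨
    M * 1         ∎
    where open ≤-Reasoning
  ... | no _ = ≤-trans (≤-reflexive (cong (_* 1) (*-zeroʳ w))) z≤n
  sauer-shelah Λ (b ∷ bs) {P} P? w M allowed (fresh , disjoint) shattered = begin
    w * total (b ∷ bs) (λ c → indicator (P? c)) * (Λ * Λᵏ)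
      ≤⟨ *-monoˡ-≤ (Λ * Λᵏ) (*-monoʳ-≤ w total≤) ⟩
    w * (bound b * tE + lV * tR) * (Λ * Λᵏ)
      ≡⟨ lemma w (bound b) tE lV tR Λ Λᵏ ⟩
    bound b * Λ * (w * tE * Λᵏ) + lV * (w * Λ * tR * Λᵏ)
      ≤⟨ +-mono-≤ (*-monoʳ-≤ (bound b * Λ) extends≤) (*-monoʳ-≤ lV rich≤) ⟩
    bound b * Λ * (M * cap) + lV * (length (allFin (size b)) * (length (vectors (allFin r) 3) * (M * cap)))
      ≡⟨ lemma′ (bound b) Λ M cap lV (length (allFin (size b))) (length (vectors (allFin r) 3)) ⟩
    M * ((bound b * Λ + lV * (length (allFin (size b)) * length (vectors (allFin r) 3))) * cap) ∎
    where
    open ≤-Reasoning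
    Λᵏ = Λ ^ length bs
    cap = capacity Λ bs
    lV = length (vectors (allFin r) (size b))
    tE = total bs (λ c → indicator (extends? b bs P? c))
    tR = total bs (richness b bs P?)
    tRᵢ : Fin (size b) → Vec C 3 → ℕ
    tRᵢ i T = total bs (λ c → indicator (rich? b bs P? i T c))

    lemma : ∀ w b e l t Λ k → w * (b * e + l * t) * (Λ * k) ≡ b * Λ * (w * e * k) + l * (w * Λ * t * k)
    lemma = solve-∀
    lemma′ : ∀ b Λ M c l a d → b * Λ * (M * c) + l * (a * (d * (M * c))) ≡ M * ((b * Λ + l * (a * d)) * c)
    lemma′ = solve-∀

    total≤ : total (b ∷ bs) (λ c → indicator (P? c)) ≤ bound b * tE + lV * tR
    total≤ = begin
      total (b ∷ bs) (λ c → indicator (P? c))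
        ≤⟨ total-mono bs (fibre-bound b bs P? (λ c Pc → proj₁ (allowed c Pc))) ⟩
      total bs (λ c → bound b * indicator (extends? b bs P? c) + lV * richness b bs P? c)
        ≡⟨ total-add bs _ _ ⟩
      total bs (λ c → bound b * indicator (extends? b bs P? c)) + total bs (λ c → lV * richness b bs P? c)
        ≡⟨ cong₂ _+_ (total-*ˡ bs (bound b) _) (total-*ˡ bs lV _) ⟩
      bound b * tE + lV * tR ∎

    extends≤ : w * tE * Λᵏ ≤ M * cap
    extends≤ = sauer-shelah Λ bs (extends? b bs P?) w M (λ c (v , Pv) → proj₂ (allowed (v , c) Pv)) disjoint
      λ X (X! , wf) sh → shattered X (X! , All.map (λ (pl , T!) → inj₂ pl , T!) wf) (shatters-extends b bs P? sh)

    rich≤ᵢ : ∀ i T → w * Λ * tRᵢ i T * Λᵏ ≤ M * cap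
    rich≤ᵢ i T with distinct? T
    ... | yes T! = sauer-shelah Λ bs (rich? b bs P? i T) (w * Λ) M
      (λ c (_ , hit) → let v , Pv , _ = hit zero in proj₂ (allowed (v , c) Pv)) disjoint
      λ X (X! , wf) sh → ≤-trans (≤-reflexive (*-assoc w Λ (Λ ^ length X)))
        (shattered ((place b i , T) ∷ X)
          (All.map⁺ (All.map (λ (pl , _) eq → fresh i (subst (Places bs) (sym eq) pl)) wf) ∷ X! ,
           (inj₁ (i , refl) , T!) ∷ All.map (λ (pl , T!) → inj₂ pl , T!) wf)
          (shatters-rich b bs P? i T sh))
    ... | no ¬T! = begin
      w * Λ * tRᵢ i T * Λᵏ              ≤⟨ *-monoˡ-≤ Λᵏ (*-monoʳ-≤ (w * Λ) (total-mono bs λ c → ≤-reflexive (indicator-no (rich? b bs P? i T c) (¬T! ∘ proj₁)))) ⟩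
      w * Λ * total bs (λ _ → 0) * Λᵏ   ≡⟨ cong (λ t → w * Λ * t * Λᵏ) (total-zero bs) ⟩
      w * Λ * 0 * Λᵏ                    ≡⟨ cong (_* Λᵏ) (*-zeroʳ (w * Λ)) ⟩
      0                                 ≤⟨ z≤n ⟩
      M * cap                           ∎

    rich≤ : w * Λ * tR * Λᵏ ≤ length (allFin (size b)) * (length (vectors (allFin r) 3) * (M * cap))
    rich≤ = begin
      w * Λ * tR * Λᵏ
        ≡⟨ reorder w Λ tR Λᵏ ⟩
      w * Λ * Λᵏ * tR
        ≡⟨ cong (w * Λ * Λᵏ *_) (total-sumOver bs _ (allFin (size b))) ⟩
      w * Λ * Λᵏ * sumOver (allFin (size b)) (λ i → total bs (λ c → sumOver (vectors (allFin r) 3) (λ T → indicator (rich? b bs P? i T c))))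
        ≡⟨ sumOver-*ˡ (w * Λ * Λᵏ) _ (allFin (size b)) ⟨
      sumOver (allFin (size b)) (λ i → w * Λ * Λᵏ * total bs (λ c → sumOver (vectors (allFin r) 3) (λ T → indicator (rich? b bs P? i T c))))
        ≤⟨ sumOver-bound _ (allFin (size b)) (λ i _ → begin
             w * Λ * Λᵏ * total bs (λ c → sumOver (vectors (allFin r) 3) (λ T → indicator (rich? b bs P? i T c)))
               ≡⟨ cong (w * Λ * Λᵏ *_) (total-sumOver bs _ (vectors (allFin r) 3)) ⟩
             w * Λ * Λᵏ * sumOver (vectors (allFin r) 3) (tRᵢ i)
               ≡⟨ sumOver-*ˡ (w * Λ * Λᵏ) _ (vectors (allFin r) 3) ⟨
             sumOver (vectors (allFin r) 3) (λ T → w * Λ * Λᵏ * tRᵢ i T)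
               ≤⟨ sumOver-bound (M * cap) (vectors (allFin r) 3)
                    (λ T _ → ≤-trans (≤-reflexive (sym (reorder w Λ (tRᵢ i T) Λᵏ))) (rich≤ᵢ i T)) ⟩
             length (vectors (allFin r) 3) * (M * cap) ∎) ⟩
      length (allFin (size b)) * (length (vectors (allFin r) 3) * (M * cap)) ∎
      where
      reorder : ∀ a b c d → a * b * c * d ≡ a * b * d * c
      reorder = solve-∀

-- Disjoint chains of midpoints

length-allFin : ∀ l → length (allFin l) ≡ l
length-allFin l = List.length-tabulate {n = l} id

sumOver-∃ : ∀ {l} {R : Fin l → A → Set} (R? : ∀ j → Decidable (R j)) {P : A → Set} (P? : Decidable P) →
            (∀ x → P x → ∃[ j ] R j x) → ∀ xs k → (∀ j → sumOver xs (λ x → indicator (R? j x)) ≤ k) →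
            sumOver xs (λ x → indicator (P? x)) ≤ l * k
sumOver-∃ {l = l} R? P? cover xs k each = begin
  sumOver xs (λ x → indicator (P? x))                               ≤⟨ sumOver-mono xs (λ x _ → covered x) ⟩
  sumOver xs (λ x → sumOver (allFin l) (λ j → indicator (R? j x)))  ≡⟨ sumOver-swap _ xs (allFin l) ⟩
  sumOver (allFin l) (λ j → sumOver xs (λ x → indicator (R? j x)))  ≤⟨ sumOver-bound k (allFin l) (λ j _ → each j) ⟩
  length (allFin l) * k                                             ≡⟨ cong (_* k) (length-allFin l) ⟩
  l * k                                                             ∎
  where
  open ≤-Reasoning
  covered : ∀ x → indicator (P? x) ≤ sumOver (allFin l) (λ j → indicator (R? j x))
  covered x with P? x
  ... | no  _ = z≤n
  ... | yes p = let j , Rj = cover x p in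
    ≤-trans (indicator-yes (R? j x) Rj) (member≤sumOver (λ j → indicator (R? j x)) (∈-allFin j))

module _ {l : ℕ} {R : Fin l → Fin l → A → Set} (R? : ∀ j k → Decidable (R j k)) where

  Avoids : A → Set
  Avoids x = ∀ j k → ¬ R j k x

  avoids? : Decidable Avoids
  avoids? x = Fin.all? λ j → Fin.all? λ k → ¬? (R? j k x)

  -- Each of the `l * l` relations `R j k` holds for at most one entry, so at most that many entries
  -- are lost.
  length≤filter-avoids : ∀ {xs} → Unique xs → (∀ j k {x y} → R j k x → R j k y → x ≡ y) →
                         length xs ≤ length (filter avoids? xs) + l * l
  length≤filter-avoids {xs} xs! unique = begin
    length xs                                                     ≡⟨ *-identityʳ _ ⟨
    length xs * 1                                                 ≡⟨ sumOver-const 1 xs ⟨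
    sumOver xs (λ _ → 1)                                          ≤⟨ sumOver-mono xs (λ x _ → split x) ⟩
    sumOver xs (λ x → indicator (avoids? x) + indicator (hit? x)) ≡⟨ sumOver-add _ _ xs ⟩
    sumOver xs (λ x → indicator (avoids? x)) + sumOver xs (λ x → indicator (hit? x))
      ≤⟨ +-mono-≤ (≤-reflexive (sym (length-filter≡sumOver avoids? xs)))
           (sumOver-∃ (λ j x → Fin.any? λ k → R? j k x) hit? (λ _ h → h) xs l λ j →
             ≤-trans (sumOver-∃ (λ k → R? j k) (λ x → Fin.any? λ k → R? j k x) (λ _ h → h) xs 1
                       λ k → sumOver-unique≤1 (R? j k) xs! (unique j k))
                     (≤-reflexive (*-identityʳ l))) ⟩
    length (filter avoids? xs) + l * l                            ∎
    where
    open ≤-Reasoning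
    hit? : Decidable (λ x → ∃[ j ] ∃[ k ] R j k x)
    hit? x = Fin.any? λ j → Fin.any? λ k → R? j k x
    split : ∀ x → 1 ≤ indicator (avoids? x) + indicator (hit? x)
    split x with hit? x
    ... | yes _ = m≤n+m 1 _
    ... | no ¬h = ≤-trans (indicator-yes (avoids? x) λ j k Rx → ¬h (j , k , Rx)) (m≤m+n _ 0)

module _ {l : ℕ} (_≟B_ : DecidableEquality B) (f : Fin l → A → B) (f-inj : ∀ j {x y} → f j x ≡ f j y → x ≡ y) where

  Separate : A → A → Set
  Separate x y = ∀ j k → f j x ≢ f k y

  -- Greedily: each chosen element rules out at most l * l others.
  separated-sublist : ∀ m xs → Unique xs → m * suc (l * l) ≤ length xs →
                      ∃[ ys ] length ys ≡ m × (∀ {y} → y ∈ ys → y ∈ xs) × AllPairs Separate ys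
  separated-sublist zero    xs       xs!          _  = [] , refl , (λ ()) , []
  separated-sublist (suc m) (x ∷ xs) (_ ∷ xs!) le =
    let ys , len , ys⊆ , sep = separated-sublist m xs′ (Unique.filter⁺ avoid xs!) enough
    in x ∷ ys , cong suc len
     , (λ { (here refl) → here refl ; (there y∈) → there (proj₁ (∈-filter⁻ avoid {xs = xs} (ys⊆ y∈))) })
     , All.tabulate (λ y∈ → proj₂ (∈-filter⁻ avoid {xs = xs} (ys⊆ y∈))) ∷ sep
    where
    avoid : Decidable (Separate x)
    avoid = avoids? λ j k y → f j x ≟B f k y
    xs′ = filter avoid xs
    enough : m * suc (l * l) ≤ length xs′
    enough = +-cancelˡ-≤ (l * l) _ _ (≤-trans (≤-pred le) (≤-trans
      (length≤filter-avoids (λ j k y → f j x ≟B f k y) xs! λ j k p q → f-inj k (trans (sym p) q))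
      (≤-reflexive (+-comm (length xs′) (l * l)))))

lines-meet-once : ∀ a b s t i i′ → s < t → a + s * i ≡ b + t * i → a + s * i′ ≡ b + t * i′ → i ≡ i′
lines-meet-once a b s t i i′ s<t eq eq′ with m≤n⇒∃[o]m+o≡n s<t
... | δ , refl = *-cancelˡ-≡ i i′ (suc δ) (+-cancelˡ-≡ b _ _ (trans (sym (cut i eq)) (cut i′ eq′)))
  where
  lemma : ∀ b s δ i → b + (1 + s + δ) * i ≡ b + (1 + δ) * i + s * i
  lemma = solve-∀
  cut : ∀ i → a + s * i ≡ b + (1 + s + δ) * i → a ≡ b + suc δ * i
  cut i eq = +-cancelʳ-≡ (s * i) _ _ (trans eq (lemma b s δ i))

module _ {n : ℕ} (z₁ z₂ z₃ : Fin n) where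

  private
    ẑ₁ = toℕ z₁
    ẑ₂ = toℕ z₂
    ẑ₃ = toℕ z₃

  record IsChain (c : Fin 4 → Fin n) : Set where
    field
      link₁ : toℕ (c (suc zero)) + toℕ (c (suc zero)) ≡ toℕ (c zero) + ẑ₁
      link₂ : toℕ (c (suc (suc zero))) + toℕ (c (suc (suc zero))) ≡ toℕ (c (suc zero)) + ẑ₂
      link₃ : toℕ (c (suc (suc (suc zero)))) + toℕ (c (suc (suc (suc zero)))) ≡ toℕ (c (suc (suc zero))) + ẑ₃
      distinct : ∀ j k → c j ≡ c k → j ≡ k

  -- Taking midpoints never leaves [n]; the three halvings are integral for one residue class of
  -- starting points modulo 8, with least representative e.
  first-chain : ∃[ e ] ∃[ y ] ∃[ w ] ∃[ u ] e < 8 × y + y ≡ e + ẑ₁ × w + w ≡ y + ẑ₂ × u + u ≡ w + ẑ₃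
  first-chain with m≤n⇒∃[o]m+o≡n (≤-pred (m%n<n (ẑ₁ + 2 * ẑ₂ + 4 * ẑ₃ + 7) 8))
  ... | e , ρ+e≡7 = e , y , w , u , s≤s (≤-trans (m≤n+m e ρ) (≤-reflexive ρ+e≡7)) ,
        sym y-eq , trans (cong (w +_) (sym (+-identityʳ w))) (trans (sym z₂+y) (+-comm ẑ₂ y)) ,
        trans (cong (u +_) (sym (+-identityʳ u))) (trans (sym z₃+w) (+-comm ẑ₃ w))
    where
    -- Unfolding the three midpoint equations from the start e gives 8u = e + Z. So `e` is what Z
    -- lacks to a multiple of 8, and w and y are recovered backwards from `u`.
    Z = ẑ₁ + 2 * ẑ₂ + 4 * ẑ₃
    ρ = (Z + 7) % 8
    u = (Z + 7) / 8
    8u≡ : 8 * u ≡ e + Z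
    8u≡ = +-cancelˡ-≡ ρ _ _ (begin
      ρ + 8 * u      ≡⟨ cong (ρ +_) (*-comm 8 u) ⟩
      ρ + u * 8      ≡⟨ m≡m%n+[m/n]*n (Z + 7) 8 ⟨
      Z + 7          ≡⟨ cong (Z +_) ρ+e≡7 ⟨
      Z + (ρ + e)    ≡⟨ lemma Z ρ e ⟩
      ρ + (e + Z)    ∎)
      where
      open ≡-Reasoning
      lemma : ∀ Z ρ e → Z + (ρ + e) ≡ ρ + (e + Z)
      lemma = solve-∀
    z₃≤2u : ẑ₃ ≤ 2 * u
    z₃≤2u = *-cancelˡ-≤ 4 (≤-linear (e + ẑ₁ + 2 * ẑ₂) (≤-reflexive (sym 8u≡)) (lemma u e ẑ₁ ẑ₂ ẑ₃))
      where
      lemma : ∀ u e a b c → 4 * (2 * u) + (e + (a + 2 * b + 4 * c)) ≡ 4 * c + 8 * u + (e + a + 2 * b)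
      lemma = solve-∀
    w = proj₁ (m≤n⇒∃[o]m+o≡n z₃≤2u)
    z₃+w : ẑ₃ + w ≡ 2 * u
    z₃+w = proj₂ (m≤n⇒∃[o]m+o≡n z₃≤2u)
    4w≡ : 4 * w ≡ e + ẑ₁ + 2 * ẑ₂
    4w≡ = +-cancelʳ-≡ (4 * ẑ₃) _ _ (begin
      4 * w + 4 * ẑ₃                     ≡⟨ lemma w ẑ₃ ⟩
      4 * (ẑ₃ + w)                       ≡⟨ cong (4 *_) z₃+w ⟩
      4 * (2 * u)                        ≡⟨ lemma′ u ⟩
      8 * u                              ≡⟨ 8u≡ ⟩
      e + (ẑ₁ + 2 * ẑ₂ + 4 * ẑ₃)         ≡⟨ lemma″ e ẑ₁ ẑ₂ ẑ₃ ⟩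
      e + ẑ₁ + 2 * ẑ₂ + 4 * ẑ₃           ∎)
      where
      open ≡-Reasoning
      lemma : ∀ w z → 4 * w + 4 * z ≡ 4 * (z + w)
      lemma = solve-∀
      lemma′ : ∀ u → 4 * (2 * u) ≡ 8 * u
      lemma′ = solve-∀
      lemma″ : ∀ e a b c → e + (a + 2 * b + 4 * c) ≡ e + a + 2 * b + 4 * c
      lemma″ = solve-∀
    z₂≤2w : ẑ₂ ≤ 2 * w
    z₂≤2w = *-cancelˡ-≤ 2 (≤-linear (e + ẑ₁) (≤-reflexive (sym 4w≡)) (lemma w e ẑ₁ ẑ₂))
      where
      lemma : ∀ w e a b → 2 * (2 * w) + (e + a + 2 * b) ≡ 2 * b + 4 * w + (e + a)
      lemma = solve-∀
    y = proj₁ (m≤n⇒∃[o]m+o≡n z₂≤2w)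
    z₂+y : ẑ₂ + y ≡ 2 * w
    z₂+y = proj₂ (m≤n⇒∃[o]m+o≡n z₂≤2w)
    y-eq : e + ẑ₁ ≡ y + y
    y-eq = +-cancelʳ-≡ (2 * ẑ₂) _ _ (begin
      e + ẑ₁ + 2 * ẑ₂       ≡⟨ 4w≡ ⟨
      4 * w                 ≡⟨ lemma w ⟩
      2 * (2 * w)           ≡⟨ cong (2 *_) z₂+y ⟨
      2 * (ẑ₂ + y)          ≡⟨ lemma′ ẑ₂ y ⟩
      y + y + 2 * ẑ₂        ∎)
      where
      open ≡-Reasoning
      lemma : ∀ w → 4 * w ≡ 2 * (2 * w)
      lemma = solve-∀
      lemma′ : ∀ z y → 2 * (z + y) ≡ y + y + 2 * z
      lemma′ = solve-∀

  private
    N = n / 8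
    e = proj₁ first-chain
    y₀ = proj₁ (proj₂ first-chain)
    w₀ = proj₁ (proj₂ (proj₂ first-chain))
    u₀ = proj₁ (proj₂ (proj₂ (proj₂ first-chain)))
    e<8 : e < 8
    e<8 = proj₁ (proj₂ (proj₂ (proj₂ (proj₂ first-chain))))
    eq₁ : y₀ + y₀ ≡ e + ẑ₁
    eq₁ = proj₁ (proj₂ (proj₂ (proj₂ (proj₂ (proj₂ first-chain)))))
    eq₂ : w₀ + w₀ ≡ y₀ + ẑ₂
    eq₂ = proj₁ (proj₂ (proj₂ (proj₂ (proj₂ (proj₂ (proj₂ first-chain))))))
    eq₃ : u₀ + u₀ ≡ w₀ + ẑ₃
    eq₃ = proj₂ (proj₂ (proj₂ (proj₂ (proj₂ (proj₂ (proj₂ first-chain))))))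

  -- Moving the start by 8 moves the successive midpoints by 4, 2 and 1. The slopes are distinct, so
  -- two given places of a chain coincide for at most one index.
  slope intercept : Fin 4 → ℕ
  slope     = lookup (8 ∷ 4 ∷ 2 ∷ 1 ∷ [])
  intercept = lookup (e ∷ y₀ ∷ w₀ ∷ u₀ ∷ [])

  value : Fin 4 → ℕ → ℕ
  value j i = intercept j + slope j * i

  slope-positive : ∀ j → 1 ≤ slope j
  slope-positive zero                   = s≤s z≤n
  slope-positive (suc zero)             = s≤s z≤n
  slope-positive (suc (suc zero))       = s≤s z≤n
  slope-positive (suc (suc (suc zero))) = s≤s z≤n

  slope-distinct : ∀ j k → j ≢ k → slope j ≢ slope k
  slope-distinct j k j≢k eq = j≢k (go j k eq)
    where
    go : ∀ j k → slope j ≡ slope k → j ≡ k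
    go zero                   zero                   _ = refl
    go zero                   (suc zero)             ()
    go zero                   (suc (suc zero))       ()
    go zero                   (suc (suc (suc zero))) ()
    go (suc zero)             zero                   ()
    go (suc zero)             (suc zero)             _ = refl
    go (suc zero)             (suc (suc zero))       ()
    go (suc zero)             (suc (suc (suc zero))) ()
    go (suc (suc zero))       zero                   ()
    go (suc (suc zero))       (suc zero)             ()
    go (suc (suc zero))       (suc (suc zero))       _ = refl
    go (suc (suc zero))       (suc (suc (suc zero))) ()
    go (suc (suc (suc zero))) zero                   ()
    go (suc (suc (suc zero))) (suc zero)             ()
    go (suc (suc (suc zero))) (suc (suc zero))       ()
    go (suc (suc (suc zero))) (suc (suc (suc zero))) _ = refl

  midpoint< : ∀ {a b z} → z < n → a < n → b + b ≡ a + z → b < n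
  midpoint< z<n a<n eq = ≰⇒> λ n≤b → <⇒≱ (+-mono-< a<n z<n) (≤-trans (+-mono-≤ n≤b n≤b) (≤-reflexive eq))

  step₁ : ∀ i → value (suc zero) i + value (suc zero) i ≡ value zero i + ẑ₁
  step₁ i = trans (lemma y₀ i) (trans (cong (_+ 8 * i) eq₁) (lemma′ e ẑ₁ i))
    where
    lemma : ∀ y i → y + 4 * i + (y + 4 * i) ≡ y + y + 8 * i
    lemma = solve-∀
    lemma′ : ∀ e z i → e + z + 8 * i ≡ e + 8 * i + z
    lemma′ = solve-∀

  step₂ : ∀ i → value (suc (suc zero)) i + value (suc (suc zero)) i ≡ value (suc zero) i + ẑ₂
  step₂ i = trans (lemma w₀ i) (trans (cong (_+ 4 * i) eq₂) (lemma′ y₀ ẑ₂ i))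
    where
    lemma : ∀ y i → y + 2 * i + (y + 2 * i) ≡ y + y + 4 * i
    lemma = solve-∀
    lemma′ : ∀ e z i → e + z + 4 * i ≡ e + 4 * i + z
    lemma′ = solve-∀

  step₃ : ∀ i → value (suc (suc (suc zero))) i + value (suc (suc (suc zero))) i ≡ value (suc (suc zero)) i + ẑ₃
  step₃ i = trans (lemma u₀ i) (trans (cong (_+ 2 * i) eq₃) (lemma′ w₀ ẑ₃ i))
    where
    lemma : ∀ y i → y + 1 * i + (y + 1 * i) ≡ y + y + 2 * i
    lemma = solve-∀
    lemma′ : ∀ e z i → e + z + 2 * i ≡ e + 2 * i + z
    lemma′ = solve-∀

  value₀< : ∀ i → i < N → value zero i < n
  value₀< i i<N = begin-strict
    e + 8 * i       <⟨ +-monoˡ-< (8 * i) e<8 ⟩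
    8 + 8 * i       ≡⟨ *-suc 8 i ⟨
    8 * suc i       ≤⟨ *-monoʳ-≤ 8 i<N ⟩
    8 * N           ≡⟨ *-comm 8 N ⟩
    N * 8           ≤⟨ m/n*n≤m n 8 ⟩
    n               ∎
    where open ≤-Reasoning

  value₁< : ∀ i → i < N → value (suc zero) i < n
  value₁< i i<N = midpoint< (Fin.toℕ<n z₁) (value₀< i i<N) (step₁ i)

  value₂< : ∀ i → i < N → value (suc (suc zero)) i < n
  value₂< i i<N = midpoint< (Fin.toℕ<n z₂) (value₁< i i<N) (step₂ i)

  value< : ∀ j i → i < N → value j i < n
  value< zero                   i i<N = value₀< i i<N
  value< (suc zero)             i i<N = value₁< i i<N
  value< (suc (suc zero))       i i<N = value₂< i i<N
  value< (suc (suc (suc zero))) i i<N = midpoint< (Fin.toℕ<n z₃) (value₂< i i<N) (step₃ i)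

  point : Fin 4 → Fin N → Fin n
  point j i = fromℕ< (value< j (toℕ i) (Fin.toℕ<n i))

  toℕ-point : ∀ j i → toℕ (point j i) ≡ value j (toℕ i)
  toℕ-point j i = Fin.toℕ-fromℕ< (value< j (toℕ i) (Fin.toℕ<n i))

  point-value : ∀ j k i i′ → point j i ≡ point k i′ → value j (toℕ i) ≡ value k (toℕ i′)
  point-value j k i i′ eq = trans (sym (toℕ-point j i)) (trans (cong toℕ eq) (toℕ-point k i′))

  point-injective : ∀ j {i i′} → point j i ≡ point j i′ → i ≡ i′
  point-injective j {i} {i′} eq = Fin.toℕ-injective
    (*-cancelˡ-≡ (toℕ i) (toℕ i′) (slope j) {{>-nonZero (slope-positive j)}}
      (+-cancelˡ-≡ (intercept j) _ _ (point-value j j i i′ eq)))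

  Degenerate : Fin 4 → Fin 4 → Fin N → Set
  Degenerate j k i = j ≢ k × point j i ≡ point k i

  degenerate? : ∀ j k → Decidable (Degenerate j k)
  degenerate? j k i = ¬? (j ≟ k) ×-dec (point j i ≟ point k i)

  degenerate-unique : ∀ j k {i i′} → Degenerate j k i → Degenerate j k i′ → i ≡ i′
  degenerate-unique j k {i} {i′} (j≢k , p) (_ , q) with <-cmp (slope j) (slope k)
  ... | tri< s<t _ _ = Fin.toℕ-injective
        (lines-meet-once (intercept j) (intercept k) _ _ (toℕ i) (toℕ i′) s<t (point-value j k i i p) (point-value j k i′ i′ q))
  ... | tri≈ _ eq _  = contradiction eq (slope-distinct j k j≢k)
  ... | tri> _ _ t<s = Fin.toℕ-injective
        (lines-meet-once (intercept k) (intercept j) _ _ (toℕ i) (toℕ i′) t<s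
          (sym (point-value j k i i p)) (sym (point-value j k i′ i′ q)))

  -- Of at least 32m starting points, at most 16 give a chain with a repeated point. Each chosen
  -- chain uses up itself and at most 16 others, and 17m + 16 ≤ 32m once m ≥ 2. Starting points
  -- occupy one residue class modulo 8, which explains 256 = 8 · 32.
  disjoint-chains : ∀ m → 2 ≤ m → m * 256 ≤ n →
    ∃[ cs ] length cs ≡ m × All IsChain cs × AllPairs (λ c c′ → ∀ j k → c j ≢ c′ k) cs
  disjoint-chains m m≥2 m*256≤n =
    let is , len , is⊆ , sep = separated-sublist _≟_ point point-injective m (filter good (allFin N)) (Unique.filter⁺ good (Unique.allFin⁺ N)) enough
    in map (λ i j → point j i) is , trans (List.length-map _ is) len
     , All.map⁺ (All.tabulate λ i∈ → chain _ (proj₂ (∈-filter⁻ good {xs = allFin N} (is⊆ i∈))))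
     , AllPairs.map⁺ sep
    where
    open ≤-Reasoning
    good = avoids? degenerate?
    chain : ∀ i → (∀ j k → ¬ Degenerate j k i) → IsChain (λ j → point j i)
    chain i ok = record
      { link₁ = via zero (suc zero) z₁ (step₁ (toℕ i))
      ; link₂ = via (suc zero) (suc (suc zero)) z₂ (step₂ (toℕ i))
      ; link₃ = via (suc (suc zero)) (suc (suc (suc zero))) z₃ (step₃ (toℕ i))
      ; distinct = λ j k eq → decidable-stable (j ≟ k) λ j≢k → ok j k (j≢k , eq)
      }
      where
      via : ∀ j k (z : Fin n) → value k (toℕ i) + value k (toℕ i) ≡ value j (toℕ i) + toℕ z →
            toℕ (point k i) + toℕ (point k i) ≡ toℕ (point j i) + toℕ z
      via j k z eq rewrite toℕ-point k i | toℕ-point j i = eq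
    32m≤N : 32 * m ≤ N
    32m≤N = begin
      32 * m             ≡⟨ m*n/n≡m (32 * m) 8 ⟨
      32 * m * 8 / 8     ≤⟨ /-monoˡ-≤ 8 (≤-trans (≤-reflexive (lemma m)) m*256≤n) ⟩
      n / 8              ∎
      where
      lemma : ∀ m → 32 * m * 8 ≡ m * 256
      lemma = solve-∀
    enough : m * 17 ≤ length (filter good (allFin N))
    enough = +-cancelʳ-≤ 16 _ _ (begin
      m * 17 + 16                                ≤⟨ ≤-linear 14 (*-monoʳ-≤ 15 m≥2) (lemma m) ⟩
      32 * m                                     ≤⟨ 32m≤N ⟩
      N                                          ≡⟨ length-allFin N ⟨
      length (allFin N)                          ≤⟨ length≤filter-avoids degenerate? (Unique.allFin⁺ N) degenerate-unique ⟩
      length (filter good (allFin N)) + 16       ∎)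
      where
      lemma : ∀ m → 32 * m + 30 ≡ m * 17 + 16 + 15 * m + 14 
      lemma = solve-∀

-- Colourings with three prescribed values

is3AP : ∀ {n} {x y z : Fin n} d → toℕ y ≡ toℕ x + suc d → toℕ z ≡ toℕ x + suc d + suc d → Is3AP x y z
is3AP {n} {x} {y} {z} d y≡ z≡ = fromℕ< d<n ,
  trans (cong suc y≡) (cong (λ e → suc (toℕ x) + suc e) (sym (Fin.toℕ-fromℕ< d<n))) ,
  trans (cong suc z≡) (trans (lemma (toℕ x) d) (cong (λ e → suc (toℕ x) + 2 * suc e) (sym (Fin.toℕ-fromℕ< d<n))))
  where
  d<n : d < n
  d<n = ≤-<-trans (≤-trans (≤-trans (n≤1+n d) (m≤n+m (suc d) (toℕ x + suc d))) (≤-reflexive (sym z≡))) (Fin.toℕ<n z)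
  lemma : ∀ x d → 1 + (x + (1 + d) + (1 + d)) ≡ 1 + x + 2 * (1 + d)
  lemma = solve-∀

-- `Is3AP` has a positive difference, so the order of the points decides in which direction the
-- progression is read.
midpoint⇒3AP : ∀ {n} {x y z : Fin n} → toℕ y + toℕ y ≡ toℕ x + toℕ z → x ≢ y → Is3AP x y z ⊎ Is3AP z y x
midpoint⇒3AP {x = x} {y} {z} eq x≢y with <-cmp (toℕ x) (toℕ y)
... | tri≈ _ x≡y _ = contradiction (Fin.toℕ-injective x≡y) x≢y
... | tri< x<y _ _ with m≤n⇒∃[o]m+o≡n x<y
...   | d , 1+x+d≡y = inj₁ (is3AP d y≡ (+-cancelˡ-≡ (toℕ x) _ _ (trans (sym eq) (trans (cong (λ t → t + t) y≡) (lemma (toℕ x) d)))))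
  where
  y≡ : toℕ y ≡ toℕ x + suc d
  y≡ = trans (sym 1+x+d≡y) (sym (+-suc (toℕ x) d))
  lemma : ∀ x d → x + (1 + d) + (x + (1 + d)) ≡ x + (x + (1 + d) + (1 + d))
  lemma = solve-∀
midpoint⇒3AP {x = x} {y} {z} eq x≢y | tri> _ _ y<x with m≤n⇒∃[o]m+o≡n y<x
...   | d , 1+y+d≡x = inj₂ (is3AP d y≡ (trans x≡ (cong (_+ suc d) y≡)))
  where
  x≡ : toℕ x ≡ toℕ y + suc d
  x≡ = trans (sym 1+y+d≡x) (sym (+-suc (toℕ y) d))
  lemma : ∀ y d z → y + (1 + d) + z ≡ y + (z + (1 + d))
  lemma = solve-∀
  y≡ : toℕ y ≡ toℕ z + suc d
  y≡ = +-cancelˡ-≡ (toℕ y) _ _ (trans eq (trans (cong (_+ toℕ z) x≡) (lemma (toℕ y) d (toℕ z))))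

rainbow-reverse : ∀ {r} {i j k : Fin r} → Rainbow i j k → Rainbow k j i
rainbow-reverse (i≢j , i≢k , j≢k) = j≢k ∘ sym , i≢k ∘ sym , i≢j ∘ sym

length≤count : ∀ n (xs : List ℕ) (χ : ℕ → Bool) → Unique xs → (∀ {x} → x ∈ xs → x < n) →
               (∀ {x} → x ∈ xs → χ x ≡ true) → length xs ≤ count χ n
length≤count n xs χ xs! xs< xs⊆χ = begin
  length xs                                                 ≤⟨ unique⊆⇒length≤ ℕ._≟_ xs! (λ x∈ → ∈-filter⁺ χ? (∈-downFrom⁺ (xs< x∈)) (xs⊆χ x∈)) ⟩
  length (filter χ? (downFrom n))                           ≡⟨ length-filter≡sumOver χ? (downFrom n) ⟩
  sumOver (downFrom n) (λ t → indicator (χ? t))             ≡⟨ go n ⟩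
  count χ n                                                 ∎
  where
  open ≤-Reasoning
  χ? : Decidable (λ t → χ t ≡ true)
  χ? t = χ t Bool.≟ true
  go : ∀ n → sumOver (downFrom n) (λ t → indicator (χ? t)) ≡ count χ n
  go zero = refl
  go (suc n) with χ n
  ... | true  = trans (cong suc (go n)) (+-comm 1 (count χ n))
  ... | false = trans (go n) (sym (+-identityʳ (count χ n)))

module _ {r : ℕ} (r≥2 : 2 ≤ r) where

  open Palettes r≥2

  pick-surjective : ∀ {l} (pal : Fin l → C × C) v → (∀ i → lookup v i ∈₂ pal i) → ∃[ b ] pick pal b ≡ v
  pick-surjective pal []      _ = [] , refl
  pick-surjective pal (k ∷ v) v∈ with v∈ zero | pick-surjective (pal ∘ suc) v (v∈ ∘ suc)
  ... | inj₁ refl | b , refl = true ∷ b , refl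
  ... | inj₂ refl | b , refl = false ∷ b , refl

  not-rainbow : ∀ {i j k : C} → ¬ Rainbow i j k → i ≢ j → i ≢ k → j ≡ k
  not-rainbow {i} {j} {k} ¬R i≢j i≢k = decidable-stable (j ≟ k) λ j≢k → ¬R (i≢j , i≢k , j≢k)

  ∈₂-dec : ∀ k pal → Dec (k ∈₂ pal)
  ∈₂-dec k (p , q) with k ≟ p | k ≟ q
  ... | yes e | _     = yes (inj₁ e)
  ... | no _  | yes e = yes (inj₂ e)
  ... | no ¬e | no ¬f = no λ { (inj₁ e) → ¬e e ; (inj₂ f) → ¬f f }

  -- Take b ≠ k in the second palette. Were k outside the first, both of its colours would have to
  -- equal b. Hence k is one of them, and any b ≠ k must equal the other one.
  linked : ∀ pal pal′ k → proj₁ pal ≢ proj₂ pal → proj₁ pal′ ≢ proj₂ pal′ →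
           (∀ a b → a ∈₂ pal → b ∈₂ pal′ → ¬ Rainbow a b k) → k ∈₂ pal × (∀ b → b ∈₂ pal′ → b ∈₂ pal)
  linked (p , q) (p′ , q′) k p≢q p′≢q′ free = k∈ , ⊆
    where
    k∈ : k ∈₂ (p , q)
    k∈ = decidable-stable (∈₂-dec k (p , q)) λ k∉ → absurd k∉
      where
      absurd : ¬ (k ∈₂ (p , q)) → ⊥
      absurd k∉ with p′ ≟ k
      ... | no p′≢k = p≢q (trans (p≡ p (inj₁ refl) (k∉ ∘ inj₁ ∘ sym)) (sym (p≡ q (inj₂ refl) (k∉ ∘ inj₂ ∘ sym))))
        where
        p≡ : ∀ a → a ∈₂ (p , q) → a ≢ k → a ≡ p′
        p≡ a a∈ a≢k = decidable-stable (a ≟ p′) λ a≢p′ → p′≢k (not-rainbow (free a p′ a∈ (inj₁ refl)) a≢p′ a≢k)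
      ... | yes p′≡k = p≢q (trans (p≡ p (inj₁ refl) (k∉ ∘ inj₁ ∘ sym)) (sym (p≡ q (inj₂ refl) (k∉ ∘ inj₂ ∘ sym))))
        where
        p≡ : ∀ a → a ∈₂ (p , q) → a ≢ k → a ≡ q′
        p≡ a a∈ a≢k = decidable-stable (a ≟ q′) λ a≢q′ →
          p′≢q′ (trans p′≡k (sym (not-rainbow (free a q′ a∈ (inj₂ refl)) a≢q′ a≢k)))
    ⊆ : ∀ b → b ∈₂ (p′ , q′) → b ∈₂ (p , q)
    ⊆ b b∈ with b ≟ k | k∈
    ... | yes refl | _          = k∈
    ... | no b≢k   | inj₁ refl = inj₂ (sym (decidable-stable (q ≟ b) λ q≢b → b≢k (not-rainbow (free q b (inj₂ refl) b∈) q≢b (p≢q ∘ sym))))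
    ... | no b≢k   | inj₂ refl = inj₁ (sym (decidable-stable (p ≟ b) λ p≢b → b≢k (not-rainbow (free p b (inj₁ refl) b∈) p≢b p≢q)))

  no-three-in-two : ∀ pal {k₁ k₂ k₃ : C} → Rainbow k₁ k₂ k₃ → k₁ ∈₂ pal → k₂ ∈₂ pal → ¬ (k₃ ∈₂ pal)
  no-three-in-two pal (d₁₂ , d₁₃ , d₂₃) (inj₁ refl) (inj₁ e)    _           = d₁₂ (sym e)
  no-three-in-two pal (d₁₂ , d₁₃ , d₂₃) (inj₁ refl) (inj₂ e)    (inj₁ e′)   = d₁₃ (sym e′)
  no-three-in-two pal (d₁₂ , d₁₃ , d₂₃) (inj₁ refl) (inj₂ e)    (inj₂ e′)   = d₂₃ (trans e (sym e′))
  no-three-in-two pal (d₁₂ , d₁₃ , d₂₃) (inj₂ refl) (inj₂ e)    _           = d₁₂ (sym e)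
  no-three-in-two pal (d₁₂ , d₁₃ , d₂₃) (inj₂ refl) (inj₁ e)    (inj₂ e′)   = d₁₃ (sym e′)
  no-three-in-two pal (d₁₂ , d₁₃ , d₂₃) (inj₂ refl) (inj₁ e)    (inj₁ e′)   = d₂₃ (trans e (sym e′))

  module _ {n : ℕ} (A : Subset n) (k₀ : C) where

    extend : Coloring r A → Fin n → C
    extend c x with x ∈ˢ? A
    ... | yes p = colour c p
    ... | no _  = k₀

    extend-∈ : ∀ c {x} (p : x ∈ˢ A) → extend c x ≡ colour c p
    extend-∈ c {x} p with x ∈ˢ? A
    ... | yes q = cong (colour c) (∈-irrelevant q p)
    ... | no ¬p = contradiction p ¬p

    extend-∉ : ∀ c {x} → x ∉ˢ A → extend c x ≡ k₀
    extend-∉ c {x} ¬p with x ∈ˢ? A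
    ... | yes p = contradiction p ¬p
    ... | no _  = refl

    extend-injective : ∀ c c′ → (∀ x → extend c x ≡ extend c′ x) → c ≡ c′
    extend-injective c c′ eq = colour-injective c c′ λ {x} p → trans (sym (extend-∈ c p)) (trans (eq x) (extend-∈ c′ p))

    extend-free : ∀ c → RainbowFree c → ∀ {x y z} → Is3AP x y z → x ∈ˢ A → y ∈ˢ A → z ∈ˢ A →
                  ¬ Rainbow (extend c x) (extend c y) (extend c z)
    extend-free c free {x} {y} {z} ap p q s (x≢y , x≢z , y≢z) = free x y z p q s ap
      ( (λ e → x≢y (trans (extend-∈ c p) (trans e (sym (extend-∈ c q)))))
      , (λ e → x≢z (trans (extend-∈ c p) (trans e (sym (extend-∈ c s)))))
      , (λ e → y≢z (trans (extend-∈ c q) (trans e (sym (extend-∈ c s))))))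

    extend-free-midpoint : ∀ c → RainbowFree c → ∀ {x y z} → toℕ y + toℕ y ≡ toℕ x + toℕ z → x ≢ y →
                           x ∈ˢ A → y ∈ˢ A → z ∈ˢ A → ¬ Rainbow (extend c x) (extend c y) (extend c z)
    extend-free-midpoint c free eq x≢y p q s with midpoint⇒3AP eq x≢y
    ... | inj₁ ap = extend-free c free ap p q s
    ... | inj₂ ap = extend-free c free ap s q p ∘ rainbow-reverse

    -- Coding colourings by chains and single points

    open Shattering r≥2 n
    open Block

    single : Fin n → Block
    single x = record
      { size = 1 ; place = λ _ → x ; Allowed = λ _ → Unit ; bound = 2
      ; bounded = λ S? _ → three-coloured-or-≤2^ S? }

    encode : ∀ bs → (Fin n → C) → Code bs
    encode []       f = tt
    encode (b ∷ bs) f = Vec.tabulate (f ∘ place b) , encode bs f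

    assigned-encode : ∀ bs f {x k} → Assigned bs (encode bs f) x k → f x ≡ k
    assigned-encode (b ∷ bs) f (inj₁ (i , refl , eq)) = trans (sym (Vec.lookup∘tabulate (f ∘ place b) i)) eq
    assigned-encode (b ∷ bs) f (inj₂ as)              = assigned-encode bs f as

    encode-injective : ∀ bs f h → encode bs f ≡ encode bs h → ∀ {x} → Places bs x → f x ≡ h x
    encode-injective (b ∷ bs) f h eq (inj₁ (i , refl)) =
      trans (sym (Vec.lookup∘tabulate (f ∘ place b) i))
        (trans (cong (λ c → lookup (proj₁ c) i) eq) (Vec.lookup∘tabulate (h ∘ place b) i))
    encode-injective (b ∷ bs) f h eq (inj₂ pl) = encode-injective bs f h (cong proj₂ eq) pl

    module _ {k₁ k₂ k₃ : C} (k-rainbow : Rainbow k₁ k₂ k₃) where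

      -- A chain inside A with four full two-colour palettes would have all palettes equal, containing
      -- the three colours k₁, k₂, k₃; so at most 15 of the 16 patterns occur.
      quad : (Fin 4 → Fin n) → Block
      quad c = record
        { size = 4 ; place = c ; Allowed = allowed ; bound = 15
        ; bounded = λ S? S⇒ → three-coloured-or-<2^ S? λ pal pal≢ full →
            thin pal pal≢ λ v v∈ → let b , eq = pick-surjective pal v v∈ in subst allowed eq (S⇒ _ (full b)) }
        where
        allowed : Vec C 4 → Set
        allowed (a ∷ b ∷ d ∷ e ∷ []) =
          (∀ i → c i ∉ˢ A → lookup (a ∷ b ∷ d ∷ e ∷ []) i ≡ k₀) ×
          ((∀ i → c i ∈ˢ A) → ¬ Rainbow a b k₁ × ¬ Rainbow b d k₂ × ¬ Rainbow d e k₃)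

        thin : ∀ pal → (∀ i → proj₁ (pal i) ≢ proj₂ (pal i)) → ¬ (∀ v → (∀ i → lookup v i ∈₂ pal i) → allowed v)
        thin pal pal≢ full with choice (λ i → ∈-or-∉ (c i))
          where
          ∈-or-∉ : ∀ x → x ∉ˢ A ⊎ x ∈ˢ A
          ∈-or-∉ x with x ∈ˢ? A
          ... | yes p = inj₂ p
          ... | no ¬p = inj₁ ¬p
        -- A chain that leaves `A` is covered as well: at a point outside `A` only `k₀` is allowed,
        -- so two distinct palette colours cannot both occur there.
        ... | inj₁ (i , c∉A) = pal≢ i (trans (forced proj₁ (λ _ → inj₁ refl)) (sym (forced proj₂ (λ _ → inj₂ refl))))
          where
          forced : (side : C × C → C) → (∀ p → side p ∈₂ p) → side (pal i) ≡ k₀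
          forced side side∈ = trans (sym (Vec.lookup∘tabulate (side ∘ pal) i))
            (proj₁ (full (Vec.tabulate (side ∘ pal)) λ j →
              subst (_∈₂ pal j) (sym (Vec.lookup∘tabulate (side ∘ pal) j)) (side∈ (pal j))) i c∉A)
        ... | inj₂ c∈A = no-three-in-two (pal zero) k-rainbow (proj₁ l₁) (proj₂ l₁ _ (proj₁ l₂)) (proj₂ l₁ _ (proj₂ l₂ _ (proj₁ l₃)))
          where
          p₀ = proj₁ ∘ pal
          i₀ i₁ i₂ i₃ : Fin 4
          i₀ = zero
          i₁ = suc zero
          i₂ = suc (suc zero)
          i₃ = suc (suc (suc zero))
          l₁ = linked (pal i₀) (pal i₁) k₁ (pal≢ i₀) (pal≢ i₁) λ a b a∈ b∈ →
                 proj₁ (proj₂ (full (a ∷ b ∷ p₀ i₂ ∷ p₀ i₃ ∷ [])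
                   λ { zero → a∈ ; (suc zero) → b∈ ; (suc (suc zero)) → inj₁ refl ; (suc (suc (suc zero))) → inj₁ refl }) c∈A)
          l₂ = linked (pal i₁) (pal i₂) k₂ (pal≢ i₁) (pal≢ i₂) λ a b a∈ b∈ →
                 proj₁ (proj₂ (proj₂ (full (p₀ i₀ ∷ a ∷ b ∷ p₀ i₃ ∷ [])
                   λ { zero → inj₁ refl ; (suc zero) → a∈ ; (suc (suc zero)) → b∈ ; (suc (suc (suc zero))) → inj₁ refl }) c∈A))
          l₃ = linked (pal i₂) (pal i₃) k₃ (pal≢ i₂) (pal≢ i₃) λ a b a∈ b∈ →
                 proj₂ (proj₂ (proj₂ (full (p₀ i₀ ∷ p₀ i₁ ∷ a ∷ b ∷ [])
                   λ { zero → inj₁ refl ; (suc zero) → inj₁ refl ; (suc (suc zero)) → a∈ ; (suc (suc (suc zero))) → b∈ }) c∈A))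

      build : List (Fin 4 → Fin n) → List (Fin n) → List Block
      build cs xs = map quad cs ++ map single xs

      places-singles : ∀ xs {x} → Places (map single xs) x → x ∈ xs
      places-singles (x ∷ xs) (inj₁ (_ , refl)) = here refl
      places-singles (x ∷ xs) (inj₂ pl)         = there (places-singles xs pl)

      disjoint-singles : ∀ xs → Unique xs → DisjointPlaces (map single xs)
      disjoint-singles []       []           = tt
      disjoint-singles (x ∷ xs) (x∉xs ∷ xs!) =
        (λ _ pl → All.lookup x∉xs (places-singles xs pl) refl) , disjoint-singles xs xs!

      places-build : ∀ cs xs {x} → Places (build cs xs) x → (∃[ c ] c ∈ cs × ∃[ j ] c j ≡ x) ⊎ x ∈ xs
      places-build []       xs pl                = inj₂ (places-singles xs pl)
      places-build (c ∷ cs) xs (inj₁ (j , eq))   = inj₁ (c , here refl , j , eq)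
      places-build (c ∷ cs) xs (inj₂ pl) with places-build cs xs pl
      ... | inj₁ (c′ , c′∈ , hit) = inj₁ (c′ , there c′∈ , hit)
      ... | inj₂ x∈               = inj₂ x∈

      Apart : (c c′ : Fin 4 → Fin n) → Set
      Apart c c′ = ∀ j k → c j ≢ c′ k

      disjoint-build : ∀ cs xs → AllPairs Apart cs → (∀ {c} → c ∈ cs → ∀ j → c j ∉ xs) → Unique xs →
                       DisjointPlaces (build cs xs)
      disjoint-build []       xs _              _      xs! = disjoint-singles xs xs!
      disjoint-build (c ∷ cs) xs (apart ∷ cs!) avoid xs! = fresh , disjoint-build cs xs cs! (avoid ∘ there) xs!
        where
        fresh : ∀ i → ¬ Places (build cs xs) (c i)
        fresh i pl with places-build cs xs pl
        ... | inj₁ (c′ , c′∈ , j , eq) = All.lookup apart c′∈ i j (sym eq)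
        ... | inj₂ x∈                  = avoid (here refl) i x∈

      length-build : ∀ cs xs → length (build cs xs) ≡ length cs + length xs
      length-build cs xs = trans (List.length-++ (map quad cs)) (cong₂ _+_ (List.length-map quad cs) (List.length-map single xs))

      quadWeight : ℕ
      quadWeight = r ^ 4 * (4 * r ^ 3)

      length-words : ∀ l → length (vectors (allFin r) l) ≡ r ^ l
      length-words l = trans (length-vectors (allFin r) l) (cong (_^ l) (length-allFin r))

      weight≤ : ∀ l → 1 ≤ l → l ≤ 4 →
        length (vectors (allFin r) l) * (length (allFin l) * length (vectors (allFin r) 3)) ≤ quadWeight
      weight≤ l 1≤l l≤4 rewrite length-words l | length-words 3 | length-allFin l =
        *-mono-≤ (^-monoʳ-≤ r {{>-nonZero (≤-trans (s≤s z≤n) r≥2)}} l≤4) (*-monoˡ-≤ (r ^ 3) l≤4)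

      capacity-singles : ∀ Λ xs → capacity Λ (map single xs) ≤ (2 * Λ + quadWeight) ^ length xs
      capacity-singles Λ []       = ≤-refl
      capacity-singles Λ (x ∷ xs) =
        *-mono-≤ (+-monoʳ-≤ (2 * Λ) (weight≤ 1 (s≤s z≤n) (s≤s z≤n))) (capacity-singles Λ xs)

      capacity-build : ∀ Λ cs xs →
        capacity Λ (build cs xs) ≤ (15 * Λ + quadWeight) ^ length cs * (2 * Λ + quadWeight) ^ length xs
      capacity-build Λ []       xs = ≤-trans (capacity-singles Λ xs) (≤-reflexive (sym (*-identityˡ _)))
      capacity-build Λ (c ∷ cs) xs = ≤-trans
        (*-mono-≤ (+-monoʳ-≤ (15 * Λ) (weight≤ 4 (s≤s z≤n) ≤-refl)) (capacity-build Λ cs xs))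
        (≤-reflexive (sym (*-assoc (15 * Λ + quadWeight) ((15 * Λ + quadWeight) ^ length cs) _)))

      module _ (L : List (Coloring r A)) (L! : Unique L) (L-free : ∀ {c} → c ∈ L → RainbowFree c) where

        module _ (bs : List Block) (cover : ∀ x → Places bs x) where

          Coded : Code bs → Set
          Coded c = c ∈ map (encode bs ∘ extend) L

          coded? : Decidable Coded
          coded? c = Any.any? (code-≟ bs c) (map (encode bs ∘ extend) L)

          length≤coded : length L ≤ total bs (λ c → indicator (coded? c))
          length≤coded = ≤-trans (≤-reflexive (sym (List.length-map (encode bs ∘ extend) L)))
            (unique⇒length≤total bs coded? (Unique.map⁺ injective L!) id)
            where
            injective : ∀ {c c′} → encode bs (extend c) ≡ encode bs (extend c′) → c ≡ c′
            injective {c} {c′} eq = extend-injective c c′ λ x → encode-injective bs (extend c) (extend c′) eq (cover x)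

          -- Shattered sets contain no progression

          module _ (X : Triples) (distinct : All (λ (x , T) → Distinct T) X) (shatters : Shatters bs Coded X) where

            colouring : (s : Fin n → Fin 3) → ∃[ c ] c ∈ L × (∀ {x T} → (x , T) ∈ X → extend c x ≡ lookup T (s x))
            colouring s with shatters s
            ... | code , code∈ , as with ∈-map⁻ (encode bs ∘ extend) code∈
            ... | c , c∈L , refl = c , c∈L , λ xT∈ → assigned-encode bs (extend c) (All.lookup as xT∈)

            -- Outside `A` every extended colouring has the colour `k₀`, whereas a shattered point
            -- takes at least two distinct colours.
            shattered⊆A : ∀ {x T} → (x , T) ∈ X → x ∈ˢ A
            shattered⊆A {x} {T} xT∈ with x ∈ˢ? A
            ... | yes p = p
            ... | no ¬p with colouring (λ _ → zero) | colouring (λ _ → suc zero)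
            ...   | c , _ , eq | c′ , _ , eq′ = contradiction
                      (All.lookup distinct xT∈ zero (suc zero) (trans (sym (eq xT∈)) (trans (extend-∉ c ¬p) (trans (sym (extend-∉ c′ ¬p)) (eq′ xT∈))))) λ ()

            avoiding : ∀ T → Distinct T → ∀ a b → ∃[ i ] lookup T i ≢ a × lookup T i ≢ b
            avoiding T T! a b with lookup T zero ≟ a | lookup T zero ≟ b | lookup T (suc zero) ≟ a | lookup T (suc zero) ≟ b
            ... | no ¬a | no ¬b | _ | _ = zero , ¬a , ¬b
            ... | _ | _ | no ¬a | no ¬b = suc zero , ¬a , ¬b
            ... | yes e | _ | yes e′ | _ = contradiction (T! zero (suc zero) (trans e (sym e′))) λ ()
            ... | _ | yes e | _ | yes e′ = contradiction (T! zero (suc zero) (trans e (sym e′))) λ ()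
            ... | yes e | no _ | no _ | yes e′ = suc (suc zero) ,
                (λ h → contradiction (T! zero (suc (suc zero)) (trans e (sym h))) λ ()) ,
                (λ h → contradiction (T! (suc zero) (suc (suc zero)) (trans e′ (sym h))) λ ())
            ... | no _ | yes e | yes e′ | no _ = suc (suc zero) ,
                (λ h → contradiction (T! (suc zero) (suc (suc zero)) (trans e′ (sym h))) λ ()) ,
                (λ h → contradiction (T! zero (suc (suc zero)) (trans e (sym h))) λ ())

            -- Three colours per point leave room for a greedy choice: any colour at x, a different
            -- one at y, a third one at z. Shattering provides a colouring with these values, and
            -- its progression is rainbow.
            no-progression : ∀ {x y z T U V} → (x , T) ∈ X → (y , U) ∈ X → (z , V) ∈ X →
                             Is3AP x y z → x ≢ y → x ≢ z → y ≢ z → ⊥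
            no-progression {x} {y} {z} {T} {U} {V} xT∈ yU∈ zV∈ ap x≢y x≢z y≢z
              with avoiding U (All.lookup distinct yU∈) (lookup T zero) (lookup T zero)
            ... | j , Uj≢T₀ , _ with avoiding V (All.lookup distinct zV∈) (lookup T zero) (lookup U j)
            ... | k , Vk≢T₀ , Vk≢Uj with colouring s
              where
              s : Fin n → Fin 3
              s t with t ≟ y | t ≟ z
              ... | yes _ | _     = j
              ... | no _  | yes _ = k
              ... | no _  | no _  = zero
            ... | c , c∈L , eq = extend-free c (L-free c∈L) ap (shattered⊆A xT∈) (shattered⊆A yU∈) (shattered⊆A zV∈)
                  ( (λ e → Uj≢T₀ (trans (sym cy) (trans (sym e) cx)))
                  , (λ e → Vk≢T₀ (trans (sym cz) (trans (sym e) cx)))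
                  , (λ e → Vk≢Uj (trans (sym cz) (trans (sym e) cy))))
              where
              cx : extend c x ≡ lookup T zero
              cx with x ≟ y | x ≟ z | eq xT∈
              ... | yes e | _     | _ = contradiction e x≢y
              ... | no _  | yes e | _ = contradiction e x≢z
              ... | no _  | no _  | h = h
              cy : extend c y ≡ lookup U j
              cy with y ≟ y | y ≟ z | eq yU∈
              ... | yes _ | _ | h = h
              ... | no ¬e | _ | _ = contradiction refl ¬e
              cz : extend c z ≡ lookup V k
              cz with z ≟ y | z ≟ z | eq zV∈
              ... | yes e | _     | _ = contradiction (sym e) y≢z
              ... | no _  | yes _ | h = h
              ... | no _  | no ¬e | _ = contradiction refl ¬e

            support : List ℕ
            support = map (toℕ ∘ proj₁) X

            χ : ℕ → Bool
            χ t = does (Any.any? (t ℕ.≟_) support)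

            χ-witness : ∀ t → χ t ≡ true → ∃[ x ] ∃[ T ] (x , T) ∈ X × t ≡ toℕ x
            χ-witness t eq with Any.any? (t ℕ.≟_) support
            ... | yes t∈ = let (x , T) , xT∈ , t≡ = ∈-map⁻ (toℕ ∘ proj₁) t∈ in x , T , xT∈ , t≡

            χ-complete : ∀ {t} → t ∈ support → χ t ≡ true
            χ-complete {t} t∈ with Any.any? (t ℕ.≟_) support
            ... | yes _ = refl
            ... | no ¬t = contradiction t∈ ¬t

            χ-free : APFree χ
            χ-free a d p q s with χ-witness _ p | χ-witness _ q | χ-witness _ s
            ... | x , T , xT∈ , refl | y , U , yU∈ , y≡ | z , V , zV∈ , z≡ =
              no-progression xT∈ yU∈ zV∈ (is3AP d (sym y≡) (sym z≡))
                (λ { refl → m≢1+m+n (toℕ x) (trans (sym y≡) (+-suc (toℕ x) d)) })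
                (λ { refl → m≢1+m+n (toℕ x) (trans (sym z≡) (lemma (toℕ x) d)) })
                (λ { refl → m≢1+m+n (toℕ x + suc d) (trans y≡ (trans (sym z≡) (+-suc (toℕ x + suc d) d))) })
              where
              lemma : ∀ x d → x + (1 + d) + (1 + d) ≡ 1 + (x + (d + (1 + d)))
              lemma = solve-∀

            length≤support : Unique (map proj₁ X) → length X ≤ count χ n
            length≤support X! = ≤-trans (≤-reflexive (sym (List.length-map (toℕ ∘ proj₁) X)))
              (length≤count n support χ
                (subst Unique (sym (List.map-∘ X)) (Unique.map⁺ Fin.toℕ-injective X!))
                (λ t∈ → let (x , T) , _ , t≡ = ∈-map⁻ (toℕ ∘ proj₁) t∈ in subst (_< n) (sym t≡) (Fin.toℕ<n x))
                χ-complete)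

          -- A shattered set is progression-free, so K times its size is at most n < K (D + 1). It
          -- has at most D points, which turns the price of shattering into `Λ ^ D`.
          coded-bound : ∀ K D Λ → 1 ≤ K → 1 ≤ Λ → n < K * suc D → (∀ X → APFree X → K * count X n ≤ n) →
                        (∀ {c} → c ∈ L → AllAllowed bs (encode bs (extend c))) → DisjointPlaces bs →
                        length L * Λ ^ length bs ≤ Λ ^ D * capacity Λ bs
          coded-bound K D Λ K≥1 Λ≥1 n<K roth-n L-allowed disjoint = begin
            length L * Λ ^ length bs                                          ≤⟨ *-monoˡ-≤ (Λ ^ length bs) length≤coded ⟩
            total bs (λ c → indicator (coded? c)) * Λ ^ length bs             ≡⟨ cong (_* Λ ^ length bs) (*-identityˡ (total bs (λ c → indicator (coded? c)))) ⟨
            1 * total bs (λ c → indicator (coded? c)) * Λ ^ length bs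
              ≤⟨ sauer-shelah Λ bs coded? 1 (Λ ^ D)
                   (λ code code∈ → let c , c∈L , eq = ∈-map⁻ (encode bs ∘ extend) code∈ in subst (AllAllowed bs) (sym eq) (L-allowed c∈L))
                   disjoint small ⟩
            Λ ^ D * capacity Λ bs ∎
            where
            open ≤-Reasoning
            small : ∀ X → WellPlaced bs X → Shatters bs Coded X → 1 * Λ ^ length X ≤ Λ ^ D
            small X (X! , wf) sh = ≤-trans (≤-reflexive (*-identityˡ _)) (^-monoʳ-≤ Λ {{>-nonZero Λ≥1}} (≤-pred
              (*-cancelˡ-< K (length X) (suc D) (begin-strict
                K * length X             ≤⟨ *-monoʳ-≤ K (length≤support X (All.map proj₂ wf) sh X!) ⟩
                K * count (χ X (All.map proj₂ wf) sh) n
                                         ≤⟨ roth-n _ (χ-free X (All.map proj₂ wf) sh) ⟩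
                n                        <⟨ n<K ⟩
                K * suc D                ∎))))

        chains-bound : ∀ z₁ z₂ z₃ → z₁ ∈ˢ A → z₂ ∈ˢ A → z₃ ∈ˢ A →
          (∀ {c} → c ∈ L → extend c z₁ ≡ k₁ × extend c z₂ ≡ k₂ × extend c z₃ ≡ k₃) →
          ∀ cs → All (IsChain z₁ z₂ z₃) cs → AllPairs Apart cs →
          ∀ K D Λ → 1 ≤ K → 1 ≤ Λ → n < K * suc D → (∀ X → APFree X → K * count X n ≤ n) →
          ∃[ s ] 4 * length cs + s ≤ n ×
            length L * Λ ^ (length cs + s) ≤ Λ ^ D * ((15 * Λ + quadWeight) ^ length cs * (2 * Λ + quadWeight) ^ s)
        chains-bound z₁ z₂ z₃ z₁∈ z₂∈ z₃∈ fixed cs chains apart K D Λ K≥1 Λ≥1 n<K roth-n = length xs , room , (begin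
          length L * Λ ^ (length cs + length xs)                  ≡⟨ cong (λ k → length L * Λ ^ k) (length-build cs xs) ⟨
          length L * Λ ^ length (build cs xs)                     ≤⟨ coded-bound (build cs xs) cover K D Λ K≥1 Λ≥1 n<K roth-n allowed
                                                                       (disjoint-build cs xs apart outside-used (Unique.filter⁺ outside? (Unique.allFin⁺ n))) ⟩
          Λ ^ D * capacity Λ (build cs xs)                        ≤⟨ *-monoʳ-≤ (Λ ^ D) (capacity-build Λ cs xs) ⟩
          Λ ^ D * ((15 * Λ + quadWeight) ^ length cs * (2 * Λ + quadWeight) ^ length xs) ∎)
          where
          open ≤-Reasoning
          used : List (Fin n)
          used = concat (map List.tabulate cs)
          outside? : Decidable (_∉ used)
          outside? x = ¬? (Any.any? (x ≟_) used)
          -- All points off the chains become single blocks, so that the code determines the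
          -- colouring.
          xs = filter outside? (allFin n)

          ∈-used : ∀ {cs : List (Fin 4 → Fin n)} {c} → c ∈ cs → ∀ j → c j ∈ concat (map List.tabulate cs)
          ∈-used {c = c} (here refl) j = ∈-++⁺ˡ (∈-tabulate⁺ {f = c} j)
          ∈-used (there c∈)  j = ∈-++⁺ʳ _ (∈-used c∈ j)

          used-places : ∀ cs {x} → x ∈ concat (map List.tabulate cs) → Places (build cs xs) x
          used-places (c ∷ cs) x∈ with ∈-++⁻ (List.tabulate c) x∈
          ... | inj₁ x∈c = let j , eq = ∈-tabulate⁻ {f = c} x∈c in inj₁ (j , sym eq)
          ... | inj₂ x∈cs = inj₂ (used-places cs x∈cs)

          single-places : ∀ cs xs {x} → x ∈ xs → Places (build cs xs) x
          single-places []       (x ∷ xs) (here refl) = inj₁ (zero , refl)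
          single-places []       (x ∷ xs) (there x∈)  = inj₂ (single-places [] xs x∈)
          single-places (c ∷ cs) xs       x∈          = inj₂ (single-places cs xs x∈)

          cover : ∀ x → Places (build cs xs) x
          cover x with Any.any? (x ≟_) used
          ... | yes x∈ = used-places cs x∈
          ... | no x∉  = single-places cs xs (∈-filter⁺ outside? (∈-allFin x) x∉)

          outside-used : ∀ {c} → c ∈ cs → ∀ j → c j ∉ xs
          outside-used c∈ j cj∈xs = proj₂ (∈-filter⁻ outside? {xs = allFin n} cj∈xs) (∈-used c∈ j)

          length-used : ∀ (cs : List (Fin 4 → Fin n)) → length (concat (map (λ c → List.tabulate {n = 4} c) cs)) ≡ 4 * length cs
          length-used []       = refl
          length-used (c ∷ cs) = trans (cong (4 +_) (length-used cs)) (sym (*-suc 4 (length cs)))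

          used! : Unique used
          used! = Unique.concat⁺
            (All.map⁺ (All.map (λ ch → Unique.tabulate⁺ λ {j} {k} → IsChain.distinct ch j k) chains))
            (AllPairs.map⁺ (AllPairs.map (λ {c} {c′} sep {x} → disjoint {c} {c′} sep {x}) apart))
            where
            disjoint : ∀ {c c′ : Fin 4 → Fin n} → Apart c c′ → ∀ {x} →
                       ¬ (x ∈ List.tabulate c × x ∈ List.tabulate c′)
            disjoint {c} {c′} sep (x∈ , x∈′) =
              let j , eq = ∈-tabulate⁻ {f = c} x∈ ; k , eq′ = ∈-tabulate⁻ {f = c′} x∈′ in sep j k (trans (sym eq) eq′)

          room : 4 * length cs + length xs ≤ n
          room = begin
            4 * length cs + length xs    ≡⟨ cong (_+ length xs) (length-used cs) ⟨
            length used + length xs      ≡⟨ List.length-++ used ⟨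
            length (used ++ xs)          ≤⟨ unique⊆⇒length≤ _≟_ (Unique.++⁺ used! (Unique.filter⁺ outside? (Unique.allFin⁺ n))
                                              λ (x∈ , x∈xs) → proj₂ (∈-filter⁻ outside? {xs = allFin n} x∈xs) x∈)
                                              (λ {x} _ → ∈-allFin x) ⟩
            length (allFin n)            ≡⟨ length-allFin n ⟩
            n                            ∎

          allowed : ∀ {c} → c ∈ L → AllAllowed (build cs xs) (encode (build cs xs) (extend c))
          allowed {c} c∈L = quads cs chains
            where
            f = extend c
            f-free = extend-free-midpoint c (L-free c∈L)
            singles : ∀ xs → AllAllowed (map single xs) (encode (map single xs) f)
            singles []       = tt
            singles (x ∷ xs) = tt , singles xs
            quads : ∀ cs → All (IsChain z₁ z₂ z₃) cs → AllAllowed (build cs xs) (encode (build cs xs) f)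
            quads []       _         = singles xs
            quads (q ∷ cs) (ch ∷ chs) =
              ( (λ { zero → extend-∉ c ; (suc zero) → extend-∉ c ; (suc (suc zero)) → extend-∉ c ; (suc (suc (suc zero))) → extend-∉ c })
              , λ q∈ →
                  subst (λ k → ¬ Rainbow _ _ k) (proj₁ (fixed c∈L)) (f-free link₁ (λ e → contradiction (distinct _ _ e) λ ()) (q∈ _) (q∈ _) z₁∈)
                , subst (λ k → ¬ Rainbow _ _ k) (proj₁ (proj₂ (fixed c∈L))) (f-free link₂ (λ e → contradiction (distinct _ _ e) λ ()) (q∈ _) (q∈ _) z₂∈)
                , subst (λ k → ¬ Rainbow _ _ k) (proj₂ (proj₂ (fixed c∈L))) (f-free link₃ (λ e → contradiction (distinct _ _ e) λ ()) (q∈ _) (q∈ _) z₃∈) )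
              , quads cs chs
              where open IsChain ch

-- Exponential estimates

^-distribʳ-* : ∀ k m n → (m * n) ^ k ≡ m ^ k * n ^ k
^-distribʳ-* zero    m n = refl
^-distribʳ-* (suc k) m n = trans (cong (m * n *_) (^-distribʳ-* k m n)) (lemma m n (m ^ k) (n ^ k))
  where
  lemma : ∀ m n a b → m * n * (a * b) ≡ m * a * (n * b)
  lemma = solve-∀

-- This is (1 + 1/a)^x ≥ 1 + x/a with denominators cleared.
bernoulli : ∀ a x → (a + x) * a ^ x ≤ a * suc a ^ x
bernoulli a zero    = ≤-reflexive (cong (_* 1) (+-identityʳ a))
bernoulli a (suc x) = begin
  (a + suc x) * (a * a ^ x)            ≤⟨ ≤-linear (x * a ^ x) ≤-refl (lemma a x (a ^ x)) ⟩
  suc a * ((a + x) * a ^ x)            ≤⟨ *-monoʳ-≤ (suc a) (bernoulli a x) ⟩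
  suc a * (a * suc a ^ x)              ≡⟨ lemma′ a (suc a ^ x) ⟩
  a * (suc a * suc a ^ x)              ∎
  where
  open ≤-Reasoning
  lemma : ∀ a x p → (1 + a) * ((a + x) * p) + 0 ≡ (a + (1 + x)) * (a * p) + 0 + x * p
  lemma = solve-∀
  lemma′ : ∀ a q → (1 + a) * (a * q) ≡ a * ((1 + a) * q)
  lemma′ = solve-∀

linear-growth : ∀ a x → x * a ^ x ≤ a * suc a ^ x
linear-growth a x = ≤-trans (*-monoˡ-≤ (a ^ x) (m≤n+m x a)) (bernoulli a x)

fourth-power-growth : ∀ a x → x ^ 4 * a ^ (x * 4) ≤ a ^ 4 * suc a ^ (x * 4)
fourth-power-growth a x = begin
  x ^ 4 * a ^ (x * 4)          ≡⟨ cong (x ^ 4 *_) (^-*-assoc a x 4) ⟨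
  x ^ 4 * (a ^ x) ^ 4          ≡⟨ ^-distribʳ-* 4 x (a ^ x) ⟨
  (x * a ^ x) ^ 4              ≤⟨ ^-monoˡ-≤ 4 (linear-growth a x) ⟩
  (a * suc a ^ x) ^ 4          ≡⟨ ^-distribʳ-* 4 a (suc a ^ x) ⟩
  a ^ 4 * (suc a ^ x) ^ 4      ≡⟨ cong (a ^ 4 *_) (^-*-assoc (suc a) x 4) ⟩
  a ^ 4 * suc a ^ (x * 4)      ∎
  where open ≤-Reasoning

-- The linear gain from Bernoulli's inequality, raised to the fourth power, beats a cubic factor:
-- with y = x / 4 one has x < 4y + 4 ≤ 8y, and y⁴ exceeds C · 8³ · a⁴ · y³ once y > β. Degree three
-- is what is called for, since a family is given by three points with their colours.
cubic-growth : ∀ a C → 1 ≤ a → ∃[ M ] (∀ x → M ≤ x → C * x ^ 3 * a ^ x < suc a ^ x)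
cubic-growth a C a≥1 = suc β * 4 , λ x M≤x → bound x (x / 4) (≤-<-trans z≤n (big x M≤x)) (big x M≤x) (split x)
  where
  open ≤-Reasoning
  β = C * 8 ^ 3 * a ^ 4
  split : ∀ x → x ≡ x % 4 + x / 4 * 4
  split x = m≡m%n+[m/n]*n x 4
  lt : ∀ x → suc β * 4 ≤ x → β * 4 < x / 4 * 4
  lt x M≤x = +-cancelˡ-< 4 (β * 4) (x / 4 * 4) (begin-strict
    4 + β * 4               ≤⟨ M≤x ⟩
    x                       ≡⟨ split x ⟩
    x % 4 + x / 4 * 4       <⟨ +-monoˡ-< (x / 4 * 4) (m%n<n x 4) ⟩
    4 + x / 4 * 4           ∎)
  big : ∀ x → suc β * 4 ≤ x → β < x / 4
  big x M≤x = *-cancelʳ-< 4 β (x / 4) (lt x M≤x)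
  bound : ∀ x y → 0 < y → β < y → x ≡ x % 4 + y * 4 → C * x ^ 3 * a ^ x < suc a ^ x
  bound x y y>0 β<y x≡ = *-cancelˡ-< (a ^ 4) _ _ (begin-strict
    a ^ 4 * (C * x ^ 3 * a ^ x)                       ≤⟨ *-monoʳ-≤ (a ^ 4) (*-monoˡ-≤ (a ^ x) (*-monoʳ-≤ C (^-monoˡ-≤ 3 x≤8y))) ⟩
    a ^ 4 * (C * (8 * y) ^ 3 * a ^ x)                 ≡⟨ cong (λ z → a ^ 4 * (C * z * a ^ x)) (^-distribʳ-* 3 8 y) ⟩
    a ^ 4 * (C * (8 ^ 3 * y ^ 3) * a ^ x)             ≡⟨ lemma (a ^ 4) C (8 ^ 3) (y ^ 3) (a ^ x) ⟩
    β * y ^ 3 * a ^ x                                 <⟨ *-monoˡ-< (a ^ x) {{m^n≢0 a x {{>-nonZero a≥1}}}} (*-monoˡ-< (y ^ 3) {{m^n≢0 y 3 {{>-nonZero y>0}}}} β<y) ⟩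
    y ^ 4 * a ^ x                                     ≡⟨ cong (λ z → y ^ 4 * a ^ z) x≡ ⟩
    y ^ 4 * a ^ (x % 4 + y * 4)                       ≡⟨ cong (y ^ 4 *_) (^-distribˡ-+-* a (x % 4) (y * 4)) ⟩
    y ^ 4 * (a ^ (x % 4) * a ^ (y * 4))               ≡⟨ lemma′ (y ^ 4) (a ^ (x % 4)) (a ^ (y * 4)) ⟩
    a ^ (x % 4) * (y ^ 4 * a ^ (y * 4))               ≤⟨ *-mono-≤ (^-monoˡ-≤ (x % 4) (n≤1+n a)) (fourth-power-growth a y) ⟩
    suc a ^ (x % 4) * (a ^ 4 * suc a ^ (y * 4))       ≡⟨ lemma′ (suc a ^ (x % 4)) (a ^ 4) (suc a ^ (y * 4)) ⟩
    a ^ 4 * (suc a ^ (x % 4) * suc a ^ (y * 4))       ≡⟨ cong (a ^ 4 *_) (^-distribˡ-+-* (suc a) (x % 4) (y * 4)) ⟨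
    a ^ 4 * suc a ^ (x % 4 + y * 4)                   ≡⟨ cong (λ z → a ^ 4 * suc a ^ z) x≡ ⟨
    a ^ 4 * suc a ^ x                                 ∎)
    where
    lemma : ∀ p C q z w → p * (C * (q * z) * w) ≡ C * q * p * z * w
    lemma = solve-∀
    lemma′ : ∀ p q z → p * (q * z) ≡ q * (p * z)
    lemma′ = solve-∀
    x≤8y : x ≤ 8 * y
    x≤8y = begin
      x                    ≡⟨ x≡ ⟩
      x % 4 + y * 4        ≤⟨ +-monoˡ-≤ (y * 4) (<⇒≤ (m%n<n x 4)) ⟩
      4 + y * 4            ≤⟨ ≤-linear 0 (*-monoʳ-≤ 4 y>0) (eq y) ⟩
      8 * y                ∎
      where
      eq : ∀ y → 8 * y + 4 ≡ 4 + y * 4 + 4 * y + 0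
      eq = solve-∀

beats-constant : ∀ a Λ → 1 ≤ a → ∃[ E ] Λ * a ^ E ≤ suc a ^ E
beats-constant a Λ a≥1 = a * Λ , *-cancelˡ-≤ a {{>-nonZero a≥1}}
  (≤-trans (≤-reflexive (sym (*-assoc a Λ _))) (linear-growth a (a * Λ)))

-- (1 + 1/u)^c ≤ u / (u − c) with denominators cleared; Q stands for u − c.
reciprocal-bernoulli : ∀ c Q → suc (c + Q) ^ c * Q ≤ (c + Q) ^ suc c
reciprocal-bernoulli c Q = go c Q (c + Q) refl
  where
  open ≤-Reasoning
  go : ∀ c Q u → c + Q ≡ u → suc u ^ c * Q ≤ u ^ suc c
  go zero    Q u refl = ≤-reflexive (trans (*-identityˡ Q) (sym (*-identityʳ Q)))
  go (suc c) Q u refl = begin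
    suc u * suc u ^ c * Q            ≡⟨ lemma (suc u) (suc u ^ c) Q ⟩
    suc u ^ c * (suc u * Q)          ≤⟨ *-monoʳ-≤ (suc u ^ c) (≤-linear (suc c) ≤-refl (lemma′ c Q)) ⟩
    suc u ^ c * (suc Q * u)          ≡⟨ *-assoc (suc u ^ c) (suc Q) u ⟨
    suc u ^ c * suc Q * u            ≤⟨ *-monoˡ-≤ u (go c (suc Q) u (+-suc c Q)) ⟩
    u ^ suc c * u                    ≡⟨ *-comm (u ^ suc c) u ⟩
    u * u ^ suc c                    ∎
    where
    lemma : ∀ a b q → a * b * q ≡ b * (a * q)
    lemma = solve-∀
    lemma′ : ∀ c Q → (1 + Q) * (1 + c + Q) + 0 ≡ (1 + (1 + c + Q)) * Q + 0 + (1 + c)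
    lemma′ = solve-∀

module _ (c : ℕ) where

  -- The factor per quadruple, (15 + 1/T) · u/Q with u = 2T and Q = u - c, should be at most 31/2,
  -- halfway between 15 and 16. After cancelling, this reads 4 (15T + 1) ≤ 31 Q, that is 960c + 124
  -- ≤ 961c + 124.
  T Q u : ℕ
  T = 16 * c + 2
  Q = 31 * c + 4
  u = c + Q

  u≡2T : u ≡ 2 * T
  u≡2T = lemma c
    where
    lemma : ∀ c → c + (31 * c + 4) ≡ 2 * (16 * c + 2)
    lemma = solve-∀

  -- This is (1 + 1/u)^s ≤ (u/Q)^m with denominators cleared. Since s ≤ c m, the excess of the
  -- singles can be charged to the quadruples, at most c singles to each.
  powers : ∀ m s → s ≤ c * m → suc u ^ s * Q ^ m ≤ u ^ s * u ^ m
  powers m s s≤cm with m≤n⇒∃[o]m+o≡n s≤cm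
  ... | t , s+t≡cm = *-cancelʳ-≤ _ _ (u ^ t) {{m^n≢0 u t {{>-nonZero u>0}}}} (begin
    suc u ^ s * Q ^ m * u ^ t            ≤⟨ *-monoʳ-≤ (suc u ^ s * Q ^ m) (^-monoˡ-≤ t (n≤1+n u)) ⟩
    suc u ^ s * Q ^ m * suc u ^ t        ≡⟨ lemma (suc u ^ s) (Q ^ m) (suc u ^ t) ⟩
    suc u ^ s * suc u ^ t * Q ^ m        ≡⟨ cong (_* Q ^ m) (^-distribˡ-+-* (suc u) s t) ⟨
    suc u ^ (s + t) * Q ^ m              ≡⟨ cong (λ k → suc u ^ k * Q ^ m) s+t≡cm ⟩
    suc u ^ (c * m) * Q ^ m              ≡⟨ cong (_* Q ^ m) (^-*-assoc (suc u) c m) ⟨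
    (suc u ^ c) ^ m * Q ^ m              ≡⟨ ^-distribʳ-* m (suc u ^ c) Q ⟨
    (suc u ^ c * Q) ^ m                  ≤⟨ ^-monoˡ-≤ m (reciprocal-bernoulli c Q) ⟩
    (u ^ suc c) ^ m                      ≡⟨ ^-*-assoc u (suc c) m ⟩
    u ^ (m + c * m)                      ≡⟨ cong (λ k → u ^ (m + k)) s+t≡cm ⟨
    u ^ (m + (s + t))                    ≡⟨ ^-distribˡ-+-* u m (s + t) ⟩
    u ^ m * u ^ (s + t)                  ≡⟨ cong (u ^ m *_) (^-distribˡ-+-* u s t) ⟩
    u ^ m * (u ^ s * u ^ t)              ≡⟨ lemma′ (u ^ m) (u ^ s) (u ^ t) ⟩
    u ^ s * u ^ m * u ^ t                ∎)
    where
    open ≤-Reasoning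
    u>0 : 0 < u
    u>0 = ≤-trans (≤-trans (s≤s z≤n) (m≤n+m 4 (31 * c))) (m≤n+m Q c)
    lemma : ∀ a b d → a * b * d ≡ a * d * b
    lemma = solve-∀
    lemma′ : ∀ a b d → a * (b * d) ≡ b * a * d
    lemma′ = solve-∀

  -- With Λ = R T every single contributes a factor at most 2 (1 + 1/u), every quadruple at most 15 + 1/T;
  -- over the whole [n] this leaves 31/32 for each quadruple.
  family-numerics : ∀ n m s D R ℓ → 1 ≤ R → s ≤ c * m → 4 * m + s ≤ n →
    ℓ * (R * T) ^ (m + s) ≤ (R * T) ^ D * ((15 * (R * T) + R) ^ m * (2 * (R * T) + R) ^ s) →
    ℓ * 32 ^ m ≤ 2 ^ n * ((R * T) ^ D * 31 ^ m)
  family-numerics n m s D R ℓ R≥1 s≤cm room hyp = begin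
    ℓ * 32 ^ m                                ≡⟨ cong (ℓ *_) (^-distribʳ-* m 2 16) ⟩
    ℓ * (2 ^ m * 16 ^ m)                      ≡⟨ cong (λ z → ℓ * (2 ^ m * z)) (^-*-assoc 2 4 m) ⟩
    ℓ * (2 ^ m * 2 ^ (4 * m))                 ≡⟨ *-assoc ℓ (2 ^ m) _ ⟨
    ℓ * 2 ^ m * 2 ^ (4 * m)                   ≤⟨ *-monoˡ-≤ (2 ^ (4 * m)) reduced ⟩
    2 ^ s * (X * 31 ^ m) * 2 ^ (4 * m)        ≡⟨ lemma (2 ^ s) (X * 31 ^ m) (2 ^ (4 * m)) ⟩
    2 ^ (4 * m) * 2 ^ s * (X * 31 ^ m)        ≡⟨ cong (_* (X * 31 ^ m)) (^-distribˡ-+-* 2 (4 * m) s) ⟨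
    2 ^ (4 * m + s) * (X * 31 ^ m)            ≤⟨ *-monoˡ-≤ (X * 31 ^ m) (^-monoʳ-≤ 2 room) ⟩
    2 ^ n * (X * 31 ^ m)                      ∎
    where
    open ≤-Reasoning
    X = (R * T) ^ D
    lemma : ∀ a b d → a * b * d ≡ d * a * b
    lemma = solve-∀
    instance
      T≢0 : NonZero T
      T≢0 = >-nonZero (≤-trans (s≤s z≤n) (m≤n+m 2 (16 * c)))
      Q≢0 : NonZero Q
      Q≢0 = >-nonZero (≤-trans (s≤s z≤n) (m≤n+m 4 (31 * c)))
      R≢0 : NonZero R
      R≢0 = >-nonZero R≥1
      u≢0 : NonZero u
      u≢0 = >-nonZero (≤-trans (≤-trans (s≤s z≤n) (m≤n+m 4 (31 * c))) (m≤n+m Q c))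

    without-R : ℓ * T ^ (m + s) ≤ X * ((15 * T + 1) ^ m * (2 * T + 1) ^ s)
    without-R = *-cancelʳ-≤ _ _ (R ^ (m + s)) {{m^n≢0 R (m + s)}} (begin
      ℓ * T ^ (m + s) * R ^ (m + s)                                         ≡⟨ *-assoc ℓ _ _ ⟩
      ℓ * (T ^ (m + s) * R ^ (m + s))                                       ≡⟨ cong (ℓ *_) (trans (*-comm (T ^ (m + s)) _) (sym (^-distribʳ-* (m + s) R T))) ⟩
      ℓ * (R * T) ^ (m + s)                                                 ≤⟨ hyp ⟩
      X * ((15 * (R * T) + R) ^ m * (2 * (R * T) + R) ^ s)                  ≡⟨ cong₂ (λ a b → X * (a ^ m * b ^ s)) (factor 15 R T) (factor 2 R T) ⟩
      X * ((R * (15 * T + 1)) ^ m * (R * (2 * T + 1)) ^ s)                  ≡⟨ cong₂ (λ a b → X * (a * b)) (^-distribʳ-* m R (15 * T + 1)) (^-distribʳ-* s R (2 * T + 1)) ⟩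
      X * (R ^ m * (15 * T + 1) ^ m * (R ^ s * (2 * T + 1) ^ s))            ≡⟨ shuffle X (R ^ m) ((15 * T + 1) ^ m) (R ^ s) ((2 * T + 1) ^ s) ⟩
      X * ((15 * T + 1) ^ m * (2 * T + 1) ^ s) * (R ^ m * R ^ s)            ≡⟨ cong (X * ((15 * T + 1) ^ m * (2 * T + 1) ^ s) *_) (^-distribˡ-+-* R m s) ⟨
      X * ((15 * T + 1) ^ m * (2 * T + 1) ^ s) * R ^ (m + s)                ∎)
      where
      factor : ∀ k R T → k * (R * T) + R ≡ R * (k * T + 1)
      factor = solve-∀
      shuffle : ∀ x a b d e → x * (a * b * (d * e)) ≡ x * (b * e) * (a * d)
      shuffle = solve-∀

    2T+1≡ : 2 * T + 1 ≡ suc u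
    2T+1≡ = trans (+-comm (2 * T) 1) (cong suc (sym u≡2T))

    with-Q : ℓ * (T * Q) ^ m ≤ 2 ^ s * (X * ((15 * T + 1) * u) ^ m)
    with-Q = *-cancelʳ-≤ _ _ (u ^ s) {{m^n≢0 u s}} (begin
      ℓ * (T * Q) ^ m * u ^ s                                       ≡⟨ cong₂ (λ a b → ℓ * a * b) (^-distribʳ-* m T Q) (trans (cong (_^ s) u≡2T) (^-distribʳ-* s 2 T)) ⟩
      ℓ * (T ^ m * Q ^ m) * (2 ^ s * T ^ s)                         ≡⟨ shuffle ℓ (T ^ m) (Q ^ m) (2 ^ s) (T ^ s) ⟩
      2 ^ s * (ℓ * (T ^ m * T ^ s)) * Q ^ m                         ≡⟨ cong (λ z → 2 ^ s * (ℓ * z) * Q ^ m) (^-distribˡ-+-* T m s) ⟨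
      2 ^ s * (ℓ * T ^ (m + s)) * Q ^ m                             ≤⟨ *-monoˡ-≤ (Q ^ m) (*-monoʳ-≤ (2 ^ s) without-R) ⟩
      2 ^ s * (X * ((15 * T + 1) ^ m * (2 * T + 1) ^ s)) * Q ^ m    ≡⟨ cong (λ z → 2 ^ s * (X * ((15 * T + 1) ^ m * z ^ s)) * Q ^ m) 2T+1≡ ⟩
      2 ^ s * (X * ((15 * T + 1) ^ m * suc u ^ s)) * Q ^ m          ≡⟨ shuffle′ (2 ^ s) X ((15 * T + 1) ^ m) (suc u ^ s) (Q ^ m) ⟩
      2 ^ s * (X * (15 * T + 1) ^ m) * (suc u ^ s * Q ^ m)          ≤⟨ *-monoʳ-≤ (2 ^ s * (X * (15 * T + 1) ^ m)) (powers m s s≤cm) ⟩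
      2 ^ s * (X * (15 * T + 1) ^ m) * (u ^ s * u ^ m)              ≡⟨ shuffle″ (2 ^ s) X ((15 * T + 1) ^ m) (u ^ s) (u ^ m) ⟩
      2 ^ s * (X * ((15 * T + 1) ^ m * u ^ m)) * u ^ s              ≡⟨ cong (λ z → 2 ^ s * (X * z) * u ^ s) (^-distribʳ-* m (15 * T + 1) u) ⟨
      2 ^ s * (X * ((15 * T + 1) * u) ^ m) * u ^ s                  ∎)
      where
      shuffle : ∀ l a b d e → l * (a * b) * (d * e) ≡ d * (l * (a * e)) * b
      shuffle = solve-∀
      shuffle′ : ∀ p x a b q → p * (x * (a * b)) * q ≡ p * (x * a) * (b * q)
      shuffle′ = solve-∀
      shuffle″ : ∀ p x a b d → p * (x * a) * (b * d) ≡ p * (x * (a * d)) * b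
      shuffle″ = solve-∀

    constants : 2 * ((15 * T + 1) * u) ≤ 31 * (T * Q)
    constants = ≤-linear (16 * (c * c) + 2 * c) ≤-refl (eq c)
      where
      eq : ∀ c → 31 * ((16 * c + 2) * (31 * c + 4)) + 0 ≡ 2 * ((15 * (16 * c + 2) + 1) * (c + (31 * c + 4))) + 0 + (16 * (c * c) + 2 * c)
      eq = solve-∀

    reduced : ℓ * 2 ^ m ≤ 2 ^ s * (X * 31 ^ m)
    reduced = *-cancelʳ-≤ _ _ ((T * Q) ^ m) {{m^n≢0 (T * Q) m {{m*n≢0 T Q}}}} (begin
      ℓ * 2 ^ m * (T * Q) ^ m                              ≡⟨ shuffle ℓ (2 ^ m) ((T * Q) ^ m) ⟩
      2 ^ m * (ℓ * (T * Q) ^ m)                            ≤⟨ *-monoʳ-≤ (2 ^ m) with-Q ⟩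
      2 ^ m * (2 ^ s * (X * ((15 * T + 1) * u) ^ m))       ≡⟨ shuffle′ (2 ^ m) (2 ^ s) X (((15 * T + 1) * u) ^ m) ⟩
      2 ^ s * (X * (2 ^ m * ((15 * T + 1) * u) ^ m))       ≡⟨ cong (λ z → 2 ^ s * (X * z)) (^-distribʳ-* m 2 ((15 * T + 1) * u)) ⟨
      2 ^ s * (X * (2 * ((15 * T + 1) * u)) ^ m)           ≤⟨ *-monoʳ-≤ (2 ^ s) (*-monoʳ-≤ X (^-monoˡ-≤ m constants)) ⟩
      2 ^ s * (X * (31 * (T * Q)) ^ m)                     ≡⟨ cong (λ z → 2 ^ s * (X * z)) (^-distribʳ-* m 31 (T * Q)) ⟩
      2 ^ s * (X * (31 ^ m * (T * Q) ^ m))                 ≡⟨ shuffle″ (2 ^ s) X (31 ^ m) ((T * Q) ^ m) ⟩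
      2 ^ s * (X * 31 ^ m) * (T * Q) ^ m                   ∎)
      where
      shuffle : ∀ a b d → a * b * d ≡ b * (a * d)
      shuffle = solve-∀
      shuffle′ : ∀ a b x d → a * (b * (x * d)) ≡ b * (x * (a * d))
      shuffle′ = solve-∀
      shuffle″ : ∀ a x b d → a * (x * (b * d)) ≡ a * (x * b) * d
      shuffle″ = solve-∀

-- The exponent m is split as E D + y with y at least m/2. By the choice of `E`, the first part
-- absorbs `Λ ^ D`; the second outgrows the cubic factor. This takes 2 E D ≤ m, which follows from K
-- > 2 c E and n ≤ c m.
exponential-gap : ∀ c r Λ → 1 ≤ c → ∃[ K ] ∃[ M ] 1 ≤ K ×
  (∀ n m D → M ≤ m → n ≤ c * m → K * D ≤ n → 2 * (n * r) ^ 3 * (Λ ^ D * 31 ^ m) < 32 ^ m)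
exponential-gap c r Λ c≥1 = suc (2 * c * E) , 2 * M , s≤s z≤n , gap
  where
  open ≤-Reasoning
  E = proj₁ (beats-constant 31 Λ (s≤s z≤n))
  ΛE : Λ * 31 ^ E ≤ 32 ^ E
  ΛE = proj₂ (beats-constant 31 Λ (s≤s z≤n))
  C = 2 * (2 * c * r) ^ 3
  M = proj₁ (cubic-growth 31 C (s≤s z≤n))
  growth : ∀ x → M ≤ x → C * x ^ 3 * 31 ^ x < 32 ^ x
  growth = proj₂ (cubic-growth 31 C (s≤s z≤n))

  gap : ∀ n m D → 2 * M ≤ m → n ≤ c * m → suc (2 * c * E) * D ≤ n → 2 * (n * r) ^ 3 * (Λ ^ D * 31 ^ m) < 32 ^ m
  gap n m D 2M≤m n≤cm KD≤n with m≤n⇒∃[o]m+o≡n ED≤m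
    where
    ED≤m : 2 * (E * D) ≤ m
    ED≤m = *-cancelˡ-≤ c {{>-nonZero c≥1}} (begin
      c * (2 * (E * D))      ≡⟨ lemma c E D ⟩
      2 * c * E * D          ≤⟨ m≤n+m _ D ⟩
      suc (2 * c * E) * D    ≤⟨ KD≤n ⟩
      n                      ≤⟨ n≤cm ⟩
      c * m                  ∎)
      where
      lemma : ∀ c E D → c * (2 * (E * D)) ≡ 2 * c * E * D
      lemma = solve-∀
  ... | t , refl = begin-strict
    2 * (n * r) ^ 3 * (Λ ^ D * 31 ^ m)                              ≤⟨ *-monoˡ-≤ (Λ ^ D * 31 ^ m) (*-monoʳ-≤ 2 (^-monoˡ-≤ 3 nr≤)) ⟩
    2 * (2 * c * r * y) ^ 3 * (Λ ^ D * 31 ^ m)                      ≡⟨ cong₂ (λ a b → 2 * a * (Λ ^ D * b)) (^-distribʳ-* 3 (2 * c * r) y) split-31 ⟩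
    2 * ((2 * c * r) ^ 3 * y ^ 3) * (Λ ^ D * ((31 ^ E) ^ D * 31 ^ y))  ≡⟨ lemma ((2 * c * r) ^ 3) (y ^ 3) (Λ ^ D) ((31 ^ E) ^ D) (31 ^ y) ⟩
    Λ ^ D * (31 ^ E) ^ D * (C * y ^ 3 * 31 ^ y)                     ≡⟨ cong (_* (C * y ^ 3 * 31 ^ y)) (^-distribʳ-* D Λ (31 ^ E)) ⟨
    (Λ * 31 ^ E) ^ D * (C * y ^ 3 * 31 ^ y)                         ≤⟨ *-monoˡ-≤ (C * y ^ 3 * 31 ^ y) (^-monoˡ-≤ D ΛE) ⟩
    (32 ^ E) ^ D * (C * y ^ 3 * 31 ^ y)                             <⟨ *-monoʳ-< ((32 ^ E) ^ D) {{m^n≢0 (32 ^ E) D {{m^n≢0 32 E}}}} (growth y M≤y) ⟩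
    (32 ^ E) ^ D * 32 ^ y                                           ≡⟨ split 32 ⟨
    32 ^ m                                                          ∎
    where
    y = E * D + t
    m≡ : m ≡ E * D + y
    m≡ = lemma (E * D) t
      where
      lemma : ∀ a t → 2 * a + t ≡ a + (a + t)
      lemma = solve-∀
    m≤2y : m ≤ 2 * y
    m≤2y = ≤-linear t ≤-refl (lemma (E * D) t)
      where
      lemma : ∀ a t → 2 * (a + t) + 0 ≡ 2 * a + t + 0 + t
      lemma = solve-∀
    M≤y : M ≤ y
    M≤y = *-cancelˡ-≤ 2 (≤-trans 2M≤m m≤2y)
    nr≤ : n * r ≤ 2 * c * r * y
    nr≤ = begin
      n * r                ≤⟨ *-monoˡ-≤ r (≤-trans n≤cm (*-monoʳ-≤ c m≤2y)) ⟩
      c * (2 * y) * r      ≡⟨ lemma c y r ⟩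
      2 * c * r * y        ∎
      where
      lemma : ∀ c y r → c * (2 * y) * r ≡ 2 * c * r * y
      lemma = solve-∀
    split : ∀ b → b ^ m ≡ (b ^ E) ^ D * b ^ y
    split b = begin-equality
      b ^ m                  ≡⟨ cong (b ^_) m≡ ⟩
      b ^ (E * D + y)        ≡⟨ ^-distribˡ-+-* b (E * D) y ⟩
      b ^ (E * D) * b ^ y    ≡⟨ cong (_* b ^ y) (^-*-assoc b E D) ⟨
      (b ^ E) ^ D * b ^ y    ∎
    split-31 = split 31
    lemma : ∀ p q x a b → 2 * (p * q) * (x * (a * b)) ≡ x * a * (2 * p * q * b)
    lemma = solve-∀

-- Comparison with the two-coloured colourings

Unique-vectors : ∀ {A : Set} {xs : List A} → Unique xs → ∀ l → Unique (vectors xs l)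
Unique-vectors xs! zero    = [] ∷ []
Unique-vectors xs! (suc l) = Unique.cartesianProductWith⁺ _∷_ (λ { refl → refl , refl }) xs! (Unique-vectors xs! l)

indicator-⊎ : ∀ {A B C : Set} (a? : Dec A) (b? : Dec B) (c? : Dec C) → (A → B ⊎ C) →
              indicator a? ≤ indicator b? + indicator c?
indicator-⊎ (no _)  b? c? h = z≤n
indicator-⊎ (yes a) b? c? h with h a
... | inj₁ b = ≤-trans (indicator-yes b? b) (m≤m+n _ _)
... | inj₂ c = ≤-trans (indicator-yes c? c) (m≤n+m _ _)

module _ {r : ℕ} (r≥3 : 3 ≤ r) where

  r≥2 : 2 ≤ r
  r≥2 = ≤-trans (n≤1+n 2) r≥3

  open Palettes r≥2

  k₀ : C
  k₀ = fromℕ< {0} (≤-trans (s≤s z≤n) r≥3)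

  k₁ : C
  k₁ = proj₁ (another k₀)

  rainbow? : ∀ (i j k : C) → Dec (Rainbow i j k)
  rainbow? i j k = ¬? (i ≟ j) ×-dec ¬? (i ≟ k) ×-dec ¬? (j ≟ k)

  module _ {n : ℕ} (A : Subset n) where

    ext : Coloring r A → Fin n → C
    ext = extend r≥2 A k₀

    coloring-≟ : DecidableEquality (Coloring r A)
    coloring-≟ c c′ = map′ (extend-injective r≥2 A k₀ c c′) (λ { refl _ → refl }) (Fin.all? λ x → ext c x ≟ ext c′ x)

    -- Prescribing three points together with their colours distributes the many-coloured colourings
    -- over `(n * r) ^ 3` families. The points must lie in `A`, since elsewhere `ext` only shows the
    -- default colour.
    Witness : Vec (Fin n) 3 → Vec C 3 → Coloring r A → Set
    Witness (x ∷ y ∷ z ∷ []) (i ∷ j ∷ k ∷ []) c =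
      (x ∈ˢ A × y ∈ˢ A × z ∈ˢ A × Rainbow i j k) × (ext c x ≡ i × ext c y ≡ j × ext c z ≡ k)

    witness? : ∀ zs ks → Decidable (Witness zs ks)
    witness? (x ∷ y ∷ z ∷ []) (i ∷ j ∷ k ∷ []) c =
      (x ∈ˢ? A ×-dec y ∈ˢ? A ×-dec z ∈ˢ? A ×-dec rainbow? i j k) ×-dec
      (ext c x ≟ i ×-dec ext c y ≟ j ×-dec ext c z ≟ k)

    ManyColoured : Coloring r A → Set
    ManyColoured c = ∃[ zs ] ∃[ ks ] Witness zs ks c

    manyColoured? : Decidable ManyColoured
    manyColoured? c = ∃vec? ∈-allFin λ zs → ∃vec? ∈-allFin λ ks → witness? zs ks c

    few many : List (Coloring r A)
    few  = filter (¬? ∘ manyColoured?) (colorings r A)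
    many = filter (λ c → rainbowFree? c ×-dec manyColoured? c) (colorings r A)

    few⇒free : ∀ c → ¬ ManyColoured c → RainbowFree c
    few⇒free c ¬M x y z p q s _ R = ¬M (x ∷ y ∷ z ∷ [] , _ ∷ _ ∷ _ ∷ [] , (p , q , s , R) ,
      extend-∈ r≥2 A k₀ c p , extend-∈ r≥2 A k₀ c q , extend-∈ r≥2 A k₀ c s)

    g≤few+many : g r A ≤ length few + length many
    g≤few+many = begin
      g r A
        ≡⟨ length-filter≡sumOver rainbowFree? (colorings r A) ⟩
      sumOver (colorings r A) (λ c → indicator (rainbowFree? c))
        ≤⟨ sumOver-mono (colorings r A) (λ c _ → indicator-⊎ (rainbowFree? c) (¬? (manyColoured? c)) (rainbowFree? c ×-dec manyColoured? c) (split c)) ⟩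
      sumOver (colorings r A) (λ c → indicator (¬? (manyColoured? c)) + indicator (rainbowFree? c ×-dec manyColoured? c))
        ≡⟨ sumOver-add _ _ (colorings r A) ⟩
      sumOver (colorings r A) (λ c → indicator (¬? (manyColoured? c))) + sumOver (colorings r A) (λ c → indicator (rainbowFree? c ×-dec manyColoured? c))
        ≡⟨ cong₂ _+_ (length-filter≡sumOver (¬? ∘ manyColoured?) (colorings r A)) (length-filter≡sumOver (λ c → rainbowFree? c ×-dec manyColoured? c) (colorings r A)) ⟨
      length few + length many ∎
      where
      open ≤-Reasoning
      split : ∀ c → RainbowFree c → ¬ ManyColoured c ⊎ (RainbowFree c × ManyColoured c)
      split c free with manyColoured? c
      ... | yes M = inj₂ (free , M)
      ... | no ¬M = inj₁ ¬M

    few≤g : length few ≤ g r A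
    few≤g = begin
      length few                                                               ≡⟨ length-filter≡sumOver (¬? ∘ manyColoured?) (colorings r A) ⟩
      sumOver (colorings r A) (λ c → indicator (¬? (manyColoured? c)))         ≤⟨ sumOver-mono (colorings r A) (λ c _ → mono c (¬? (manyColoured? c))) ⟩
      sumOver (colorings r A) (λ c → indicator (rainbowFree? c))               ≡⟨ length-filter≡sumOver rainbowFree? (colorings r A) ⟨
      g r A                                                                    ∎
      where
      open ≤-Reasoning
      mono : ∀ c (d : Dec (¬ ManyColoured c)) → indicator d ≤ indicator (rainbowFree? c)
      mono c (yes ¬M) = indicator-yes (rainbowFree? c) (few⇒free c ¬M)
      mono c (no _)   = z≤n

    -- Junk value (k₀ , k₁) when three colours occur.
    palette : Coloring r A → C × C
    palette c with three-or-two (λ k → Fin.any? λ x → x ∈ˢ? A ×-dec (ext c x ≟ k))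
    ... | inj₁ _         = k₀ , k₁
    ... | inj₂ (pal , _) = pal

    -- Even a colouring with at most one colour gets two distinct palette colours; this is what
    -- gives `2*few≤few` two choices at the new point.
    palette-spec : ∀ c → ¬ ManyColoured c →
                   proj₁ (palette c) ≢ proj₂ (palette c) × (∀ {x} → x ∈ˢ A → ext c x ∈₂ palette c)
    palette-spec c ¬M with three-or-two (λ k → Fin.any? λ x → x ∈ˢ? A ×-dec (ext c x ≟ k))
    ... | inj₂ (_ , pal≢ , ⊆pal) = pal≢ , λ {x} p → ⊆pal _ (x , p , refl)
    ... | inj₁ (i ∷ j ∷ k ∷ [] , T! , hit) with hit zero | hit (suc zero) | hit (suc (suc zero))
    ...   | x , p , ex | y , q , ey | z , s , ez = contradiction
              (x ∷ y ∷ z ∷ [] , i ∷ j ∷ k ∷ [] ,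
               (p , q , s , (λ e → contradiction (T! zero (suc zero) e) λ ()) , (λ e → contradiction (T! zero (suc (suc zero)) e) λ ())
                          , (λ e → contradiction (T! (suc zero) (suc (suc zero)) e) λ ())) , ex , ey , ez) ¬M

    two-coloured⇒few : ∀ c pal → (∀ {x} → x ∈ˢ A → ext c x ∈₂ pal) → ¬ ManyColoured c
    two-coloured⇒few c pal ⊆pal (x ∷ y ∷ z ∷ [] , i ∷ j ∷ k ∷ [] , (p , q , s , R) , refl , refl , refl) =
      no-three-in-two r≥2 pal R (⊆pal p) (⊆pal q) (⊆pal s)

    many-bound : ∀ B w → (∀ zs ks → w * length (filter (λ c → rainbowFree? c ×-dec witness? zs ks c) (colorings r A)) ≤ B) →
                 w * length many ≤ (n * r) ^ 3 * B
    many-bound B w each = begin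
      w * length many
        ≡⟨ cong (w *_) (length-filter≡sumOver (λ c → rainbowFree? c ×-dec manyColoured? c) cs) ⟩
      w * sumOver cs (λ c → indicator (rainbowFree? c ×-dec manyColoured? c))
        ≤⟨ *-monoʳ-≤ w (sumOver-mono cs (λ c _ → pointwise c)) ⟩
      w * sumOver cs (λ c → sumOver Zs (λ zs → sumOver Ks (λ ks → F zs ks c)))
        ≡⟨ cong (w *_) (trans (sumOver-swap _ cs Zs) (sumOver-cong Zs λ zs → sumOver-swap _ cs Ks)) ⟩
      w * sumOver Zs (λ zs → sumOver Ks (λ ks → sumOver cs (F zs ks)))
        ≡⟨ trans (sym (sumOver-*ˡ w _ Zs)) (sumOver-cong Zs λ zs → sym (sumOver-*ˡ w _ Ks)) ⟩
      sumOver Zs (λ zs → sumOver Ks (λ ks → w * sumOver cs (F zs ks)))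
        ≤⟨ sumOver-bound (length Ks * B) Zs (λ zs _ → sumOver-bound B Ks λ ks _ →
             ≤-trans (≤-reflexive (cong (w *_) (sym (length-filter≡sumOver (λ c → rainbowFree? c ×-dec witness? zs ks c) cs)))) (each zs ks)) ⟩
      length Zs * (length Ks * B)
        ≡⟨ *-assoc (length Zs) (length Ks) B ⟨
      length Zs * length Ks * B
        ≡⟨ cong (_* B) (trans (cong₂ _*_ (len n) (len r)) (sym (^-distribʳ-* 3 n r))) ⟩
      (n * r) ^ 3 * B ∎
      where
      open ≤-Reasoning
      cs = colorings r A
      Zs = vectors (allFin n) 3
      Ks = vectors (allFin r) 3
      F : Vec (Fin n) 3 → Vec C 3 → Coloring r A → ℕ
      F zs ks c = indicator (rainbowFree? c ×-dec witness? zs ks c)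
      len : ∀ l → length (vectors (allFin l) 3) ≡ l ^ 3
      len l = trans (length-vectors (allFin l) 3) (cong (_^ 3) (length-allFin l))
      sumOver-cong : ∀ {X : Set} {f h : X → ℕ} xs → (∀ x → f x ≡ h x) → sumOver xs f ≡ sumOver xs h
      sumOver-cong []       e = refl
      sumOver-cong (x ∷ xs) e = cong₂ _+_ (e x) (sumOver-cong xs e)
      pointwise : ∀ c → indicator (rainbowFree? c ×-dec manyColoured? c) ≤ sumOver Zs (λ zs → sumOver Ks (λ ks → F zs ks c))
      pointwise c = go (rainbowFree? c ×-dec manyColoured? c)
        where
        go : (d : Dec (RainbowFree c × ManyColoured c)) → indicator d ≤ sumOver Zs (λ zs → sumOver Ks (λ ks → F zs ks c))
        go (no _) = z≤n
        go (yes (free , zs , ks , W)) = ≤-trans (indicator-yes (rainbowFree? c ×-dec witness? zs ks c) (free , W))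
          (≤-trans (member≤sumOver (λ ks → F zs ks c) (∈-vectors ∈-allFin ks))
                   (member≤sumOver (λ zs → sumOver Ks (λ ks → F zs ks c)) (∈-vectors ∈-allFin zs)))

  module _ {n : ℕ} where

    paint : (Fin n → C) → Coloring r (⊤ {n})
    paint f = tabulate ⊤ λ {x} _ → f x

    ext-paint : ∀ f x → ext ⊤ (paint f) x ≡ f x
    ext-paint f x = trans (extend-∈ r≥2 ⊤ k₀ (paint f) ∈⊤) (colour-tabulate ⊤ (λ {x} _ → f x) ∈⊤)

    paint-injective : ∀ f h → paint f ≡ paint h → ∀ x → f x ≡ h x
    paint-injective f h eq x = trans (sym (ext-paint f x)) (trans (cong (λ c → ext ⊤ c x) eq) (ext-paint h x))

    paint∈few : ∀ f pal → (∀ x → f x ∈₂ pal) → paint f ∈ few ⊤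
    paint∈few f pal f∈ = ∈-filter⁺ (¬? ∘ manyColoured? ⊤) (∈-colorings (paint f))
      (two-coloured⇒few ⊤ (paint f) pal λ {x} _ → subst (_∈₂ pal) (sym (ext-paint f x)) (f∈ x))

    2^n≤few : 2 ^ n ≤ length (few (⊤ {n}))
    2^n≤few = begin
      2 ^ n              ≡⟨ length-vectors (true ∷ false ∷ []) n ⟨
      length (bits n)    ≤⟨ injection⇒length≤ (coloring-≟ (⊤ {n})) (paint ∘ side) (Unique-vectors (((λ ()) ∷ []) ∷ [] ∷ []) n)
                              (λ {b} _ → paint∈few (side b) (k₀ , k₁) (side∈ b)) (λ {b} {b′} _ _ eq → side-injective b b′ (paint-injective _ _ eq)) ⟩
      length (few (⊤ {n}))  ∎
      where
      open ≤-Reasoning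
      colourOf : Bool → C
      colourOf true  = k₀
      colourOf false = k₁
      colourOf-injective : ∀ b b′ → colourOf b ≡ colourOf b′ → b ≡ b′
      colourOf-injective true  true  _ = refl
      colourOf-injective true  false e = contradiction e (proj₂ (another k₀))
      colourOf-injective false true  e = contradiction (sym e) (proj₂ (another k₀))
      colourOf-injective false false _ = refl
      side : Vec Bool n → Fin n → C
      side b x = colourOf (lookup b x)
      side∈ : ∀ b x → side b x ∈₂ (k₀ , k₁)
      side∈ b x with lookup b x
      ... | true  = inj₁ refl
      ... | false = inj₂ refl
      side-injective : ∀ b b′ → (∀ x → side b x ≡ side b′ x) → b ≡ b′
      side-injective b b′ eq = trans (sym (Vec.tabulate∘lookup b)) (trans (Vec.tabulate-cong λ x → colourOf-injective _ _ (eq x)) (Vec.tabulate∘lookup b′))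

    -- Outside A use the first colour of the palette, except at a, where both colours are possible.
    2*few≤few : ∀ (A : Subset n) a → a ∉ˢ A → 2 * length (few A) ≤ length (few (⊤ {n}))
    2*few≤few A a a∉A = begin
      2 * length (few A)                                ≡⟨ size ⟨
      length pairs                                      ≤⟨ injection⇒length≤ (coloring-≟ (⊤ {n})) (λ (b , c) → paint (fill b c)) pairs!
                                                             (λ {p} p∈ → let b , c = p in paint∈few (fill b c) (palette A c) (fill∈ b c (few-of p∈)))
                                                             injective ⟩
      length (few (⊤ {n}))                           ∎
      where
      open ≤-Reasoning
      sides : List Bool
      sides = true ∷ false ∷ []
      pairs : List (Bool × Coloring r A)
      pairs = cartesianProductWith _,_ sides (few A)
      size : length pairs ≡ 2 * length (few A)
      size = begin-equality
        length pairs                                          ≡⟨ *-identityʳ _ ⟨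
        length pairs * 1                                      ≡⟨ sumOver-const 1 pairs ⟨
        sumOver pairs (λ _ → 1)                               ≡⟨ sumOver-product _,_ _ sides (few A) ⟩
        sumOver sides (λ _ → sumOver (few A) (λ _ → 1))       ≡⟨ sumOver-const (sumOver (few A) (λ _ → 1)) sides ⟩
        2 * sumOver (few A) (λ _ → 1)                         ≡⟨ cong (2 *_) (trans (sumOver-const 1 (few A)) (*-identityʳ (length (few A)))) ⟩
        2 * length (few A)                                    ∎
      pairs! : Unique pairs
      pairs! = Unique.cartesianProductWith⁺ _,_ (λ { refl → refl , refl }) (((λ ()) ∷ []) ∷ [] ∷ [])
                 (Unique.filter⁺ (¬? ∘ manyColoured? A) (colorings-unique r A))
      few-of : ∀ {b c} → (b , c) ∈ pairs → ¬ ManyColoured A c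
      few-of bc∈ with ∈-cartesianProductWith⁻ _,_ sides (few A) bc∈
      ... | _ , _ , _ , c∈ , refl = proj₂ (∈-filter⁻ (¬? ∘ manyColoured? A) {xs = colorings r A} c∈)

      choose : Bool → C × C → C
      choose true  = proj₁
      choose false = proj₂
      choose∈ : ∀ b pal → choose b pal ∈₂ pal
      choose∈ true  pal = inj₁ refl
      choose∈ false pal = inj₂ refl
      choose-injective : ∀ b b′ pal → proj₁ pal ≢ proj₂ pal → choose b pal ≡ choose b′ pal → b ≡ b′
      choose-injective true  true  pal ≢ e = refl
      choose-injective true  false pal ≢ e = contradiction e ≢
      choose-injective false true  pal ≢ e = contradiction (sym e) ≢
      choose-injective false false pal ≢ e = refl

      fill : Bool → Coloring r A → Fin n → C
      fill b c x with x ∈ˢ? A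
      ... | yes p = colour c p
      ... | no _  = choose (if does (x ≟ a) then b else true) (palette A c)

      fill∈ : ∀ b c → ¬ ManyColoured A c → ∀ x → fill b c x ∈₂ palette A c
      fill∈ b c ¬M x with x ∈ˢ? A
      ... | yes p = subst (_∈₂ palette A c) (extend-∈ r≥2 A k₀ c p) (proj₂ (palette-spec A c ¬M) p)
      ... | no _  = choose∈ (if does (x ≟ a) then b else true) (palette A c)

      fill-∈ : ∀ b c {x} (p : x ∈ˢ A) → fill b c x ≡ colour c p
      fill-∈ b c {x} p with x ∈ˢ? A
      ... | yes q = cong (colour c) (∈-irrelevant q p)
      ... | no ¬p = contradiction p ¬p

      fill-a : ∀ b c → fill b c a ≡ choose b (palette A c)
      fill-a b c with a ∈ˢ? A
      ... | yes p = contradiction p a∉A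
      ... | no _ with a ≟ a
      ...   | yes _ = refl
      ...   | no ¬e = contradiction refl ¬e

      injective : ∀ {p p′} → p ∈ pairs → p′ ∈ pairs →
                  paint (fill (proj₁ p) (proj₂ p)) ≡ paint (fill (proj₁ p′) (proj₂ p′)) → p ≡ p′
      injective {b , c} {b′ , c′} p∈ p′∈ eq with same-c
        where
        pointwise = paint-injective (fill b c) (fill b′ c′) eq
        same-c : c ≡ c′
        same-c = colour-injective c c′ λ {x} p → trans (sym (fill-∈ b c p)) (trans (pointwise x) (fill-∈ b′ c′ p))
      ... | refl = cong (_, c) (choose-injective b b′ (palette A c) (proj₁ (palette-spec A c (few-of p∈)))
                     (trans (sym (fill-a b c)) (trans (paint-injective (fill b c) (fill b′ c) eq a) (fill-a b′ c))))

  -- Choice of the parameters and conclusion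

  R : ℕ
  R = r ^ 4 * (4 * r ^ 3)

  r≢0 : NonZero r
  r≢0 = >-nonZero (≤-trans (s≤s z≤n) r≥3)

  R≥1 : 1 ≤ R
  R≥1 = *-mono-≤ {1} {r ^ 4} (m^n>0 r {{r≢0}} 4) (*-mono-≤ {1} {4} (s≤s z≤n) (m^n>0 r {{r≢0}} 3))

  -- `c` is a variable with the equation `c≡512`, so that `T c` and the powers built from it stay
  -- symbolic.
  module Threshold (c : ℕ) (c≡512 : c ≡ 512) (K M N : ℕ) (K≥1 : 1 ≤ K)
    (roth-N : ∀ X n → N ≤ n → APFree X → K * count X n ≤ n)
    (gap : ∀ n m D → M ≤ m → n ≤ c * m → K * D ≤ n → 2 * (n * r) ^ 3 * ((R * T c) ^ D * 31 ^ m) < 32 ^ m) where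

    Λ : ℕ
    Λ = R * T c

    Λ≥1 : 1 ≤ Λ
    Λ≥1 = *-mono-≤ {1} {R} R≥1 (≤-trans (s≤s z≤n) (m≤n+m 2 (16 * c)))

    n₁ : ℕ
    -- `N` is for Roth's theorem; the rest makes n / 256 at least M, as `gap` asks, and at least 2,
    -- as `disjoint-chains` asks.
    n₁ = N + (M + 2) * 256

    module _ (n : ℕ) (n≥n₁ : n₁ ≤ n) (A : Subset n) where

      m D : ℕ
      m = n / 256
      D = _/_ n K {{>-nonZero K≥1}}

      M+2≤m : M + 2 ≤ m
      M+2≤m = ≤-trans (≤-reflexive (sym (m*n/n≡m (M + 2) 256))) (/-monoˡ-≤ 256 (≤-trans (m≤n+m _ N) n≥n₁))

      m≥2 : 2 ≤ m
      m≥2 = ≤-trans (m≤n+m 2 M) M+2≤m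

      n≤cm : n ≤ c * m
      n≤cm = begin
        n                        ≡⟨ m≡m%n+[m/n]*n n 256 ⟩
        n % 256 + m * 256        ≤⟨ +-monoˡ-≤ (m * 256) (<⇒≤ (m%n<n n 256)) ⟩
        -- The remainder modulo 256 is absorbed by doubling 256 to 512, since m ≥ 1.
        1 * 256 + m * 256        ≤⟨ +-monoˡ-≤ (m * 256) (*-monoˡ-≤ 256 (≤-trans (s≤s z≤n) m≥2)) ⟩
        m * 256 + m * 256        ≡⟨ *-distribˡ-+ m 256 256 ⟨
        m * 512                  ≡⟨ cong (m *_) c≡512 ⟨
        m * c                    ≡⟨ *-comm m c ⟩
        c * m                    ∎
        where open ≤-Reasoning

      KD≤n : K * D ≤ n
      KD≤n = ≤-trans (≤-reflexive (*-comm K D)) (m/n*n≤m n K {{>-nonZero K≥1}})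

      n<K[1+D] : n < K * suc D
      n<K[1+D] = begin-strict
        n                          ≡⟨ m≡m%n+[m/n]*n n K {{>-nonZero K≥1}} ⟩
        _%_ n K {{>-nonZero K≥1}} + D * K  <⟨ +-monoˡ-< (D * K) (m%n<n n K {{>-nonZero K≥1}}) ⟩
        K + D * K                  ≡⟨ *-comm (suc D) K ⟩
        K * suc D                  ∎
        where open ≤-Reasoning

      W = (n * r) ^ 3

      member : Vec (Fin n) 3 → Vec C 3 → Coloring r A → Set
      member zs ks c = RainbowFree c × Witness A zs ks c

      member? : ∀ zs ks → Decidable (member zs ks)
      member? zs ks c = rainbowFree? c ×-dec witness? A zs ks c

      family : Vec (Fin n) 3 → Vec C 3 → List (Coloring r A)
      family zs ks = filter (member? zs ks) (colorings r A)

      family-member : ∀ zs ks {c} → c ∈ family zs ks → member zs ks c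
      family-member zs ks c∈ = proj₂ (∈-filter⁻ (member? zs ks) {xs = colorings r A} c∈)

      module _ {z₁ z₂ z₃ : Fin n} {k₁ k₂ k₃ : C} (rainbow : Rainbow k₁ k₂ k₃)
               (z₁∈ : z₁ ∈ˢ A) (z₂∈ : z₂ ∈ˢ A) (z₃∈ : z₃ ∈ˢ A) (L : List (Coloring r A)) (L! : Unique L)
               (L-free : ∀ {c} → c ∈ L → RainbowFree c)
               (fixed : ∀ {c} → c ∈ L → ext A c z₁ ≡ k₁ × ext A c z₂ ≡ k₂ × ext A c z₃ ≡ k₃) where

        ℓ-bound : length L * 32 ^ m ≤ 2 ^ n * (Λ ^ D * 31 ^ m)
        ℓ-bound = family-numerics c n m s D R (length L) R≥1 (≤-trans (≤-trans (m≤n+m s (4 * m)) room) n≤cm) room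
          (subst (λ l → length L * Λ ^ (l + s) ≤ Λ ^ D * ((15 * Λ + R) ^ l * (2 * Λ + R) ^ s)) len (proj₂ (proj₂ bound)))
          where
          chains = disjoint-chains z₁ z₂ z₃ m m≥2 (m/n*n≤m n 256)
          cs = proj₁ chains
          len : length cs ≡ m
          len = proj₁ (proj₂ chains)
          bound = chains-bound r≥2 A k₀ rainbow L L! L-free z₁ z₂ z₃ z₁∈ z₂∈ z₃∈ fixed
                    cs (proj₁ (proj₂ (proj₂ chains))) (proj₂ (proj₂ (proj₂ chains)))
                    K D Λ K≥1 Λ≥1 n<K[1+D] (λ X free → roth-N X n (≤-trans (m≤m+n N _) n≥n₁) free)
          s = proj₁ bound
          room : 4 * m + s ≤ n
          room = subst (λ l → 4 * l + s ≤ n) len (proj₁ (proj₂ bound))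

        -- Strictness is recorded by `pred (2 ^ n)`, so that the bounds of all W families can be
        -- added and W cancelled with a strict inequality left. The factor 2 matches the doubling in
        -- `2*few≤few`.
        ℓ-small : 2 * W * length L ≤ pred (2 ^ n)
        ℓ-small = ≤-pred (≤-trans (*-cancelʳ-< (32 ^ m) (2 * W * length L) (2 ^ n) scaled) (≤-reflexive (sym (suc-pred (2 ^ n) {{m^n≢0 2 n}}))))
          where
          open ≤-Reasoning
          scaled : 2 * W * length L * 32 ^ m < 2 ^ n * 32 ^ m
          scaled = begin-strict
            2 * W * length L * 32 ^ m              ≡⟨ *-assoc (2 * W) (length L) (32 ^ m) ⟩
            2 * W * (length L * 32 ^ m)            ≤⟨ *-monoʳ-≤ (2 * W) ℓ-bound ⟩
            2 * W * (2 ^ n * (Λ ^ D * 31 ^ m))     ≡⟨ lemma (2 * W) (2 ^ n) (Λ ^ D * 31 ^ m) ⟩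
            2 ^ n * (2 * W * (Λ ^ D * 31 ^ m))     <⟨ *-monoʳ-< (2 ^ n) {{m^n≢0 2 n}} (gap n m D (≤-trans (m≤m+n M 2) M+2≤m) n≤cm KD≤n) ⟩
            2 ^ n * 32 ^ m                         ∎
            where
            lemma : ∀ a b d → a * (b * d) ≡ b * (a * d)
            lemma = solve-∀

      -- Any member of the family certifies that its index (zs , ks) is admissible.
      family-small : ∀ zs ks → 2 * W * length (family zs ks) ≤ pred (2 ^ n)
      family-small zs@(z₁ ∷ z₂ ∷ z₃ ∷ []) ks@(i ∷ j ∷ k ∷ []) = go (family zs ks)
        (Unique.filter⁺ (member? zs ks) (colorings-unique r A)) (family-member zs ks)
        where
        go : ∀ L → Unique L → (∀ {c} → c ∈ L → member zs ks c) → 2 * W * length L ≤ pred (2 ^ n)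
        go []         _  _         = ≤-trans (≤-reflexive (*-zeroʳ (2 * W))) z≤n
        go L@(c₀ ∷ _) L! member-of =
          let _ , (z₁∈ , z₂∈ , z₃∈ , rainbow) , _ = member-of (here refl)
          in ℓ-small rainbow z₁∈ z₂∈ z₃∈ L L! (λ c∈ → proj₁ (member-of c∈)) (λ c∈ → proj₂ (proj₂ (member-of c∈)))

      2*many<2^n : 2 * length (many A) < 2 ^ n
      2*many<2^n = ≤-trans (s≤s (*-cancelˡ-≤ W {{m^n≢0 (n * r) 3 {{m*n≢0 n r {{n≢0}} {{r≢0}}}}}} (begin
        W * (2 * length (many A))    ≡⟨ lemma W (length (many A)) ⟩
        2 * W * length (many A)      ≤⟨ many-bound A (pred (2 ^ n)) (2 * W) family-small ⟩
        W * pred (2 ^ n)             ∎))) (≤-reflexive (suc-pred (2 ^ n) {{m^n≢0 2 n}}))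
        where
        open ≤-Reasoning
        n≢0 : NonZero n
        n≢0 = >-nonZero (≤-trans (≤-trans (s≤s z≤n) m≥2) (m/n≤m n 256))
        lemma : ∀ w l → w * (2 * l) ≡ 2 * w * l
        lemma = solve-∀

      g<g : A ⊂ ⊤ → g r A < g r (⊤ {n})
      g<g (_ , a , _ , a∉A) = <-≤-trans (*-cancelˡ-< 2 (g r A) (length (few (⊤ {n}))) (begin-strict
        2 * g r A                                        ≤⟨ *-monoʳ-≤ 2 (g≤few+many A) ⟩
        2 * (length (few A) + length (many A))           ≡⟨ *-distribˡ-+ 2 (length (few A)) (length (many A)) ⟩
        2 * length (few A) + 2 * length (many A)         <⟨ +-mono-≤-< (2*few≤few A a a∉A) 2*many<2^n ⟩
        length (few (⊤ {n})) + 2 ^ n                  ≤⟨ +-monoʳ-≤ (length (few (⊤ {n}))) (2^n≤few {n}) ⟩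
        length (few (⊤ {n})) + length (few (⊤ {n})) ≡⟨ cong (length (few (⊤ {n})) +_) (+-identityʳ (length (few (⊤ {n})))) ⟨
        2 * length (few (⊤ {n}))                      ∎)) (few≤g (⊤ {n}))
        where open ≤-Reasoning

  module _ (c : ℕ) (c≡512 : c ≡ 512) where

    eventually-less : (∃[ K ] ∃[ M ] 1 ≤ K ×
        (∀ n m D → M ≤ m → n ≤ c * m → K * D ≤ n → 2 * (n * r) ^ 3 * ((R * T c) ^ D * 31 ^ m) < 32 ^ m)) →
      ∃[ n₁ ] (∀ n → n₁ ≤ n → (A : Subset n) → A ⊂ ⊤ → g r A < g r (⊤ {n}))
    eventually-less (K , M , K≥1 , gap) = with-roth (roth K K≥1)
      where
      with-roth : ∃[ N ] (∀ X n → N ≤ n → APFree X → K * count X n ≤ n) →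
                  ∃[ n₁ ] (∀ n → n₁ ≤ n → (A : Subset n) → A ⊂ ⊤ → g r A < g r (⊤ {n}))
      with-roth (N , roth-N) = Threshold.n₁ c c≡512 K M N K≥1 roth-N gap , Threshold.g<g c c≡512 K M N K≥1 roth-N gap

    eventually : ∃[ n₁ ] (∀ n → n₁ ≤ n → (A : Subset n) → A ⊂ ⊤ → g r A < g r (⊤ {n}))
    eventually = eventually-less (exponential-gap c r (R * T c) (≤-trans (s≤s z≤n) (≤-reflexive (sym c≡512))))

theorem1p4 : (r : ℕ) → r ≥ 3 → ∃[ n₁ ] ((n : ℕ) → n ≥ n₁ → (A : Subset n) → A ⊂ ⊤ → g r A < g r (⊤ {n}))
theorem1p4 r r≥3 = eventually r≥3 512 refl
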